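{- There exist positive constants $c$ and $C$ such that the following holds for $p=p(n)\in[0,1]$. 1. If $p\le c\left(\frac{\log n}{n}\right)^{1/2}$, then with high probability $\mathrm{tc}_2(G(n,n,p))\ge 4$. 2. If $p\ge C\left(\frac{\log n}{n}\right)^{1/2}$, then with high probability $G\sim G(n,n,p)$ has the following property: in every $2$-colouring of $G$, all but at most $200/p$ vertices of $G$ can be covered using at most three vertex-disjoint monochromatic trees.
   Context: $G(n,m,p)$ denotes the binomial random bipartite graph: its vertex classes are disjoint copies of $[n]$ and $[m]$, and each possible edge between the two classes appears independently with probability $p$. $\log$ is the natural logarithm. "With high probability" means with probability $1-o(1)$ as $n\to\infty$. A $2$-colouring of a graph $G$ is an arbitrary colouring of the edges of $G$ with up to $2$ colours. A monochromatic tree is a subgraph of $G$ that is a tree all of whose edges have the same colour (a single vertex counts as a monochromatic tree); different trees in a cover may have different colours. $\mathrm{tc}_2(G)$ is the smallest integer $k$ such that, in every $2$-colouring of $G$, the vertex set $V(G)$ can be covered by at most $k$ monochromatic trees (not necessarily disjoint). -}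

module Defs where

open import Data.Bool using (Bool; true; false; T; if_then_else_)
open import Data.Fin using (Fin)
open import Data.Integer as ℤ using (+_)
import Data.Integer.Properties as ℤₚ
open import Data.List as List using (List; []; _∷_; _++_; length)
open import Data.List.Membership.Propositional using (_∈_)
open import Data.List.Relation.Unary.Linked using (Linked)
open import Data.List.Relation.Unary.Unique.Propositional using (Unique)
open import Data.Nat as ℕ using (ℕ; zero; suc)
open import Data.Nat.Coprimality using (1-coprimeTo)
import Data.Nat.Properties as ℕₚ
open import Data.Product using (Σ-syntax; ∃-syntax; _×_; _,_; proj₁; proj₂)
open import Data.Rational as ℚ using (ℚ; 0ℚ; 1ℚ; ½; mkℚ; *≤*; *<*)
open import Data.Rational.Properties as ℚₚ using (≤-trans; ≤-reflexive)
open import Data.Rational.Unnormalised as ℚᵘ using (mkℚᵘ)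
import Data.Rational.Unnormalised.Properties as ℚᵘₚ
open import Data.Rational.Solver using (module +-*-Solver)
open import Data.Sum using (_⊎_; inj₁; inj₂; [_,_]′)
open import Data.Vec as Vec using (Vec; []; _∷_)
open import Relation.Binary.Construct.Closure.ReflexiveTransitive using (Star)
open import Relation.Binary.PropositionalEquality
  using (_≡_; _≢_; refl; sym; trans; cong; cong₂; subst; subst₂; module ≡-Reasoning)
open import Relation.Nullary using (¬_; contradiction)

-- Real numbers: Cauchy sequences of rationals, compared up to the
-- relations _≤ℝ_ and _<ℝ_ below (two reals are equal when each is ≤ the
-- other; no quotient is taken).

IsCauchy : (ℕ → ℚ) → Set
IsCauchy x =
  ∀ ε → 0ℚ ℚ.< ε → ∃[ N ] ∀ m n → N ℕ.≤ m → N ℕ.≤ n → ℚ.∣ x m ℚ.- x n ∣ ℚ.≤ ε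

record ℝ : Set where
  constructor mkℝ
  field
    seq    : ℕ → ℚ
    cauchy : IsCauchy seq

open ℝ

infix 4 _≤ℝ_ _<ℝ_

_≤ℝ_ : ℝ → ℝ → Set
x ≤ℝ y = ∀ ε → 0ℚ ℚ.< ε → ∃[ N ] ∀ n → N ℕ.≤ n → seq x n ℚ.≤ seq y n ℚ.+ ε

_<ℝ_ : ℝ → ℝ → Set
x <ℝ y = ∃[ δ ] 0ℚ ℚ.< δ × ∃[ N ] ∀ n → N ℕ.≤ n → seq x n ℚ.+ δ ℚ.≤ seq y n

private
  open +-*-Solver using (solve; _:+_; _:*_; :-_; _:-_; _:=_; con)

  ∣∣-≤ : ∀ {q ε} → q ℚ.≤ ε → ℚ.- q ℚ.≤ ε → ℚ.∣ q ∣ ℚ.≤ ε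
  ∣∣-≤ {q} a b with ℚₚ.∣p∣≡p∨∣p∣≡-p q
  ... | inj₁ e = ≤-trans (≤-reflexive e) a
  ... | inj₂ e = ≤-trans (≤-reflexive e) b

  q≤∣q∣ : ∀ q → q ℚ.≤ ℚ.∣ q ∣
  q≤∣q∣ q with ℚₚ.≤-total 0ℚ q
  ... | inj₁ 0≤q = ≤-reflexive (sym (ℚₚ.0≤p⇒∣p∣≡p 0≤q))
  ... | inj₂ q≤0 = ≤-trans q≤0 (ℚₚ.0≤∣p∣ q)

  -swap : ∀ a b → ℚ.- (a ℚ.- b) ≡ b ℚ.- a
  -swap = solve 2 (λ a b → :- (a :- b) := b :- a) refl

  -- the defining condition is symmetric in m and n
  fromOneSided : ∀ {x : ℕ → ℚ} →
    (∀ ε → 0ℚ ℚ.< ε → ∃[ N ] ∀ m n → N ℕ.≤ m → N ℕ.≤ n → x m ℚ.- x n ℚ.≤ ε) →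
    IsCauchy x
  fromOneSided {x} h ε ε>0 with h ε ε>0
  ... | N , b = N , λ m n Nm Nn →
    ∣∣-≤ (b m n Nm Nn) (≤-trans (≤-reflexive (-swap (x m) (x n))) (b n m Nn Nm))

  half>0 : ∀ {ε} → 0ℚ ℚ.< ε → 0ℚ ℚ.< ½ ℚ.* ε
  half>0 {ε} ε>0 = ℚₚ.positive⁻¹ (½ ℚ.* ε) {{ℚₚ.pos*pos⇒pos ½ ε {{ℚ.positive ε>0}}}}

  half+half : ∀ ε → ½ ℚ.* ε ℚ.+ ½ ℚ.* ε ≡ ε
  half+half ε = trans (sym (ℚₚ.*-distribʳ-+ ε ½ ½)) (ℚₚ.*-identityˡ ε)

  pos-* : ∀ {a b} → 0ℚ ℚ.< a → 0ℚ ℚ.< b → 0ℚ ℚ.< a ℚ.* b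
  pos-* {a} {b} a>0 b>0 =
    ℚₚ.positive⁻¹ (a ℚ.* b)
      {{ℚₚ.pos*pos⇒pos a {{ℚ.positive a>0}} b {{ℚ.positive b>0}}}}

  *-mono : ∀ {a b c d} → 0ℚ ℚ.≤ c → 0ℚ ℚ.≤ b → a ℚ.≤ b → c ℚ.≤ d → a ℚ.* c ℚ.≤ b ℚ.* d
  *-mono {a} {b} {c} {d} c≥0 b≥0 a≤b c≤d = ≤-trans
    (ℚₚ.*-monoʳ-≤-nonNeg c {{ℚ.nonNegative c≥0}} a≤b)
    (ℚₚ.*-monoˡ-≤-nonNeg b {{ℚ.nonNegative b≥0}} c≤d)

recip : (q : ℚ) → 0ℚ ℚ.< q → ℚ
recip q q>0 = (ℚ.1/ q) {{ℚ.>-nonZero q>0}}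

private
  recip>0 : ∀ q (q>0 : 0ℚ ℚ.< q) → 0ℚ ℚ.< recip q q>0
  recip>0 q q>0 = ℚₚ.positive⁻¹ (recip q q>0) {{ℚₚ.1/pos⇒pos q {{ℚ.positive q>0}}}}

  recip-inverse : ∀ q (q>0 : 0ℚ ℚ.< q) → recip q q>0 ℚ.* q ≡ 1ℚ
  recip-inverse q q>0 = ℚₚ.*-inverseˡ q {{ℚ.>-nonZero q>0}}

fromℚ : ℚ → ℝ
fromℚ q = mkℝ (λ _ → q) λ ε ε>0 → 0 , λ _ _ _ _ →
  ≤-trans (≤-reflexive (cong ℚ.∣_∣ (ℚₚ.+-inverseʳ q))) (ℚₚ.<⇒≤ ε>0)

fromℕ : ℕ → ℝ
fromℕ k = fromℚ (+ k ℚ./ 1)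

0ℝ 1ℝ : ℝ
0ℝ = fromℚ 0ℚ
1ℝ = fromℚ 1ℚ

infixl 6 _+ℝ_ _-ℝ_
infixl 7 _*ℝ_
infix  8 -ℝ_

_+ℝ_ : ℝ → ℝ → ℝ
x +ℝ y = mkℝ (λ n → seq x n ℚ.+ seq y n) isC
  where
  isC : IsCauchy (λ n → seq x n ℚ.+ seq y n)
  isC ε ε>0 with cauchy x (½ ℚ.* ε) (half>0 ε>0) | cauchy y (½ ℚ.* ε) (half>0 ε>0)
  ... | M , a | N , b = M ℕ.⊔ N , λ m n p q → begin
      ℚ.∣ (seq x m ℚ.+ seq y m) ℚ.- (seq x n ℚ.+ seq y n) ∣
        ≡⟨ cong ℚ.∣_∣ (rearrange (seq x m) (seq y m) (seq x n) (seq y n)) ⟩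
      ℚ.∣ (seq x m ℚ.- seq x n) ℚ.+ (seq y m ℚ.- seq y n) ∣
        ≤⟨ ℚₚ.∣p+q∣≤∣p∣+∣q∣ (seq x m ℚ.- seq x n) (seq y m ℚ.- seq y n) ⟩
      ℚ.∣ seq x m ℚ.- seq x n ∣ ℚ.+ ℚ.∣ seq y m ℚ.- seq y n ∣
        ≤⟨ ℚₚ.+-mono-≤ (a m n (ℕₚ.m⊔n≤o⇒m≤o M N p) (ℕₚ.m⊔n≤o⇒m≤o M N q))
                       (b m n (ℕₚ.m⊔n≤o⇒n≤o M N p) (ℕₚ.m⊔n≤o⇒n≤o M N q)) ⟩
      ½ ℚ.* ε ℚ.+ ½ ℚ.* ε
        ≡⟨ half+half ε ⟩
      ε ∎
    where
    open ℚₚ.≤-Reasoning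
    rearrange : ∀ a b c d → (a ℚ.+ b) ℚ.- (c ℚ.+ d) ≡ (a ℚ.- c) ℚ.+ (b ℚ.- d)
    rearrange = solve 4 (λ a b c d → (a :+ b) :- (c :+ d) := (a :- c) :+ (b :- d)) refl

-ℝ_ : ℝ → ℝ
-ℝ x = mkℝ (λ n → ℚ.- seq x n) λ ε ε>0 →
  let N , a = cauchy x ε ε>0 in
  N , λ m n p q →
    ≤-trans (≤-reflexive (cong ℚ.∣_∣ (flip (seq x m) (seq x n)))) (a n m q p)
  where
  flip : ∀ a b → (ℚ.- a) ℚ.- (ℚ.- b) ≡ b ℚ.- a
  flip = solve 2 (λ a b → (:- a) :- (:- b) := b :- a) refl

_-ℝ_ : ℝ → ℝ → ℝ
x -ℝ y = x +ℝ (-ℝ y)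

private
  eventuallyBounded : ∀ x → ∃[ B ] 0ℚ ℚ.< B ×
    ∃[ N ] ∀ n → N ℕ.≤ n → ℚ.∣ seq x n ∣ ℚ.≤ B
  eventuallyBounded x with cauchy x 1ℚ (ℚₚ.positive⁻¹ 1ℚ)
  ... | N , a = 1ℚ ℚ.+ ℚ.∣ seq x N ∣
    , ℚₚ.positive⁻¹ _ {{ℚₚ.pos+nonNeg⇒pos 1ℚ ℚ.∣ seq x N ∣ {{ℚₚ.∣-∣-nonNeg (seq x N)}}}}
    , N , λ n N≤n → begin
      ℚ.∣ seq x n ∣
        ≡⟨ cong ℚ.∣_∣ (split (seq x n) (seq x N)) ⟩
      ℚ.∣ (seq x n ℚ.- seq x N) ℚ.+ seq x N ∣
        ≤⟨ ℚₚ.∣p+q∣≤∣p∣+∣q∣ (seq x n ℚ.- seq x N) (seq x N) ⟩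
      ℚ.∣ seq x n ℚ.- seq x N ∣ ℚ.+ ℚ.∣ seq x N ∣
        ≤⟨ ℚₚ.+-monoˡ-≤ ℚ.∣ seq x N ∣ (a n N N≤n ℕₚ.≤-refl) ⟩
      1ℚ ℚ.+ ℚ.∣ seq x N ∣ ∎
    where
    open ℚₚ.≤-Reasoning
    split : ∀ a b → a ≡ (a ℚ.- b) ℚ.+ b
    split = solve 2 (λ a b → a := (a :- b) :+ b) refl

  times-close : ∀ a b c d A B η θ → 0ℚ ℚ.≤ A → 0ℚ ℚ.≤ θ →
    ℚ.∣ a ∣ ℚ.≤ A → ℚ.∣ d ∣ ℚ.≤ B → ℚ.∣ b ℚ.- d ∣ ℚ.≤ η → ℚ.∣ a ℚ.- c ∣ ℚ.≤ θ →
    ℚ.∣ a ℚ.* b ℚ.- c ℚ.* d ∣ ℚ.≤ A ℚ.* η ℚ.+ θ ℚ.* B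
  times-close a b c d A B η θ A≥0 θ≥0 ∣a∣≤A ∣d∣≤B b~d a~c = begin
    ℚ.∣ a ℚ.* b ℚ.- c ℚ.* d ∣
      ≡⟨ cong ℚ.∣_∣ (split a b c d) ⟩
    ℚ.∣ a ℚ.* (b ℚ.- d) ℚ.+ (a ℚ.- c) ℚ.* d ∣
      ≤⟨ ℚₚ.∣p+q∣≤∣p∣+∣q∣ (a ℚ.* (b ℚ.- d)) ((a ℚ.- c) ℚ.* d) ⟩
    ℚ.∣ a ℚ.* (b ℚ.- d) ∣ ℚ.+ ℚ.∣ (a ℚ.- c) ℚ.* d ∣
      ≡⟨ cong₂ ℚ._+_ (ℚₚ.∣p*q∣≡∣p∣*∣q∣ a (b ℚ.- d)) (ℚₚ.∣p*q∣≡∣p∣*∣q∣ (a ℚ.- c) d) ⟩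
    ℚ.∣ a ∣ ℚ.* ℚ.∣ b ℚ.- d ∣ ℚ.+ ℚ.∣ a ℚ.- c ∣ ℚ.* ℚ.∣ d ∣
      ≤⟨ ℚₚ.+-mono-≤
           {ℚ.∣ a ∣ ℚ.* ℚ.∣ b ℚ.- d ∣} {A ℚ.* η} {ℚ.∣ a ℚ.- c ∣ ℚ.* ℚ.∣ d ∣} {θ ℚ.* B}
           (*-mono {ℚ.∣ a ∣} {A} {ℚ.∣ b ℚ.- d ∣} {η} (ℚₚ.0≤∣p∣ (b ℚ.- d)) A≥0 ∣a∣≤A b~d)
           (*-mono {ℚ.∣ a ℚ.- c ∣} {θ} {ℚ.∣ d ∣} {B} (ℚₚ.0≤∣p∣ d) θ≥0 a~c ∣d∣≤B) ⟩
    A ℚ.* η ℚ.+ θ ℚ.* B ∎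
    where
    open ℚₚ.≤-Reasoning
    split : ∀ a b c d → a ℚ.* b ℚ.- c ℚ.* d ≡ a ℚ.* (b ℚ.- d) ℚ.+ (a ℚ.- c) ℚ.* d
    split = solve 4 (λ a b c d → a :* b :- c :* d := a :* (b :- d) :+ (a :- c) :* d) refl

  cancel-recip : ∀ q (q>0 : 0ℚ ℚ.< q) e → recip q q>0 ℚ.* q ℚ.* e ≡ e
  cancel-recip q q>0 e =
    trans (cong (λ z → z ℚ.* e) (recip-inverse q q>0)) (ℚₚ.*-identityˡ e)

  times-budget : ∀ A (A>0 : 0ℚ ℚ.< A) B (B>0 : 0ℚ ℚ.< B) e →
    A ℚ.* (recip A A>0 ℚ.* e) ℚ.+ (recip B B>0 ℚ.* e) ℚ.* B ≡ e ℚ.+ e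
  times-budget A A>0 B B>0 e = cong₂ ℚ._+_
    (trans (left A (recip A A>0) e) (cancel-recip A A>0 e))
    (trans (right B (recip B B>0) e) (cancel-recip B B>0 e))
    where
    left : ∀ a r e → a ℚ.* (r ℚ.* e) ≡ r ℚ.* a ℚ.* e
    left = solve 3 (λ a r e → a :* (r :* e) := r :* a :* e) refl
    right : ∀ a r e → r ℚ.* e ℚ.* a ≡ r ℚ.* a ℚ.* e
    right = solve 3 (λ a r e → r :* e :* a := r :* a :* e) refl

  times-cauchy : ∀ x y → IsCauchy (λ n → seq x n ℚ.* seq y n)
  times-cauchy x y ε ε>0 =
    let A , A>0 , K , a = eventuallyBounded x
        B , B>0 , L , b = eventuallyBounded y
        e = ½ ℚ.* ε
        θ>0 = pos-* {recip B B>0} {e} (recip>0 B B>0) (half>0 ε>0)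
        η>0 = pos-* {recip A A>0} {e} (recip>0 A A>0) (half>0 ε>0)
        M , c = cauchy x (recip B B>0 ℚ.* e) θ>0
        N , d = cauchy y (recip A A>0 ℚ.* e) η>0
    in (K ℕ.⊔ L) ℕ.⊔ (M ℕ.⊔ N) , λ m n p q →
      let KL≤m = ℕₚ.m⊔n≤o⇒m≤o (K ℕ.⊔ L) (M ℕ.⊔ N) p
          KL≤n = ℕₚ.m⊔n≤o⇒m≤o (K ℕ.⊔ L) (M ℕ.⊔ N) q
          MN≤m = ℕₚ.m⊔n≤o⇒n≤o (K ℕ.⊔ L) (M ℕ.⊔ N) p
          MN≤n = ℕₚ.m⊔n≤o⇒n≤o (K ℕ.⊔ L) (M ℕ.⊔ N) q
      in ≤-trans
        (times-close (seq x m) (seq y m) (seq x n) (seq y n)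
          A B (recip A A>0 ℚ.* e) (recip B B>0 ℚ.* e) (ℚₚ.<⇒≤ A>0) (ℚₚ.<⇒≤ θ>0)
          (a m (ℕₚ.m⊔n≤o⇒m≤o K L KL≤m)) (b n (ℕₚ.m⊔n≤o⇒n≤o K L KL≤n))
          (d m n (ℕₚ.m⊔n≤o⇒n≤o M N MN≤m) (ℕₚ.m⊔n≤o⇒n≤o M N MN≤n))
          (c m n (ℕₚ.m⊔n≤o⇒m≤o M N MN≤m) (ℕₚ.m⊔n≤o⇒m≤o M N MN≤n)))
        (≤-reflexive (trans (times-budget A A>0 B B>0 e) (half+half ε)))

_*ℝ_ : ℝ → ℝ → ℝ
x *ℝ y = mkℝ (λ n → seq x n ℚ.* seq y n) (times-cauchy x y)

-- The witness δ of 0 <ℝ x only keeps the finitely many early terms away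
-- from 0; it does not affect the value of the inverse.
inv : (x : ℝ) → 0ℝ <ℝ x → ℝ
inv x (δ , δ>0 , N , pos) = mkℝ (λ n → recip (y n) (y>0 n)) (fromOneSided {λ n → recip (y n) (y>0 n)} isC)
  where
  y : ℕ → ℚ
  y n = seq x n ℚ.⊔ δ
  y≥δ : ∀ n → δ ℚ.≤ y n
  y≥δ n = ℚₚ.p≤q⊔p (seq x n) δ
  y>0 : ∀ n → 0ℚ ℚ.< y n
  y>0 n = ℚₚ.<-≤-trans δ>0 (y≥δ n)
  y≡x : ∀ n → N ℕ.≤ n → y n ≡ seq x n
  y≡x n N≤n = ℚₚ.p≥q⇒p⊔q≡p (≤-trans (≤-reflexive (sym (ℚₚ.+-identityˡ δ))) (pos n N≤n))
  isC : ∀ ε → 0ℚ ℚ.< ε → ∃[ M ] ∀ m n → M ℕ.≤ m → M ℕ.≤ n →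
        recip (y m) (y>0 m) ℚ.- recip (y n) (y>0 n) ℚ.≤ ε
  isC ε ε>0 with cauchy x (ε ℚ.* (δ ℚ.* δ)) (pos-* ε>0 (pos-* δ>0 δ>0))
  ... | M , a = N ℕ.⊔ M , λ m n p q →
      let r = recip (y m) (y>0 m) ; s = recip (y n) (y>0 n)
          ym>0 = y>0 m ; yn>0 = y>0 n
          rr = recip-inverse (y m) ym>0 ; ss = recip-inverse (y n) yn>0
      in ℚₚ.*-cancelʳ-≤-pos (y m ℚ.* y n) {{ℚ.positive (pos-* ym>0 yn>0)}} (begin
        (r ℚ.- s) ℚ.* (y m ℚ.* y n)
          ≡⟨ expand r s (y m) (y n) ⟩
        (r ℚ.* y m) ℚ.* y n ℚ.- (s ℚ.* y n) ℚ.* y m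
          ≡⟨ cong₂ ℚ._-_ (cancel rr) (cancel ss) ⟩
        y n ℚ.- y m
          ≡⟨ cong₂ ℚ._-_ (y≡x n (ℕₚ.m⊔n≤o⇒m≤o N M q)) (y≡x m (ℕₚ.m⊔n≤o⇒m≤o N M p)) ⟩
        seq x n ℚ.- seq x m
          ≤⟨ q≤∣q∣ (seq x n ℚ.- seq x m) ⟩
        ℚ.∣ seq x n ℚ.- seq x m ∣
          ≤⟨ a n m (ℕₚ.m⊔n≤o⇒n≤o N M q) (ℕₚ.m⊔n≤o⇒n≤o N M p) ⟩
        ε ℚ.* (δ ℚ.* δ)
          ≤⟨ ℚₚ.*-monoˡ-≤-nonNeg ε {{ℚ.nonNegative (ℚₚ.<⇒≤ ε>0)}}
               (*-mono (ℚₚ.<⇒≤ δ>0) (ℚₚ.<⇒≤ ym>0) (y≥δ m) (y≥δ n)) ⟩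
        ε ℚ.* (y m ℚ.* y n) ∎)
    where
    open ℚₚ.≤-Reasoning
    expand : ∀ r s a b → (r ℚ.- s) ℚ.* (a ℚ.* b) ≡ (r ℚ.* a) ℚ.* b ℚ.- (s ℚ.* b) ℚ.* a
    expand = solve 4 (λ r s a b → (r :- s) :* (a :* b) := (r :* a) :* b :- (s :* b) :* a) refl
    cancel : ∀ {r e} → r ≡ 1ℚ → r ℚ.* e ≡ e
    cancel {e = e} refl = ℚₚ.*-identityˡ e

private
  unit≡ : ∀ k → + 1 ℚ./ suc k ≡ mkℚ (+ 1) k (1-coprimeTo (suc k))
  unit≡ k = ℚₚ.normalize-coprime (1-coprimeTo (suc k))

  unit-anti : ∀ {k l} → k ℕ.≤ l → + 1 ℚ./ suc l ℚ.≤ + 1 ℚ./ suc k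
  unit-anti {k} {l} k≤l = subst₂ ℚ._≤_ (sym (unit≡ l)) (sym (unit≡ k))
    (*≤* (ℤₚ.*-monoˡ-≤-nonNeg (+ 1) (ℤ.+≤+ (ℕ.s≤s k≤l))))

  unit≥0 : ∀ k → 0ℚ ℚ.≤ + 1 ℚ./ suc k
  unit≥0 k = ℚₚ.nonNegative⁻¹ (+ 1 ℚ./ suc k) {{ℚₚ.normalize-nonNeg 1 (suc k)}}

  archimedean : ∀ ε → 0ℚ ℚ.< ε → ∃[ k ] + 1 ℚ./ suc k ℚ.≤ ε
  archimedean (mkℚ ℤ.+[1+ a ] d c) _ = d , subst (ℚ._≤ mkℚ ℤ.+[1+ a ] d c) (sym (unit≡ d))
    (*≤* (ℤₚ.*-monoʳ-≤-nonNeg (+ suc d) {+ 1} {+ suc a} (ℤ.+≤+ (ℕ.s≤s ℕ.z≤n))))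
  archimedean (mkℚ (+ 0) d c) (*<* (ℤ.+<+ ()))
  archimedean (mkℚ ℤ.-[1+ a ] d c) (*<* ())

  n*unit : ∀ n → (+ suc n ℚ./ 1) ℚ.* (+ 1 ℚ./ suc n) ≡ 1ℚ
  n*unit n = ℚₚ.toℚᵘ-injective (ℚᵘₚ.≃-trans
    (ℚₚ.toℚᵘ-homo-* (+ suc n ℚ./ 1) (+ 1 ℚ./ suc n))
    (ℚᵘₚ.≃-trans
      (ℚᵘₚ.*-cong (ℚₚ.toℚᵘ-fromℚᵘ (mkℚᵘ (+ suc n) 0)) (ℚₚ.toℚᵘ-fromℚᵘ (mkℚᵘ (+ 1) n)))
      (ℚᵘ.*≡* (trans (ℤₚ.*-identityʳ _) (trans (ℤₚ.*-identityʳ (+ suc n))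
        (sym (trans (ℤₚ.*-identityˡ _) (ℤₚ.*-identityˡ (+ suc n)))))))))

-- Natural logarithm of a positive integer, by the Mercator series
-- log n = - log (1 - x) = Σ_{k ≥ 1} x ^ k / k  at  x = 1 - 1/n.

_^ℚ_ : ℚ → ℕ → ℚ
x ^ℚ zero  = 1ℚ
x ^ℚ suc k = x ℚ.* x ^ℚ k

mercatorTerm : ℚ → ℕ → ℚ
mercatorTerm x k = x ^ℚ suc k ℚ.* (+ 1 ℚ./ suc k)

mercatorSum : ℚ → ℕ → ℚ
mercatorSum x zero    = 0ℚ
mercatorSum x (suc N) = mercatorSum x N ℚ.+ mercatorTerm x N

private
  module Mercator (k : ℕ) where
    n = + suc k ℚ./ 1
    v = + 1 ℚ./ suc k
    x = 1ℚ ℚ.- v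
    S = mercatorSum x
    u = mercatorTerm x

    n≥0 : 0ℚ ℚ.≤ n
    n≥0 = ℚₚ.nonNegative⁻¹ n {{ℚₚ.normalize-nonNeg (suc k) 1}}

    x≥0 : 0ℚ ℚ.≤ x
    x≥0 = subst (ℚ._≤ x) (ℚₚ.+-inverseʳ v) (ℚₚ.+-monoˡ-≤ (ℚ.- v) (unit-anti {0} {k} ℕ.z≤n))

    x≤1 : x ℚ.≤ 1ℚ
    x≤1 = subst (x ℚ.≤_) (ℚₚ.+-identityʳ 1ℚ) (ℚₚ.+-monoʳ-≤ 1ℚ (ℚₚ.neg-antimono-≤ (unit≥0 k)))

    pow≥0 : ∀ j → 0ℚ ℚ.≤ x ^ℚ j
    pow≥0 zero    = ℚₚ.nonNegative⁻¹ 1ℚ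
    pow≥0 (suc j) = subst (ℚ._≤ x ℚ.* x ^ℚ j) (ℚₚ.*-zeroʳ x)
      (ℚₚ.*-monoˡ-≤-nonNeg x {{ℚ.nonNegative x≥0}} (pow≥0 j))

    pow≤1 : ∀ j → x ^ℚ j ℚ.≤ 1ℚ
    pow≤1 zero    = ℚₚ.≤-refl
    pow≤1 (suc j) = subst (x ℚ.* x ^ℚ j ℚ.≤_) (ℚₚ.*-identityˡ 1ℚ)
      (*-mono {x} {1ℚ} {x ^ℚ j} {1ℚ} (pow≥0 j) (ℚₚ.nonNegative⁻¹ 1ℚ) x≤1 (pow≤1 j))

    u≥0 : ∀ j → 0ℚ ℚ.≤ u j
    u≥0 j = subst (ℚ._≤ u j) (ℚₚ.*-zeroʳ (x ^ℚ suc j))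
      (ℚₚ.*-monoˡ-≤-nonNeg (x ^ℚ suc j) {{ℚ.nonNegative (pow≥0 (suc j))}} (unit≥0 j))

    u≤unit : ∀ j → u j ℚ.≤ + 1 ℚ./ suc j
    u≤unit j = subst (u j ℚ.≤_) (ℚₚ.*-identityˡ (+ 1 ℚ./ suc j))
      (ℚₚ.*-monoʳ-≤-nonNeg (+ 1 ℚ./ suc j) {{ℚ.nonNegative (unit≥0 j)}} (pow≤1 (suc j)))

    u-step : ∀ j → u (suc j) ℚ.≤ x ℚ.* u j
    u-step j = subst (u (suc j) ℚ.≤_) (ℚₚ.*-assoc x (x ^ℚ suc j) (+ 1 ℚ./ suc j))
      (ℚₚ.*-monoˡ-≤-nonNeg (x ^ℚ suc (suc j)) {{ℚ.nonNegative (pow≥0 (suc (suc j)))}}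
        (unit-anti (ℕₚ.n≤1+n j)))

    S-mono : ∀ {M N} → N ℕ.≤′ M → S N ℚ.≤ S M
    S-mono ℕ.≤′-refl = ℚₚ.≤-refl
    S-mono {suc M} {N} (ℕ.≤′-step N≤M) = ≤-trans (S-mono N≤M)
      (subst (ℚ._≤ S (suc M)) (ℚₚ.+-identityʳ (S M)) (ℚₚ.+-monoʳ-≤ (S M) (u≥0 M)))

    absorb : ∀ y → y ℚ.+ n ℚ.* (x ℚ.* y) ≡ n ℚ.* y
    absorb y = begin
      y ℚ.+ n ℚ.* (x ℚ.* y)              ≡⟨ ring n v y ⟩
      n ℚ.* y ℚ.+ (1ℚ ℚ.- n ℚ.* v) ℚ.* y ≡⟨ cong (λ z → n ℚ.* y ℚ.+ (1ℚ ℚ.- z) ℚ.* y) (n*unit k) ⟩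
      n ℚ.* y ℚ.+ 0ℚ ℚ.* y               ≡⟨ cong (n ℚ.* y ℚ.+_) (ℚₚ.*-zeroˡ y) ⟩
      n ℚ.* y ℚ.+ 0ℚ                     ≡⟨ ℚₚ.+-identityʳ (n ℚ.* y) ⟩
      n ℚ.* y                            ∎
      where
      open ≡-Reasoning
      ring : ∀ n v y → y ℚ.+ n ℚ.* ((1ℚ ℚ.- v) ℚ.* y) ≡ n ℚ.* y ℚ.+ (1ℚ ℚ.- n ℚ.* v) ℚ.* y
      ring = solve 3 (λ n v y → y :+ n :* ((con 1ℚ :- v) :* y)
                             := n :* y :+ (con 1ℚ :- n :* v) :* y) refl

    tail : ∀ {M N} → N ℕ.≤′ M → S M ℚ.+ n ℚ.* u M ℚ.≤ S N ℚ.+ n ℚ.* u N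
    tail ℕ.≤′-refl = ℚₚ.≤-refl
    tail {suc M} {N} (ℕ.≤′-step N≤M) = begin
      S M ℚ.+ u M ℚ.+ n ℚ.* u (suc M)
        ≡⟨ ℚₚ.+-assoc (S M) (u M) (n ℚ.* u (suc M)) ⟩
      S M ℚ.+ (u M ℚ.+ n ℚ.* u (suc M))
        ≤⟨ ℚₚ.+-monoʳ-≤ (S M) (ℚₚ.+-monoʳ-≤ (u M)
             (ℚₚ.*-monoˡ-≤-nonNeg n {{ℚ.nonNegative n≥0}} (u-step M))) ⟩
      S M ℚ.+ (u M ℚ.+ n ℚ.* (x ℚ.* u M))
        ≡⟨ cong (S M ℚ.+_) (absorb (u M)) ⟩
      S M ℚ.+ n ℚ.* u M
        ≤⟨ tail N≤M ⟩
      S N ℚ.+ n ℚ.* u N ∎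
      where open ℚₚ.≤-Reasoning

    tail≤ : ∀ {M N} → N ℕ.≤ M → S M ℚ.≤ S N ℚ.+ n ℚ.* (+ 1 ℚ./ suc N)
    tail≤ {M} {N} N≤M = begin
      S M                ≡⟨ ℚₚ.+-identityʳ (S M) ⟨
      S M ℚ.+ 0ℚ         ≡⟨ cong (S M ℚ.+_) (ℚₚ.*-zeroʳ n) ⟨
      S M ℚ.+ n ℚ.* 0ℚ
        ≤⟨ ℚₚ.+-monoʳ-≤ (S M) (ℚₚ.*-monoˡ-≤-nonNeg n {{ℚ.nonNegative n≥0}} (u≥0 M)) ⟩
      S M ℚ.+ n ℚ.* u M  ≤⟨ tail (ℕₚ.≤⇒≤′ N≤M) ⟩
      S N ℚ.+ n ℚ.* u N
        ≤⟨ ℚₚ.+-monoʳ-≤ (S N) (ℚₚ.*-monoˡ-≤-nonNeg n {{ℚ.nonNegative n≥0}} (u≤unit N)) ⟩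
      S N ℚ.+ n ℚ.* (+ 1 ℚ./ suc N) ∎
      where open ℚₚ.≤-Reasoning

    isC : ∀ ε → 0ℚ ℚ.< ε → ∃[ N ] ∀ a b → N ℕ.≤ a → N ℕ.≤ b → S a ℚ.- S b ℚ.≤ ε
    isC ε ε>0 =
      let v>0 = subst (0ℚ ℚ.<_) (sym (unit≡ k)) (ℚₚ.positive⁻¹ (mkℚ (+ 1) k _))
          N , N-small = archimedean (v ℚ.* ε) (pos-* {v} {ε} v>0 ε>0)
      in N , λ a b N≤a N≤b → begin
        S a ℚ.- S b
          ≤⟨ ℚₚ.+-mono-≤ (tail≤ N≤a) (ℚₚ.neg-antimono-≤ (S-mono (ℕₚ.≤⇒≤′ N≤b))) ⟩
        S N ℚ.+ n ℚ.* (+ 1 ℚ./ suc N) ℚ.- S N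
          ≡⟨ drop (S N) (n ℚ.* (+ 1 ℚ./ suc N)) ⟩
        n ℚ.* (+ 1 ℚ./ suc N)
          ≤⟨ ℚₚ.*-monoˡ-≤-nonNeg n {{ℚ.nonNegative n≥0}} N-small ⟩
        n ℚ.* (v ℚ.* ε)   ≡⟨ ℚₚ.*-assoc n v ε ⟨
        n ℚ.* v ℚ.* ε     ≡⟨ cong (ℚ._* ε) (n*unit k) ⟩
        1ℚ ℚ.* ε          ≡⟨ ℚₚ.*-identityˡ ε ⟩
        ε ∎
      where
      open ℚₚ.≤-Reasoning
      drop : ∀ a b → a ℚ.+ b ℚ.- a ≡ b
      drop = solve 2 (λ a b → a :+ b :- a := b) refl

log : (n : ℕ) → .{{_ : ℕ.NonZero n}} → ℝ
log n@(suc k) = mkℝ (mercatorSum (1ℚ ℚ.- + 1 ℚ./ n))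
  (fromOneSided {mercatorSum (1ℚ ℚ.- + 1 ℚ./ n)} (Mercator.isC k))

-- Square root.  √ x has as n-th term a rational root of the n-th term of x,
-- accurate to 1/(n+1); roots of negative numbers are 0.

record IsRoot (k : ℕ) (q s : ℚ) : Set where
  field
    s≥0   : 0ℚ ℚ.≤ s
    below : 0ℚ ℚ.< s → s ℚ.* s ℚ.≤ q
    above : q ℚ.< (s ℚ.+ (+ 1 ℚ./ suc k)) ℚ.* (s ℚ.+ (+ 1 ℚ./ suc k))

private
  largest : (ℕ → Bool) → ℕ → ℕ
  largest P zero    = zero
  largest P (suc b) = if P (suc b) then suc b else largest P b

  record IsLargest (P : ℕ → Bool) (r : ℕ) : Set where
    field
      sat : r ≡ 0 ⊎ T (P r)
      max : ¬ T (P (suc r))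

  largest-spec : ∀ P b → ¬ T (P (suc b)) → IsLargest P (largest P b)
  largest-spec P zero    ¬p = record { sat = inj₁ refl ; max = ¬p }
  largest-spec P (suc b) ¬p with P (suc b) in eq
  ... | true  = record { sat = inj₂ (subst T (sym eq) _) ; max = ¬p }
  ... | false = largest-spec P b (subst T eq)

  module Sqrt (k : ℕ) (q : ℚ) where
    grid : ℕ → ℚ
    grid j = + j ℚ./ suc k

    P : ℕ → Bool
    P j = grid j ℚ.* grid j ℚ.≤ᵇ q

    P⇒≤ : ∀ j → T (P j) → grid j ℚ.* grid j ℚ.≤ q
    P⇒≤ j = ℚₚ.≤ᵇ⇒≤ {grid j ℚ.* grid j} {q}

    ≤⇒P : ∀ j → grid j ℚ.* grid j ℚ.≤ q → T (P j)
    ≤⇒P j = ℚₚ.≤⇒≤ᵇ {grid j ℚ.* grid j} {q}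

    bound : ℕ
    bound = suc k ℕ.* suc ℤ.∣ ℚ.↥ q ∣

    gridᵘ : ∀ j → ℚ.toℚᵘ (grid j) ℚᵘ.≃ mkℚᵘ (+ j) k
    gridᵘ j = ℚₚ.toℚᵘ-fromℚᵘ (mkℚᵘ (+ j) k)

    grid-mono : ∀ {i j} → i ℕ.≤ j → grid i ℚ.≤ grid j
    grid-mono {i} {j} i≤j = ℚₚ.toℚᵘ-cancel-≤ (ℚᵘₚ.≤-respˡ-≃ (ℚᵘₚ.≃-sym (gridᵘ i))
      (ℚᵘₚ.≤-respʳ-≃ (ℚᵘₚ.≃-sym (gridᵘ j))
        (ℚᵘ.*≤* (ℤₚ.*-monoʳ-≤-nonNeg (+ suc k) (ℤ.+≤+ i≤j)))))

    grid-suc : ∀ j → grid (suc j) ≡ grid j ℚ.+ (+ 1 ℚ./ suc k)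
    grid-suc j = ℚₚ.toℚᵘ-injective (ℚᵘₚ.≃-trans (gridᵘ (suc j)) (ℚᵘₚ.≃-trans
      (ℚᵘ.*≡* numerators)
      (ℚᵘₚ.≃-sym (ℚᵘₚ.≃-trans (ℚₚ.toℚᵘ-homo-+ (grid j) (+ 1 ℚ./ suc k))
        (ℚᵘₚ.+-cong (gridᵘ j) (gridᵘ 1))))))
      where
      numerators : + suc j ℤ.* (+ (suc k ℕ.* suc k))
                 ≡ (+ j ℤ.* + suc k ℤ.+ + 1 ℤ.* + suc k) ℤ.* + suc k
      numerators = trans (cong (+ suc j ℤ.*_) (ℤₚ.pos-* (suc k) (suc k)))
        (trans (sym (ℤₚ.*-assoc (+ suc j) (+ suc k) (+ suc k)))
          (cong (ℤ._* + suc k)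
            (trans (cong (ℤ._* + suc k) (ℤₚ.+-comm (+ 1) (+ j)))
              (ℤₚ.*-distribʳ-+ (+ suc k) (+ j) (+ 1)))))

    grid≥0 : ∀ j → 0ℚ ℚ.≤ grid j
    grid≥0 j = ℚₚ.nonNegative⁻¹ (grid j) {{ℚₚ.normalize-nonNeg j (suc k)}}

    Z : ℚ
    Z = + suc ℤ.∣ ℚ.↥ q ∣ ℚ./ 1

    Zᵘ : ℚ.toℚᵘ Z ℚᵘ.≃ mkℚᵘ (+ suc ℤ.∣ ℚ.↥ q ∣) 0
    Zᵘ = ℚₚ.toℚᵘ-fromℚᵘ (mkℚᵘ (+ suc ℤ.∣ ℚ.↥ q ∣) 0)

    gridBound : grid bound ≡ Z
    gridBound = ℚₚ.toℚᵘ-injective (ℚᵘₚ.≃-trans (gridᵘ bound) (ℚᵘₚ.≃-trans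
      (ℚᵘ.*≡* (trans (ℤₚ.*-identityʳ (+ bound))
        (trans (cong +_ (ℕₚ.*-comm (suc k) (suc ℤ.∣ ℚ.↥ q ∣)))
               (ℤₚ.pos-* (suc ℤ.∣ ℚ.↥ q ∣) (suc k)))))
      (ℚᵘₚ.≃-sym Zᵘ)))

    Z≥1 : 1ℚ ℚ.≤ Z
    Z≥1 = ℚₚ.toℚᵘ-cancel-≤ (ℚᵘₚ.≤-respʳ-≃ (ℚᵘₚ.≃-sym Zᵘ)
      (ℚᵘ.*≤* (ℤₚ.*-monoʳ-≤-nonNeg (+ 1) (ℤ.+≤+ (ℕ.s≤s (ℕ.z≤n {ℤ.∣ ℚ.↥ q ∣}))))))

    q<Z : q ℚ.< Z
    q<Z = ℚₚ.toℚᵘ-cancel-< (ℚᵘₚ.<-respʳ-≃ (ℚᵘₚ.≃-sym Zᵘ) (ℚᵘ.*<* (below q)))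
      where
      below : ∀ q → ℚᵘ.↥ (ℚ.toℚᵘ q) ℤ.* + 1 ℤ.< + suc ℤ.∣ ℚ.↥ q ∣ ℤ.* ℚᵘ.↧ (ℚ.toℚᵘ q)
      below (mkℚ (+ a) d _) = subst₂ ℤ._<_
        (sym (ℤₚ.*-identityʳ (+ a))) (ℤₚ.pos-* (suc a) (suc d))
        (ℤ.+<+ (ℕₚ.m≤m*n (suc a) (suc d)))
      below (mkℚ ℤ.-[1+ a ] d _) = subst₂ ℤ._<_
        (sym (ℤₚ.*-identityʳ ℤ.-[1+ a ])) (ℤₚ.pos-* (suc (suc a)) (suc d))
        ℤ.-<+

    overshoot : ¬ T (P (suc bound))
    overshoot p = ℚₚ.<-irrefl refl (ℚₚ.<-≤-trans q<Z (begin
      Z                                     ≡⟨ ℚₚ.*-identityˡ Z ⟨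
      1ℚ ℚ.* Z                              ≤⟨ *-mono {1ℚ} {g} {Z} {g} (≤-trans 0≤1 Z≥1) (grid≥0 (suc bound)) (≤-trans Z≥1 Z≤g) Z≤g ⟩
      g ℚ.* g                               ≤⟨ P⇒≤ (suc bound) p ⟩
      q                                     ∎))
      where
      open ℚₚ.≤-Reasoning
      g = grid (suc bound)
      0≤1 = ℚₚ.nonNegative⁻¹ 1ℚ
      Z≤g : Z ℚ.≤ g
      Z≤g = subst (ℚ._≤ g) gridBound (grid-mono (ℕₚ.n≤1+n bound))

    isRoot : ∀ r → IsLargest P r → IsRoot k q (grid r)
    isRoot r l = record
      { s≥0   = grid≥0 r
      ; below = λ r>0 → [ (λ r≡0 → contradiction r>0 (ℚₚ.<-irrefl
                            (sym (trans (cong grid r≡0) (ℚₚ.0/n≡0 (suc k))))))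
                        , P⇒≤ r ]′ (IsLargest.sat l)
      ; above = subst (λ z → q ℚ.< z ℚ.* z) (grid-suc r)
          (ℚₚ.≰⇒> {grid (suc r) ℚ.* grid (suc r)} {q}
            (λ le → IsLargest.max l (≤⇒P (suc r) le)))
      }

    toRoot : (∃[ r ] IsLargest P r) → ∃[ s ] IsRoot k q s
    toRoot (r , l) = grid r , isRoot r l

    result : ∃[ s ] IsRoot k q s
    result = toRoot (largest P bound , largest-spec P bound overshoot)

approxRoot : ∀ k q → ∃[ s ] IsRoot k q s
approxRoot = Sqrt.result

sqrtℚ : ℕ → ℚ → ℚ
sqrtℚ k q = proj₁ (approxRoot k q)

private
  sqrt-close : ∀ k l a b s t → IsRoot k a s → IsRoot l b t → ∀ h → 0ℚ ℚ.< h → + 1 ℚ./ suc l ℚ.≤ h → a ℚ.- b ℚ.≤ h ℚ.* h →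
    s ℚ.- t ℚ.≤ h ℚ.+ h
  sqrt-close k l a b s t rs rt h h>0 fine a-b≤h² = ℚₚ.≮⇒≥ {h ℚ.+ h} {s ℚ.- t} λ far →
    let
      t+h≥0 : 0ℚ ℚ.≤ t ℚ.+ h
      t+h≥0 = ≤-trans h≥0 (shift≤ t h t≥0)
      far′ : t ℚ.+ h ℚ.+ h ℚ.< s
      far′ = subst₂ ℚ._<_ (e₁ t h) (e₂ s t) (ℚₚ.+-monoˡ-< t far)
      w≥0 : 0ℚ ℚ.≤ t ℚ.+ h ℚ.+ h
      w≥0 = ≤-trans t+h≥0 (shift≤′ (t ℚ.+ h) h h≥0)
    in ℚₚ.<-irrefl refl (begin-strict
      b ℚ.+ h ℚ.* h
        <⟨ ℚₚ.+-monoˡ-< (h ℚ.* h) (T.above) ⟩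
      (t ℚ.+ (+ 1 ℚ./ suc l)) ℚ.* (t ℚ.+ (+ 1 ℚ./ suc l)) ℚ.+ h ℚ.* h
        ≤⟨ ℚₚ.+-monoˡ-≤ (h ℚ.* h)
             (*-mono {t ℚ.+ (+ 1 ℚ./ suc l)} {t ℚ.+ h} {t ℚ.+ (+ 1 ℚ./ suc l)} {t ℚ.+ h}
               (≤-trans (unit≥0 l) (shift≤ t (+ 1 ℚ./ suc l) t≥0)) t+h≥0
               (ℚₚ.+-monoʳ-≤ t fine) (ℚₚ.+-monoʳ-≤ t fine)) ⟩
      (t ℚ.+ h) ℚ.* (t ℚ.+ h) ℚ.+ h ℚ.* h
        ≤⟨ shift≤′ ((t ℚ.+ h) ℚ.* (t ℚ.+ h) ℚ.+ h ℚ.* h)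
             ((t ℚ.+ h) ℚ.* h ℚ.+ (t ℚ.+ h) ℚ.* h) cross≥0 ⟩
      (t ℚ.+ h) ℚ.* (t ℚ.+ h) ℚ.+ h ℚ.* h ℚ.+ ((t ℚ.+ h) ℚ.* h ℚ.+ (t ℚ.+ h) ℚ.* h)
        ≡⟨ e₃ t h ⟩
      (t ℚ.+ h ℚ.+ h) ℚ.* (t ℚ.+ h ℚ.+ h)
        ≤⟨ *-mono {t ℚ.+ h ℚ.+ h} {s} {t ℚ.+ h ℚ.+ h} {s} w≥0 (S.s≥0)
             (ℚₚ.<⇒≤ far′) (ℚₚ.<⇒≤ far′) ⟩
      s ℚ.* s
        ≤⟨ S.below (ℚₚ.≤-<-trans w≥0 far′) ⟩
      a
        ≡⟨ e₄ a b ⟩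
      b ℚ.+ (a ℚ.- b)
        ≤⟨ ℚₚ.+-monoʳ-≤ b a-b≤h² ⟩
      b ℚ.+ h ℚ.* h ∎)
    where
    open ℚₚ.≤-Reasoning
    module S = IsRoot rs
    module T = IsRoot rt
    h≥0 = ℚₚ.<⇒≤ h>0
    t≥0 = T.s≥0
    shift≤ : ∀ a b → 0ℚ ℚ.≤ a → b ℚ.≤ a ℚ.+ b
    shift≤ a b a≥0 = subst (ℚ._≤ a ℚ.+ b) (ℚₚ.+-identityˡ b) (ℚₚ.+-monoˡ-≤ b a≥0)
    shift≤′ : ∀ a b → 0ℚ ℚ.≤ b → a ℚ.≤ a ℚ.+ b
    shift≤′ a b b≥0 = subst (ℚ._≤ a ℚ.+ b) (ℚₚ.+-identityʳ a) (ℚₚ.+-monoʳ-≤ a b≥0)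
    prod≥0 : ∀ a b → 0ℚ ℚ.≤ a → 0ℚ ℚ.≤ b → 0ℚ ℚ.≤ a ℚ.* b
    prod≥0 a b a≥0 b≥0 = subst (ℚ._≤ a ℚ.* b) (ℚₚ.*-zeroʳ a)
      (ℚₚ.*-monoˡ-≤-nonNeg a {{ℚ.nonNegative a≥0}} b≥0)
    cross : 0ℚ ℚ.≤ (t ℚ.+ h) ℚ.* h
    cross = prod≥0 (t ℚ.+ h) h (≤-trans h≥0 (shift≤ t h t≥0)) h≥0
    cross≥0 : 0ℚ ℚ.≤ (t ℚ.+ h) ℚ.* h ℚ.+ (t ℚ.+ h) ℚ.* h
    cross≥0 = ≤-trans cross (shift≤ ((t ℚ.+ h) ℚ.* h) ((t ℚ.+ h) ℚ.* h) cross)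
    e₁ : ∀ t h → h ℚ.+ h ℚ.+ t ≡ t ℚ.+ h ℚ.+ h
    e₁ = solve 2 (λ t h → h :+ h :+ t := t :+ h :+ h) refl
    e₂ : ∀ s t → s ℚ.- t ℚ.+ t ≡ s
    e₂ = solve 2 (λ s t → s :- t :+ t := s) refl
    e₃ : ∀ t h →
      (t ℚ.+ h) ℚ.* (t ℚ.+ h) ℚ.+ h ℚ.* h ℚ.+ ((t ℚ.+ h) ℚ.* h ℚ.+ (t ℚ.+ h) ℚ.* h)
        ≡ (t ℚ.+ h ℚ.+ h) ℚ.* (t ℚ.+ h ℚ.+ h)
    e₃ = solve 2 (λ t h →
      (t :+ h) :* (t :+ h) :+ h :* h :+ ((t :+ h) :* h :+ (t :+ h) :* h)
        := (t :+ h :+ h) :* (t :+ h :+ h)) refl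
    e₄ : ∀ a b → a ≡ b ℚ.+ (a ℚ.- b)
    e₄ = solve 2 (λ a b → a := b :+ (a :- b)) refl

  sqrt-cauchy : ∀ x ε → 0ℚ ℚ.< ε → ∃[ N ] ∀ m n → N ℕ.≤ m → N ℕ.≤ n →
    sqrtℚ m (seq x m) ℚ.- sqrtℚ n (seq x n) ℚ.≤ ε
  sqrt-cauchy x ε ε>0 =
    let h = ½ ℚ.* ε
        h>0 = half>0 ε>0
        K , fine = archimedean h h>0
        M , a = cauchy x (h ℚ.* h) (pos-* {h} {h} h>0 h>0)
    in K ℕ.⊔ M , λ m n p q → subst
      (λ z → sqrtℚ m (seq x m) ℚ.- sqrtℚ n (seq x n) ℚ.≤ z) (half+half ε)
      (sqrt-close m n (seq x m) (seq x n) (sqrtℚ m (seq x m)) (sqrtℚ n (seq x n))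
        (proj₂ (approxRoot m (seq x m))) (proj₂ (approxRoot n (seq x n))) h h>0
        (≤-trans (unit-anti (ℕₚ.m⊔n≤o⇒m≤o K M q)) fine)
        (≤-trans (q≤∣q∣ (seq x m ℚ.- seq x n))
          (a m n (ℕₚ.m⊔n≤o⇒n≤o K M p) (ℕₚ.m⊔n≤o⇒n≤o K M q))))

√ : ℝ → ℝ
√ x = mkℝ (λ n → sqrtℚ n (seq x n))
  (fromOneSided {λ n → sqrtℚ n (seq x n)} (sqrt-cauchy x))

record Graph : Set₁ where
  field
    V      : Set
    adj    : V → V → Bool
    symm   : ∀ u v → T (adj u v) → T (adj v u)
    irrefl : ∀ v → ¬ T (adj v v)

module _ (G : Graph) where
  open Graph G

  record Subgraph : Set where
    field
      inV   : V → Bool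
      inE   : V → V → Bool
      symmE : ∀ u v → T (inE u v) → T (inE v u)
      E⊆adj : ∀ u v → T (inE u v) → T (adj u v)
      ends  : ∀ u v → T (inE u v) → T (inV u)

  -- Only the values on edges of G matter.
  record Colouring (r : ℕ) : Set where
    field
      colour : V → V → Fin r
      symmC  : ∀ u v → T (adj u v) → colour u v ≡ colour v u

module _ {G : Graph} where
  open Graph G

  module _ (H : Subgraph G) where
    open Subgraph H

    VertexOf : V → Set
    VertexOf v = T (inV v)

    EdgeOf : V → V → Set
    EdgeOf u v = T (inE u v)

    Connected : Set
    Connected = (∃[ v ] VertexOf v) ×
                (∀ u v → VertexOf u → VertexOf v → Star EdgeOf u v)

    -- no closed walk x, x₁, …, xₖ, x with k ≥ 2 and x, x₁, …, xₖ distinct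
    Acyclic : Set
    Acyclic = ∀ x xs → 2 ℕ.≤ length xs → Unique (x ∷ xs) →
              ¬ Linked EdgeOf (x ∷ xs ++ x ∷ [])

    IsTree : Set
    IsTree = Connected × Acyclic

  record MonochromaticTree {r : ℕ} (χ : Colouring G r) : Set where
    open Colouring χ
    field
      subgraph : Subgraph G
      isTree   : IsTree subgraph
      hue      : Fin r
      mono     : ∀ u v → EdgeOf subgraph u v → colour u v ≡ hue

  module _ {r : ℕ} {χ : Colouring G r} where
    infix 4 _∈ᵗ_

    _∈ᵗ_ : V → MonochromaticTree χ → Set
    v ∈ᵗ t = VertexOf (MonochromaticTree.subgraph t) v

    Disjoint : MonochromaticTree χ → MonochromaticTree χ → Set
    Disjoint s t = ∀ v → ¬ (v ∈ᵗ s × v ∈ᵗ t)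

CoverableBy : (r : ℕ) → Graph → ℕ → Set
CoverableBy r G k = (χ : Colouring G r) →
  ∃[ j ] j ℕ.≤ k × Σ[ t ∈ (Fin j → MonochromaticTree χ) ] ∀ v → ∃[ i ] v ∈ᵗ t i

IsTc : (r : ℕ) → Graph → ℕ → Set
IsTc r G k = CoverableBy r G k × (∀ j → CoverableBy r G j → k ℕ.≤ j)

Tc₂≥ : ℕ → Graph → Set
Tc₂≥ m G = ∃[ k ] IsTc 2 G k × m ℕ.≤ k

-- "All but at most b vertices": xs lists (at least) the uncovered ones.
AlmostCoverable : Graph → ℕ → ℝ → Set
AlmostCoverable G k b = (χ : Colouring G 2) →
  ∃[ j ] j ℕ.≤ k × Σ[ t ∈ (Fin j → MonochromaticTree χ) ]
    (∀ i i′ → i ≢ i′ → Disjoint (t i) (t i′)) ×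
    Σ[ xs ∈ List (Graph.V G) ] fromℕ (length xs) ≤ℝ b ×
      (∀ v → v ∈ xs ⊎ ∃[ i ] v ∈ᵗ t i)

-- Row i lists the edges between vertex i of the first class and the
-- vertices of the second class.
BipartiteGraph : ℕ → ℕ → Set
BipartiteGraph n m = Vec (Vec Bool m) n

toGraph : ∀ {n m} → BipartiteGraph n m → Graph
toGraph {n} {m} B = record
  { V      = Fin n ⊎ Fin m
  ; adj    = adj
  ; symm   = symm
  ; irrefl = λ { (inj₁ _) () ; (inj₂ _) () }
  }
  where
  edge : Fin n → Fin m → Bool
  edge i j = Vec.lookup (Vec.lookup B i) j

  adj : Fin n ⊎ Fin m → Fin n ⊎ Fin m → Bool
  adj (inj₁ i) (inj₂ j) = edge i j
  adj (inj₂ j) (inj₁ i) = edge i j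
  adj (inj₁ _) (inj₁ _) = false
  adj (inj₂ _) (inj₂ _) = false

  symm : ∀ u v → T (adj u v) → T (adj v u)
  symm (inj₁ _) (inj₂ _) e = e
  symm (inj₂ _) (inj₁ _) e = e

allVecs : ∀ {A : Set} → List A → (k : ℕ) → List (Vec A k)
allVecs as zero    = [] ∷ []
allVecs as (suc k) = List.cartesianProductWith _∷_ as (allVecs as k)

allBipartiteGraphs : ∀ n m → List (BipartiteGraph n m)
allBipartiteGraphs n m = allVecs (allVecs (false ∷ true ∷ []) m) n

sumℝ productℝ : List ℝ → ℝ
sumℝ     = List.foldr _+ℝ_ 0ℝ
productℝ = List.foldr _*ℝ_ 1ℝ

-- the probability of B: a factor p for each edge and 1 - p for each non-edge
weight : ∀ {n m} → ℝ → BipartiteGraph n m → ℝ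
weight p B = productℝ
  (List.map (λ b → if b then p else 1ℝ -ℝ p) (Vec.toList (Vec.concat B)))

Pr : ∀ {n m} → ℝ → (BipartiteGraph n m → Bool) → ℝ
Pr {n} {m} p S = sumℝ (List.map (weight p) (List.filterᵇ S (allBipartiteGraphs n m)))

-- An event given as an arbitrary predicate has no computable indicator in
-- general, so "P(E) ≥ b" is witnessed by a decidable S contained in E with
-- Pr p S ≥ b; for decidable E this is equivalent to Pr p E ≥ b.
PrAtLeast : ∀ {n m} → ℝ → (BipartiteGraph n m → Set) → ℝ → Set
PrAtLeast {n} {m} p E b =
  Σ[ S ∈ (BipartiteGraph n m → Bool) ] (∀ B → T (S B) → E B) × b ≤ℝ Pr p S

WithHighProbability : (p : ℕ → ℝ) → (∀ n → BipartiteGraph n n → Set) → Set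
WithHighProbability p E =
  ∀ ε → 0ℝ <ℝ ε → ∃[ N ] ∀ n → N ℕ.≤ n → PrAtLeast (p n) (E n) (1ℝ -ℝ ε)

threshold : (n : ℕ) → .{{_ : ℕ.NonZero n}} → ℝ
threshold n = √ (log n *ℝ fromℚ (+ 1 ℚ./ n))

-- A bound on p(n) is only required for large n: p(n) ≤ 1 makes a bound
-- such as C √(log n / n) ≤ p(n) unsatisfiable at small n when C is large.
ForLarge : ((n : ℕ) → .{{_ : ℕ.NonZero n}} → Set) → Set
ForLarge P = ∃[ n₀ ] ∀ n → .{{_ : ℕ.NonZero n}} → n₀ ℕ.≤ n → P n

{-# OPTIONS --safe #-}
-- Part 1.  If p² n is a small multiple of log n, then with high probability some three rows x, y, z
-- have pairwise disjoint neighbourhoods that miss a column b: disjoint triples of rows succeed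
-- independently, each with probability at least a small power of 1/n.  Colour the edges at x, y, z
-- red, the other edges at their neighbours blue and the rest red; no monochromatic tree contains two
-- of x, y, z, b.
--
-- Part 2.  With s = O(1/p) and m = Θ(n), with high probability any s vertices of one class and any m
-- of the other span an edge; nothing else about the random graph is used.  Either some large pair of
-- vertex sets is monochromatic, or there are a red and a blue connected core, in disjoint thirds of the
-- classes, that almost all remaining vertices see in the right colour.  In both cases one finds at most
-- three disjoint monochromatic cores and linearly many hubs in each class that may join a red or a blue
-- core.  The hubs choose greedily by majority, so that all but O(s) of the other vertices see a hub in
-- the colour of its core, and those become leaves.
module Submission where

open import Defs
open import Data.Bool using (Bool; true; false; T; _∧_; _∨_; not; if_then_else_)
open import Data.Bool.ListAction using (any)
open import Data.Bool.Properties using (T?; not-involutive)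
open import Data.Empty using (⊥-elim)
open import Data.Fin as Fin using (Fin; zero; suc)
import Data.Fin.Properties as Finₚ
open import Data.Integer as ℤ using (ℤ)
import Data.Integer.Properties as ℤₚ
open import Data.List as List using (List; []; _∷_; _++_; length)
open import Data.List.Membership.Propositional using (_∈_; lose; find)
import Data.List.Membership.Propositional.Properties as ∈ₚ
import Data.List.Properties as Listₚ
open import Data.List.Relation.Unary.All as All using (All; _∷_)
open import Data.List.Relation.Unary.AllPairs using (_∷_)
open import Data.List.Relation.Unary.Any as Any using (here; there)
import Data.List.Relation.Unary.Any.Properties as Anyₚ
open import Data.List.Relation.Unary.Linked as Linked using (Linked; _∷_)
open import Data.List.Relation.Unary.Unique.Propositional using (Unique)
open import Data.Maybe using (Maybe; just; nothing; _<∣>_)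
import Data.Maybe.Properties as Maybeₚ
open import Data.Nat as ℕ using (ℕ; zero; suc)
import Data.Nat.DivMod as ℕD
import Data.Nat.Properties as ℕₚ
open import Data.Product using (Σ-syntax; ∃-syntax; _×_; _,_; proj₁; proj₂)
open import Data.Rational as ℚ using (ℚ; 0ℚ; 1ℚ; ½)
import Data.Rational.Properties as ℚₚ
open import Data.Rational.Solver using (module +-*-Solver)
open import Data.Rational.Unnormalised as ℚᵘ using (mkℚᵘ)
import Data.Rational.Unnormalised.Properties as ℚᵘₚ
open import Data.Sum using (_⊎_; inj₁; inj₂; [_,_]′; swap)
import Data.Sum.Properties as Sumₚ
open import Data.Unit using (⊤; tt)
open import Data.Vec as Vec using (Vec; []; _∷_; head; tail; lookup)
import Data.Vec.Properties as Vecₚ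
open import Function using (_∘_; id)
open import Relation.Binary using (DecidableEquality)
open import Relation.Binary.PropositionalEquality using (_≡_; _≢_; refl; sym; trans; cong; cong₂; subst; subst₂)
open import Relation.Nullary using (¬_; Dec; yes; no; does; contradiction)
open import Relation.Nullary.Decidable using (_×-dec_; _⊎-dec_; ¬?; map′; toWitness)
open import Algebra.Properties.CommutativeMonoid.Sum ℕₚ.+-0-commutativeMonoid using (sum; sum-cong-≗; ∑-distrib-+)

-- `Tc₂≥` asks for the value of the cover number, not only for the failure of three trees, so
-- coverability has to be decided: trees are replaced by whole monochromatic components and
-- colourings by finitely many matrices. Reals are sequences, so every estimate is made on rational
-- terms. The logarithm is known only up to a constant factor, through an integer `J` with 4^J ≤ n <
-- 4^(J+1) or `L` with 2^L ≤ n < 2^(L+1), and forms of Bernoulli's inequality replace exponentials.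
-- The failure probabilities come out as at most 24/J and 8/L, which still tend to 0. In Part 2 a
-- vertex may see all hubs in one colour only, so a hub must be free to join a core of either
-- colour; and part of every large set is put aside before a core is sought in the rest, which keeps
-- cores and hubs disjoint. Where no second core can be found, almost every vertex already sees hubs
-- in the first colour. Each class loses at most 4s vertices and s ≤ 21/q for a rational q just
-- below p, so that 8s stays below 200/p.

-- Counting in subsets of Fin n
module _ where
  open import Data.Nat using (_+_; _*_; _∸_; _≤_; _<_; z≤n; s≤s)

  private variable
    a b n : ℕ

  T-does⁻ : ∀ {P : Set} (d : Dec P) → T (does d) → P
  T-does⁻ (yes p) _ = p

  T-does⁺ : ∀ {P : Set} (d : Dec P) → P → T (does d)
  T-does⁺ (yes _) _ = tt
  T-does⁺ (no ¬p) p = ¬p p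

  Subset : ℕ → Set
  Subset n = Fin n → Bool

  bit : Bool → ℕ
  bit true  = 1
  bit false = 0

  count : Subset n → ℕ
  count P = sum (bit ∘ P)

  bit≤1 : ∀ b → bit b ≤ 1
  bit≤1 true  = s≤s z≤n
  bit≤1 false = z≤n

  sum-mono : (f g : Fin n → ℕ) → (∀ i → f i ≤ g i) → sum f ≤ sum g
  sum-mono {zero}  f g h = z≤n
  sum-mono {suc n} f g h = ℕₚ.+-mono-≤ (h zero) (sum-mono (f ∘ suc) (g ∘ suc) (h ∘ suc))

  sum-0 : ∀ n → sum {n} (λ _ → 0) ≡ 0
  sum-0 zero    = refl
  sum-0 (suc n) = sum-0 n

  bit-mono : ∀ {b c} → (T b → T c) → bit b ≤ bit c
  bit-mono {true}  {true}  h = ℕₚ.≤-refl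
  bit-mono {true}  {false} h = ⊥-elim (h tt)
  bit-mono {false} {c}     h = z≤n

  bit-∪ : ∀ {b c d} → (T b → T c ⊎ T d) → bit b ≤ bit c + bit d
  bit-∪ {false} h = z≤n
  bit-∪ {true} {c} {d} h with h tt
  ... | inj₁ x = ℕₚ.≤-trans (bit-mono {true} {c} λ _ → x) (ℕₚ.m≤m+n (bit c) (bit d))
  ... | inj₂ x = ℕₚ.≤-trans (bit-mono {true} {d} λ _ → x) (ℕₚ.m≤n+m (bit d) (bit c))

  bit-⊎ : ∀ {b c d} → (T c → T b) → (T d → T b) → (T c → ¬ T d) → bit c + bit d ≤ bit b
  bit-⊎ {c = true}  {true}  p q r = ⊥-elim (r tt tt)
  bit-⊎ {c = true}  {false} p q r = bit-mono {true} p
  bit-⊎ {c = false} {d}     p q r = bit-mono {d} q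

  count-⊆ : {P Q : Subset n} → (∀ i → T (P i) → T (Q i)) → count P ≤ count Q
  count-⊆ h = sum-mono _ _ (λ i → bit-mono (h i))

  count-∪ : {P Q R : Subset n} → (∀ i → T (P i) → T (Q i) ⊎ T (R i)) → count P ≤ count Q + count R
  count-∪ {P = P} {Q} {R} h = ℕₚ.≤-trans (sum-mono _ _ (λ i → bit-∪ (h i)))
    (ℕₚ.≤-reflexive (∑-distrib-+ (bit ∘ Q) (bit ∘ R)))

  count-⊎ : {P Q R : Subset n} → (∀ i → T (Q i) → T (P i)) → (∀ i → T (R i) → T (P i)) →
    (∀ i → T (Q i) → ¬ T (R i)) → count Q + count R ≤ count P
  count-⊎ {P = P} {Q} {R} p q r = ℕₚ.≤-trans
    (ℕₚ.≤-reflexive (sym (∑-distrib-+ (bit ∘ Q) (bit ∘ R))))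
    (sum-mono _ _ (λ i → bit-⊎ (p i) (q i) (r i)))

  count-inhabited : (P : Subset n) → 0 < count P → ∃[ i ] T (P i)
  count-inhabited {suc n} P h with P zero in eq
  ... | true  = zero , subst T (sym eq) tt
  ... | false = let i , p = count-inhabited (P ∘ suc) h in suc i , p

  count-empty : {P : Subset n} → (∀ i → ¬ T (P i)) → count P ≡ 0
  count-empty {n} {P} h = ℕₚ.n≤0⇒n≡0 (ℕₚ.≤-trans (count-⊆ {P = P} {λ _ → false} (λ i p → h i p))
    (ℕₚ.≤-reflexive (sum-0 n)))

  count-all : ∀ n → count {n} (λ _ → true) ≡ n
  count-all zero    = refl
  count-all (suc n) = cong suc (count-all n)

  count-remove : {P : Subset n} (i : Fin n) →
    count P ≤ suc (count (λ j → P j ∧ not (does (j Fin.≟ i))))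
  count-remove {suc n} {P} zero = ℕₚ.+-mono-≤ (bit≤1 (P zero))
    (ℕₚ.≤-trans (count-⊆ {P = P ∘ suc} (λ i p → go (P (suc i)) p)) (ℕₚ.m≤n+m _ _))
    where
    go : ∀ b → T b → T (b ∧ true)
    go true _ = tt
  count-remove {suc n} {P} (suc i) = ℕₚ.≤-trans
    (ℕₚ.+-monoʳ-≤ (bit (P zero)) (count-remove {P = P ∘ suc} i))
    (ℕₚ.≤-trans (ℕₚ.≤-reflexive (ℕₚ.+-suc _ _))
      (s≤s (ℕₚ.+-mono-≤ (bit-mono (go (P zero))) (count-⊆ {n} (λ j p → p)))))
    where
    go : ∀ b → T b → T (b ∧ true)
    go true _ = tt

  subset-of-size : (P : Subset n) (k : ℕ) → k ≤ count P →
    Σ[ Q ∈ Subset n ] (∀ i → T (Q i) → T (P i)) × count Q ≡ k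
  subset-of-size {n} P zero k≤ = (λ _ → false) , (λ _ ()) , sum-0 n
  subset-of-size {suc n} P (suc k) k≤ with P zero in eq
  ... | true  = let Q , Q⊆ , c = subset-of-size (P ∘ suc) k (ℕₚ.≤-pred k≤) in
        (λ { zero → true ; (suc i) → Q i })
      , (λ { zero _ → subst T (sym eq) tt ; (suc i) q → Q⊆ i q })
      , cong suc c
  ... | false = let Q , Q⊆ , c = subset-of-size (P ∘ suc) (suc k) k≤ in
        (λ { zero → false ; (suc i) → Q i })
      , (λ { zero () ; (suc i) q → Q⊆ i q })
      , c

  infixl 6 _∖_
  _∖_ : {V : Set} → (V → Bool) → (V → Bool) → V → Bool
  (P ∖ Q) i = P i ∧ not (Q i)

  ∧⁻ : ∀ {b c} → T (b ∧ c) → T b × T c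
  ∧⁻ {true} {true} _ = tt , tt

  ∧⁺ : ∀ {b c} → T b → T c → T (b ∧ c)
  ∧⁺ {true} {true} _ _ = tt

  not⁻ : ∀ {b} → T (not b) → ¬ T b
  not⁻ {false} _ ()

  not⁺ : ∀ {b} → ¬ T b → T (not b)
  not⁺ {true}  h = h tt
  not⁺ {false} h = tt

  ∨⁻ : ∀ {b c} → T (b ∨ c) → T b ⊎ T c
  ∨⁻ {true}  p = inj₁ tt
  ∨⁻ {false} p = inj₂ p

  ∨⁺ˡ : ∀ {b c} → T b → T (b ∨ c)
  ∨⁺ˡ {true} _ = tt

  ∨⁺ʳ : ∀ {b c} → T c → T (b ∨ c)
  ∨⁺ʳ {true}  _ = tt
  ∨⁺ʳ {false} p = p

  em : ∀ b → T b ⊎ ¬ T b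
  em true  = inj₁ tt
  em false = inj₂ (λ ())

  ∧-split : ∀ {b} c → T b → T (b ∧ not c) ⊎ T (b ∧ c)
  ∧-split true  p = inj₂ (∧⁺ p tt)
  ∧-split false p = inj₁ (∧⁺ p tt)

  count-∖ : {P Q : Subset n} → count P ≤ count Q + count (P ∖ Q)
  count-∖ {P = P} {Q} = count-∪ λ i p → go i p (em (Q i))
    where
    go : ∀ i → T (P i) → T (Q i) ⊎ ¬ T (Q i) → T (Q i) ⊎ T ((P ∖ Q) i)
    go i p (inj₁ q) = inj₁ q
    go i p (inj₂ q) = inj₂ (∧⁺ p (not⁺ q))

  least : (P : ℕ → Set) → (∀ k → Dec (P k)) → ∃[ k ] P k → ∃[ k ] P k × ∀ j → P j → k ≤ j
  least P P? (k , p) = go P P? k p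
    where
    go : (P : ℕ → Set) → (∀ k → Dec (P k)) → ∀ k → P k → ∃[ k ] P k × ∀ j → P j → k ≤ j
    go P P? zero p = 0 , p , λ _ _ → z≤n
    go P P? (suc k) p with P? 0 | go (P ∘ suc) (P? ∘ suc) k p
    ... | yes p₀ | _ = 0 , p₀ , λ _ _ → z≤n
    ... | no ¬p₀ | l , pl , min =
      suc l , pl , λ { zero p₀ → contradiction p₀ ¬p₀ ; (suc j) pj → s≤s (min j pj) }

  three-parts : ∀ {n} t → t + (t + t) ≤ n → Σ[ P ∈ (Fin 3 → Subset n) ]
    (∀ a → t ≤ count (P a)) × (∀ a a′ i → T (P a i) → T (P a′ i) → a ≡ a′)
  three-parts {n} t large = P , P-size , P-disjoint
    where
    all : Subset n
    all _ = true
    rest-size : (Q R : Subset n) → ∀ {x} → count R ≡ t → t + x ≤ count Q → x ≤ count (Q ∖ R)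
    rest-size Q R e h = ℕₚ.+-cancelˡ-≤ t _ _ (ℕₚ.≤-trans h
      (ℕₚ.≤-trans (count-∖ {P = Q} {R}) (ℕₚ.≤-reflexive (cong (_+ count (Q ∖ R)) e))))
    all-size : t + (t + t) ≤ count all
    all-size = ℕₚ.≤-trans large (ℕₚ.≤-reflexive (sym (count-all n)))
    P₀ = subset-of-size all t (ℕₚ.m+n≤o⇒m≤o t all-size)
    Q₁ = all ∖ proj₁ P₀
    Q₁-size : t + t ≤ count Q₁
    Q₁-size = rest-size all (proj₁ P₀) (proj₂ (proj₂ P₀)) all-size
    P₁ = subset-of-size Q₁ t (ℕₚ.m+n≤o⇒m≤o t Q₁-size)
    Q₂ = Q₁ ∖ proj₁ P₁
    P : Fin 3 → Subset n
    P zero             = proj₁ P₀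
    P (suc zero)       = proj₁ P₁
    -- The last part takes everything that is left, so sizes are only bounded from below.
    P (suc (suc zero)) = Q₂
    P-size : ∀ a → t ≤ count (P a)
    P-size zero             = ℕₚ.≤-reflexive (sym (proj₂ (proj₂ P₀)))
    P-size (suc zero)       = ℕₚ.≤-reflexive (sym (proj₂ (proj₂ P₁)))
    P-size (suc (suc zero)) = rest-size Q₁ (proj₁ P₁) (proj₂ (proj₂ P₁)) Q₁-size
    P₀∩Q₁ : ∀ i → T (P zero i) → ¬ T (Q₁ i)
    P₀∩Q₁ i p q = not⁻ q p
    P₁∩Q₂ : ∀ i → T (P (suc zero) i) → ¬ T (Q₂ i)
    P₁∩Q₂ i p q = not⁻ (proj₂ (∧⁻ {Q₁ i} q)) p
    P₁⊆Q₁ : ∀ i → T (P (suc zero) i) → T (Q₁ i)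
    P₁⊆Q₁ = proj₁ (proj₂ P₁)
    Q₂⊆Q₁ : ∀ i → T (Q₂ i) → T (Q₁ i)
    Q₂⊆Q₁ i q = proj₁ (∧⁻ {Q₁ i} q)
    P-disjoint : ∀ a a′ i → T (P a i) → T (P a′ i) → a ≡ a′
    P-disjoint zero zero i p q = refl
    P-disjoint zero (suc zero) i p q = contradiction (P₁⊆Q₁ i q) (P₀∩Q₁ i p)
    P-disjoint zero (suc (suc zero)) i p q = contradiction (Q₂⊆Q₁ i q) (P₀∩Q₁ i p)
    P-disjoint (suc zero) zero i p q = contradiction (P₁⊆Q₁ i p) (P₀∩Q₁ i q)
    P-disjoint (suc zero) (suc zero) i p q = refl
    P-disjoint (suc zero) (suc (suc zero)) i p q = contradiction q (P₁∩Q₂ i p)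
    P-disjoint (suc (suc zero)) zero i p q = contradiction (Q₂⊆Q₁ i p) (P₀∩Q₁ i q)
    P-disjoint (suc (suc zero)) (suc zero) i p q = contradiction p (P₁∩Q₂ i q)
    P-disjoint (suc (suc zero)) (suc (suc zero)) i p q = refl

-- Spanning trees and reachability in finite graphs
module _ where
  open import Data.Nat using (_+_; _*_; _∸_; _≤_; _<_; z≤n; s≤s)
  open import Relation.Binary.Construct.Closure.ReflexiveTransitive as Star using (Star; ε; _◅_; _◅◅_)

  -- Every step of a walk without backtracking in a rooted forest goes to the parent or to a child,
  -- and after a step to a child all further steps go to children.
  module _ {V : Set} (Child : V → V → Set) (rank : V → ℕ)
    (child-unique : ∀ {u v w} → Child u v → Child u w → v ≡ w)
    (child-rank : ∀ {u v} → Child u v → rank v < rank u)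
    where

    private
      Edge : V → V → Set
      Edge u v = Child u v ⊎ Child v u

    NonBacktracking : List V → Set
    NonBacktracking (a ∷ b ∷ c ∷ l) = a ≢ c × NonBacktracking (b ∷ c ∷ l)
    NonBacktracking _ = ⊤

    lastOf : V → List V → V
    lastOf v []       = v
    lastOf v (w ∷ ws) = lastOf w ws

    lastOf-∈ : ∀ w ws → lastOf w ws ∈ w ∷ ws
    lastOf-∈ w []       = here refl
    lastOf-∈ w (x ∷ ws) = there (lastOf-∈ x ws)

    descend : ∀ u v ws z → Child v u → NonBacktracking (u ∷ v ∷ ws ++ z ∷ []) →
      Linked Edge (v ∷ ws ++ z ∷ []) → Child z (lastOf v ws) × rank u < rank z
    descend u v [] z vu (u≢z , _) (inj₁ vz ∷ _) = contradiction (child-unique vu vz) u≢z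
    descend u v [] z vu (u≢z , _) (inj₂ zv ∷ _) =
      zv , ℕₚ.<-trans (child-rank vu) (child-rank zv)
    descend u v (w ∷ ws) z vu (u≢w , nb) (inj₁ vw ∷ l) = contradiction (child-unique vu vw) u≢w
    descend u v (w ∷ ws) z vu (u≢w , nb) (inj₂ wv ∷ l) =
      let zl , v<z = descend v w ws z wv nb l in zl , ℕₚ.<-trans (child-rank vu) v<z

    -- Either every step goes to the parent and the rank falls throughout, or some step goes to a
    -- child and then, by `descend`, so does the last one.
    ascend : ∀ v ws z → NonBacktracking (v ∷ ws ++ z ∷ []) → Linked Edge (v ∷ ws ++ z ∷ []) →
      rank z < rank v ⊎ Child z (lastOf v ws)
    ascend v [] z nb (inj₁ vz ∷ _) = inj₁ (child-rank vz)
    ascend v [] z nb (inj₂ zv ∷ _) = inj₂ zv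
    ascend v (w ∷ []) z nb@(_ , nb′) (inj₁ vw ∷ l) with ascend w [] z nb′ l
    ... | inj₁ z<w = inj₁ (ℕₚ.<-trans z<w (child-rank vw))
    ... | inj₂ zw  = inj₂ zw
    ascend v (w ∷ ws@(_ ∷ _)) z nb@(_ , nb′) (inj₁ vw ∷ l) with ascend w ws z nb′ l
    ... | inj₁ z<w = inj₁ (ℕₚ.<-trans z<w (child-rank vw))
    ... | inj₂ zw  = inj₂ zw
    ascend v (w ∷ ws) z nb (inj₂ wv ∷ l) = inj₂ (proj₁ (descend v w ws z wv nb l))

    -- Distinctness of the list settles every triple but the last, which ends in the repeated `x`;
    -- its first entry is one of the other vertices.
    closed-nonBacktracking : ∀ x y w ws → Unique (x ∷ y ∷ w ∷ ws) →
      NonBacktracking (x ∷ y ∷ w ∷ ws ++ x ∷ [])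
    closed-nonBacktracking x y w ws ((x≢y ∷ x≢w ∷ x∉ws) ∷ u) = x≢w , go y w ws (x≢y ∷ x≢w ∷ x∉ws) u
      where
      go : ∀ y w ws → All (x ≢_) (y ∷ w ∷ ws) → Unique (y ∷ w ∷ ws) →
        NonBacktracking (y ∷ w ∷ ws ++ x ∷ [])
      go y w []       (x≢y ∷ _) _ = x≢y ∘ sym , tt
      go y w (v ∷ ws) (_ ∷ x∉) ((_ ∷ y≢v ∷ _) ∷ u) = y≢v , go w v ws x∉ u

    -- If the first step goes to a child, the rank would rise all the way back to `x`. If it goes to
    -- the parent `y`, the walk can only return to `x` from `y`, and `y` does not occur again.
    forest-acyclic : ∀ x xs → 2 ≤ length xs → Unique (x ∷ xs) → ¬ Linked Edge (x ∷ xs ++ x ∷ [])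
    forest-acyclic x (y ∷ []) (s≤s ())
    forest-acyclic x (y ∷ w ∷ ws) _ u@(_ ∷ (y∉ ∷ _)) (e ∷ l) with closed-nonBacktracking x y w ws u
    ... | nb with e
    ... | inj₂ yx = ℕₚ.<-irrefl refl (proj₂ (descend x y (w ∷ ws) x yx nb l))
    ... | inj₁ xy with ascend y (w ∷ ws) x (proj₂ nb) l
    ... | inj₁ x<y = ℕₚ.<-asym x<y (child-rank xy)
    ... | inj₂ xl  = All.lookup y∉ (lastOf-∈ w ws) (child-unique xy xl)

  module FiniteSearch {V : Set} (vs : List V) (complete : ∀ v → v ∈ vs) where

    exists? : {P : V → Set} → (∀ v → Dec (P v)) → Dec (∃[ v ] P v)
    exists? P? = map′ (λ a → let v , _ , p = find a in v , p) (λ (v , p) → lose (complete v) p)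
      (Any.any? P? vs)

  module SpanningTree {G : Graph} (vs : List (Graph.V G)) (complete : ∀ v → v ∈ vs)
    (_≟_ : DecidableEquality (Graph.V G)) (χ : Colouring G 2) where
    open Graph G
    open Colouring χ
    open FiniteSearch vs complete

    Step : Fin 2 → (V → Bool) → V → V → Set
    Step κ U u v = T (U u) × T (U v) × T (adj u v) × colour u v ≡ κ

    Step? : ∀ κ U u v → Dec (Step κ U u v)
    Step? κ U u v = T? (U u) ×-dec T? (U v) ×-dec T? (adj u v) ×-dec (colour u v Fin.≟ κ)

    step-sym : ∀ {κ U u v} → Step κ U u v → Step κ U v u
    step-sym (a , b , c , d) = b , a , symm _ _ c , trans (sym (symmC _ _ c)) d

    module _ (κ : Fin 2) (U : V → Bool) (r : V) (r∈U : T (U r))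
      (conn : ∀ v → T (U v) → Star (Step κ U) v r) where

      private
        Walk : ℕ → V → Set
        Walk zero    v = v ≡ r
        Walk (suc k) v = ∃[ u ] Step κ U v u × Walk k u

        Walk? : ∀ k v → Dec (Walk k v)
        Walk? zero    v = v ≟ r
        Walk? (suc k) v = exists? (λ u → Step? κ U v u ×-dec Walk? k u)

        toWalk : ∀ {v} → Star (Step κ U) v r → ∃[ k ] Walk k v
        toWalk ε       = 0 , refl
        toWalk (s ◅ p) = let k , w = toWalk p in suc k , _ , s , w

        dist : ∀ v → T (U v) → ∃[ k ] Walk k v × ∀ j → Walk j v → k ≤ j
        dist v v∈U = least (λ k → Walk k v) (λ k → Walk? k v) (toWalk (conn v v∈U))

        -- The decision is a separate argument so that `parentAux` can split on it without unfolding
        -- `rank`.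
        rankAux : ∀ v → T (U v) ⊎ ¬ T (U v) → ℕ
        rankAux v (inj₁ v∈U) = proj₁ (dist v v∈U)
        rankAux v (inj₂ _)   = 0

        rank : V → ℕ
        rank v = rankAux v (em (U v))

        -- The value is junk at r and outside U.
        parentAux : ∀ v (d : T (U v) ⊎ ¬ T (U v)) →
          ∃[ u ] (T (U v) → v ≢ r → Step κ U v u × rank u < rankAux v d)
        parentAux v (inj₂ v∉U) = v , λ v∈U → contradiction v∈U v∉U
        parentAux v (inj₁ v∈U) with dist v v∈U
        ... | zero  , v≡r , _ = v , λ _ v≢r → contradiction v≡r v≢r
        -- The parent is the first vertex of a shortest walk to `r`; the rest of that walk shows
        -- that its own distance is at most `k`.
        ... | suc k , (u , s , w) , _ = u , λ _ _ → s , s≤s (below (em (U u)))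
          where
          below : ∀ d → rankAux u d ≤ k
          below (inj₁ u∈U) = proj₂ (proj₂ (dist u u∈U)) k w
          below (inj₂ u∉U) = contradiction (proj₁ (proj₂ s)) u∉U

        parent : V → V
        parent v = proj₁ (parentAux v (em (U v)))

        parent-step : ∀ v → T (U v) → v ≢ r → Step κ U v (parent v) × rank (parent v) < rank v
        parent-step v = proj₂ (parentAux v (em (U v)))

        Child : V → V → Set
        Child u v = T (U u) × u ≢ r × parent u ≡ v

        Child? : ∀ u v → Dec (Child u v)
        Child? u v = T? (U u) ×-dec ¬? (u ≟ r) ×-dec (parent u ≟ v)

        child-step : ∀ {u v} → Child u v → Step κ U u v
        child-step (u∈U , u≢r , refl) = proj₁ (parent-step _ u∈U u≢r)

        child-rank : ∀ {u v} → Child u v → rank v < rank u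
        child-rank (u∈U , u≢r , refl) = proj₂ (parent-step _ u∈U u≢r)

        child-unique : ∀ {u v w} → Child u v → Child u w → v ≡ w
        child-unique (_ , _ , refl) (_ , _ , refl) = refl

        Edge : V → V → Set
        Edge u v = Child u v ⊎ Child v u

        Edge? : ∀ u v → Dec (Edge u v)
        Edge? u v = Child? u v ⊎-dec Child? v u

        edge-step : ∀ {u v} → Edge u v → Step κ U u v
        edge-step (inj₁ c) = child-step c
        edge-step (inj₂ c) = step-sym (child-step c)

        inE : V → V → Bool
        inE u v = does (Edge? u v)

        inE⁻ : ∀ {u v} → T (inE u v) → Edge u v
        inE⁻ {u} {v} = T-does⁻ (Edge? u v)

        inE⁺ : ∀ {u v} → Edge u v → T (inE u v)
        inE⁺ {u} {v} = T-does⁺ (Edge? u v)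

        E : V → V → Set
        E u v = T (inE u v)

        toRoot : ∀ k v → rank v ≤ k → T (U v) → Star E v r
        toRoot k v rk v∈U with v ≟ r
        ... | yes refl = ε
        toRoot zero    v rk v∈U | no v≢r =
          ⊥-elim (ℕₚ.n≮0 (ℕₚ.<-≤-trans (proj₂ (parent-step v v∈U v≢r)) rk))
        toRoot (suc k) v rk v∈U | no v≢r = let s , lt = parent-step v v∈U v≢r in
          inE⁺ (inj₁ (v∈U , v≢r , refl)) ◅
          toRoot k (parent v) (ℕₚ.≤-pred (ℕₚ.<-≤-trans lt rk)) (proj₁ (proj₂ s))

      -- Breadth-first tree of `U` from `r`. The distance to `r` drops along parent edges, so they
      -- form a forest, and following them leads to `r`.
      spanningTree : MonochromaticTree χ
      spanningTree = record
        { subgraph = record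
            { inV   = U
            ; inE   = inE
            ; symmE = λ u v e → inE⁺ (swap (inE⁻ e))
            ; E⊆adj = λ u v e → proj₁ (proj₂ (proj₂ (edge-step (inE⁻ e))))
            ; ends  = λ u v e → proj₁ (edge-step (inE⁻ e))
            }
        ; isTree = ((r , r∈U)
                   , λ u v u∈U v∈U → toRoot (rank u) u ℕₚ.≤-refl u∈U
                       ◅◅ Star.reverse (λ e → inE⁺ (swap (inE⁻ e))) (toRoot (rank v) v ℕₚ.≤-refl v∈U))
                 , λ x xs 2≤ u l → forest-acyclic Child rank child-unique child-rank x xs 2≤ u (mapL l)
        ; hue  = κ
        ; mono = λ u v e → proj₂ (proj₂ (proj₂ (edge-step (inE⁻ e))))
        }
        where
        mapL : ∀ {l} → Linked E l → Linked Edge l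
        mapL = Linked.map inE⁻

  -- Warshall's algorithm.
  module Reachability {V : Set} (vs : List V) (complete : ∀ v → v ∈ vs)
    (_≟_ : DecidableEquality V) {R : V → V → Set} (R? : ∀ u v → Dec (R u v)) where

    private
      Via : List V → V → V → Set
      Via []       u v = u ≡ v ⊎ R u v
      Via (w ∷ ws) u v = Via ws u v ⊎ (Via ws u w × Via ws w v)

      Via? : ∀ ws u v → Dec (Via ws u v)
      Via? []       u v = (u ≟ v) ⊎-dec R? u v
      Via? (w ∷ ws) u v = Via? ws u v ⊎-dec (Via? ws u w ×-dec Via? ws w v)

      via-edge : ∀ ws {u v} → u ≡ v ⊎ R u v → Via ws u v
      via-edge []       e = e
      via-edge (w ∷ ws) e = inj₁ (via-edge ws e)

      into : ∀ {w ws u} → Via (w ∷ ws) u w → Via ws u w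
      into (inj₁ p)       = p
      into (inj₂ (p , _)) = p

      out-of : ∀ {w ws v} → Via (w ∷ ws) w v → Via ws w v
      out-of (inj₁ p)       = p
      out-of (inj₂ (_ , p)) = p

      -- Walks may be joined at a vertex once it is allowed as an intermediate vertex. At the head
      -- of the list this needs `into` and `out-of`: a walk that starts or ends at `w` need not pass
      -- through `w` in between.
      via-trans : ∀ {ws w u v} → w ∈ ws → Via ws u w → Via ws w v → Via ws u v
      via-trans {h ∷ ws} (here refl) p q = inj₂ (into {ws = ws} p , out-of {ws = ws} q)
      via-trans {h ∷ ws} (there m) (inj₁ p) (inj₁ q) = inj₁ (via-trans m p q)
      via-trans {h ∷ ws} (there m) (inj₁ p) (inj₂ (q , q′)) = inj₂ (via-trans m p q , q′)
      via-trans {h ∷ ws} (there m) (inj₂ (p , p′)) (inj₁ q) = inj₂ (p , via-trans m p′ q)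
      via-trans {h ∷ ws} (there m) (inj₂ (p , p′)) (inj₂ (q , q′)) = inj₂ (p , q′)

      via⇒star : ∀ ws {u v} → Via ws u v → Star R u v
      via⇒star []       (inj₁ refl)     = ε
      via⇒star []       (inj₂ e)        = e ◅ ε
      via⇒star (w ∷ ws) (inj₁ p)        = via⇒star ws p
      via⇒star (w ∷ ws) (inj₂ (p , q))  = via⇒star ws p ◅◅ via⇒star ws q

      star⇒via : ∀ {u v} → Star R u v → Via vs u v
      star⇒via ε       = via-edge vs (inj₁ refl)
      star⇒via (e ◅ p) = via-trans (complete _) (via-edge vs (inj₂ e)) (star⇒via p)

    star? : ∀ u v → Dec (Star R u v)
    star? u v = map′ (via⇒star vs) star⇒via (Via? vs u v)

-- The tree cover number is computable
module _ where
  open import Data.Nat using (_+_; _*_; _∸_; _≤_; _<_; z≤n; s≤s)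
  open import Relation.Binary.Construct.Closure.ReflexiveTransitive as Star using (Star; ε; _◅_; _◅◅_)

  allVecs-complete : {A : Set} {as : List A} → (∀ a → a ∈ as) → ∀ {k} (v : Vec A k) → v ∈ allVecs as k
  allVecs-complete c []      = here refl
  allVecs-complete c (a ∷ v) = ∈ₚ.∈-cartesianProductWith⁺ _∷_ (c a) (allVecs-complete c v)

  bits : List Bool
  bits = false ∷ true ∷ []

  bits-complete : ∀ b → b ∈ bits
  bits-complete false = here refl
  bits-complete true  = there (here refl)

  sides : ∀ n m → List (Fin n ⊎ Fin m)
  sides n m = List.map inj₁ (List.allFin n) ++ List.map inj₂ (List.allFin m)

  sides-complete : ∀ {n m} v → v ∈ sides n m
  sides-complete {n} {m} (inj₁ i) = ∈ₚ.∈-++⁺ˡ (∈ₚ.∈-map⁺ inj₁ (∈ₚ.∈-allFin i))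
  sides-complete {n} {m} (inj₂ j) =
    ∈ₚ.∈-++⁺ʳ (List.map inj₁ (List.allFin n)) (∈ₚ.∈-map⁺ inj₂ (∈ₚ.∈-allFin j))

  _≟ᵛ_ : ∀ {n m} → DecidableEquality (Fin n ⊎ Fin m)
  _≟ᵛ_ = Sumₚ.≡-dec Fin._≟_ Fin._≟_

  coverable-mono : ∀ {r G j k} → j ≤ k → CoverableBy r G j → CoverableBy r G k
  coverable-mono j≤k c χ = let i , i≤j , t , cov = c χ in i , ℕₚ.≤-trans i≤j j≤k , t , cov

  module ComponentCovers {G : Graph} (vs : List (Graph.V G)) (complete : ∀ v → v ∈ vs)
    (_≟_ : DecidableEquality (Graph.V G)) where
    open Graph G
    open FiniteSearch vs complete

    Mono : Colouring G 2 → Fin 2 → V → V → Set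
    Mono χ κ u v = T (adj u v) × Colouring.colour χ u v ≡ κ

    -- A monochromatic tree may be enlarged to its component, which a root and a colour determine.
    -- Covers thus range over the finitely many vectors `ρ` and can be searched.
    ComponentCover : Colouring G 2 → ℕ → Set
    ComponentCover χ j = ∃[ ρ ] ∀ v → ∃[ i ]
      Star (Mono χ (proj₂ (Vec.lookup {n = j} ρ i))) v (proj₁ (Vec.lookup ρ i))

    module _ (χ : Colouring G 2) where
      open Colouring χ
      open SpanningTree vs complete _≟_ χ

      reach? : ∀ κ u v → Dec (Star (Mono χ κ) u v)
      reach? κ = star? λ u v → T? (adj u v) ×-dec (colour u v Fin.≟ κ)
        where open Reachability vs complete _≟_

      componentCover? : ∀ j → Dec (ComponentCover χ j)
      componentCover? j = map′ (λ a → let ρ , _ , c = find a in ρ , c)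
        (λ (ρ , c) → lose (allVecs-complete roots-complete ρ) c)
        (Any.any? (λ ρ → map′ (λ a v → All.lookup a (complete v)) (λ f → All.tabulate (λ {v} _ → f v))
            (All.all? (λ v → Finₚ.any? (λ i → reach? _ v _)) vs))
          (allVecs roots j))
        where
        roots : List (V × Fin 2)
        roots = List.cartesianProduct vs (zero ∷ suc zero ∷ [])
        roots-complete : ∀ r → r ∈ roots
        roots-complete (v , zero)     = ∈ₚ.∈-cartesianProduct⁺ (complete v) (here refl)
        roots-complete (v , suc zero) = ∈ₚ.∈-cartesianProduct⁺ (complete v) (there (here refl))

      tree-path : ∀ (t : MonochromaticTree χ) {u v} → let open MonochromaticTree t in
        Star (EdgeOf subgraph) u v → Star (Mono χ hue) u v
      tree-path t = Star.map λ {u} {v} e → Subgraph.E⊆adj subgraph u v e , mono u v e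
        where open MonochromaticTree t

      fromTrees : ∀ {j} (t : Fin j → MonochromaticTree χ) → (∀ v → ∃[ i ] v ∈ᵗ t i) → ComponentCover χ j
      fromTrees t cov = Vec.tabulate root , λ v → let i , v∈ = cov v in i ,
        subst (λ r → Star (Mono χ (proj₂ r)) v (proj₁ r)) (sym (Vecₚ.lookup∘tabulate root i))
          (tree-path (t i) (proj₂ (connected i) v (proj₁ (proj₁ (connected i))) v∈ (proj₂ (proj₁ (connected i)))))
        where
        connected : ∀ i → Connected (MonochromaticTree.subgraph (t i))
        connected i = proj₁ (MonochromaticTree.isTree (t i))
        root = λ i → proj₁ (proj₁ (connected i)) , MonochromaticTree.hue (t i)

      component : Fin 2 → V → V → Bool
      component κ r v = does (reach? κ v r)

      componentTree : Fin 2 → V → MonochromaticTree χ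
      componentTree κ r = spanningTree κ (component κ r) r (T-does⁺ (reach? κ r r) ε)
        λ v v∈ → inside (T-does⁻ (reach? κ v r) v∈)
        where
        inside : ∀ {v} → Star (Mono χ κ) v r → Star (Step κ (component κ r)) v r
        inside ε = ε
        inside (_◅_ {v} {w} e p) = (T-does⁺ (reach? κ v r) (e ◅ p) , T-does⁺ (reach? κ w r) p , e) ◅ inside p

      toTrees : ∀ {j} → ComponentCover χ j →
        Σ[ t ∈ (Fin j → MonochromaticTree χ) ] ∀ v → ∃[ i ] v ∈ᵗ t i
      toTrees (ρ , c) = (λ i → componentTree (proj₂ (Vec.lookup ρ i)) (proj₁ (Vec.lookup ρ i)))
        , λ v → let i , p = c v in i , T-does⁺ (reach? _ v _) p

    componentCover-resp : ∀ {χ χ′ : Colouring G 2} →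
      (∀ u v → T (adj u v) → Colouring.colour χ u v ≡ Colouring.colour χ′ u v) →
      ∀ {j} → ComponentCover χ j → ComponentCover χ′ j
    componentCover-resp same (ρ , c) = ρ , λ v → let i , p = c v in
      i , Star.map (λ {u} {w} (a , e) → a , trans (sym (same u w a)) e) p

    coverable-trivial : CoverableBy 2 G (length vs)
    coverable-trivial χ = length vs , ℕₚ.≤-refl , toTrees χ
      ( Vec.tabulate root
      , λ v → Any.index (complete v) , subst (λ r → Star (Mono χ (proj₂ r)) v (proj₁ r))
          (sym (trans (Vecₚ.lookup∘tabulate root (Any.index (complete v)))
                      (cong (_, zero) (sym (Anyₚ.lookup-index (complete v)))))) ε)
      where
      root : Fin (length vs) → V × Fin 2
      root i = List.lookup vs i , zero

  module _ {n m : ℕ} (B : BipartiteGraph n m) where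
    private
      G = toGraph B
    open ComponentCovers {G} (sides n m) sides-complete _≟ᵛ_

    private
      -- Colours matter only on pairs from different classes, so finitely many matrices represent
      -- all colourings up to `componentCover-resp`.
      matrixColouring : Vec (Vec (Fin 2) m) n → Colouring G 2
      matrixColouring M = record
        { colour = λ { (inj₁ i) (inj₂ j) → Vec.lookup (Vec.lookup M i) j
                     ; (inj₂ j) (inj₁ i) → Vec.lookup (Vec.lookup M i) j
                     ; (inj₁ _) (inj₁ _) → zero
                     ; (inj₂ _) (inj₂ _) → zero }
        ; symmC = λ { (inj₁ _) (inj₂ _) _ → refl ; (inj₂ _) (inj₁ _) _ → refl }
        }

      matrixOf : Colouring G 2 → Vec (Vec (Fin 2) m) n
      matrixOf χ = Vec.tabulate λ i → Vec.tabulate λ j → Colouring.colour χ (inj₁ i) (inj₂ j)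

      matrixOf-colour : ∀ χ u v → T (Graph.adj G u v) →
        Colouring.colour (matrixColouring (matrixOf χ)) u v ≡ Colouring.colour χ u v
      matrixOf-colour χ (inj₁ i) (inj₂ j) a =
        trans (cong (λ r → Vec.lookup r j) (Vecₚ.lookup∘tabulate _ i)) (Vecₚ.lookup∘tabulate _ j)
      matrixOf-colour χ (inj₂ j) (inj₁ i) a =
        trans (matrixOf-colour χ (inj₁ i) (inj₂ j) a) (Colouring.symmC χ _ _ a)

      SmallCover : ℕ → Vec (Vec (Fin 2) m) n → Set
      SmallCover k M = ∃[ j ] j < suc k × ComponentCover (matrixColouring M) j

      matrices : List (Vec (Vec (Fin 2) m) n)
      matrices = allVecs (allVecs (zero ∷ suc zero ∷ []) m) n

      matrices-complete : ∀ M → M ∈ matrices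
      matrices-complete = allVecs-complete (allVecs-complete
        λ { zero → here refl ; (suc zero) → there (here refl) })

    coverable? : ∀ k → Dec (CoverableBy 2 G k)
    coverable? k = map′ to from
        (All.all? (λ M → ℕₚ.anyUpTo? (componentCover? (matrixColouring M)) (suc k)) matrices)
      where
      to : All.All (SmallCover k) matrices → CoverableBy 2 G k
      to a χ = let j , j<k , c = All.lookup a (matrices-complete (matrixOf χ)) in
        j , ℕₚ.≤-pred j<k , toTrees χ (componentCover-resp {χ = matrixColouring (matrixOf χ)} {χ}
          (matrixOf-colour χ) c)
      from : CoverableBy 2 G k → All.All (SmallCover k) matrices
      from c = All.tabulate λ {M} _ → let j , j≤k , t , cov = c (matrixColouring M) in
        j , s≤s j≤k , fromTrees (matrixColouring M) t cov

    -- The exact minimum is found by searching downwards from the trivial cover with one tree per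
    -- vertex, which is possible because `coverable?` decides every step.
    uncoverable⇒tc≥ : ∀ k → ¬ CoverableBy 2 G k → Tc₂≥ (suc k) G
    uncoverable⇒tc≥ k ¬c =
      let l , c , min = least (CoverableBy 2 G) coverable? (_ , coverable-trivial) in
      l , (c , min) , ℕₚ.≰⇒> λ l≤k → ¬c (coverable-mono l≤k c)

-- A colouring that needs many trees
module _ where
  open import Data.Nat using (_+_; _*_; _∸_; _≤_; _<_; z≤n; s≤s)
  open import Relation.Binary.Construct.Closure.ReflexiveTransitive as Star using (Star; ε; _◅_; _◅◅_)

  edge : ∀ {n m} → BipartiteGraph n m → Fin n → Fin m → Bool
  edge B i j = Vec.lookup (Vec.lookup B i) j

  -- Give each t a a red star; the other edges at a neighbour of some t a are blue and everything
  -- else is red.  Then no monochromatic tree meets two of the vertices b, t 0, …, t (k - 1).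
  module _ {n m k : ℕ} (B : BipartiteGraph n m) (t : Fin k → Fin n) (b : Fin m)
    (t-injective : ∀ a a′ → t a ≡ t a′ → a ≡ a′)
    (t-disjoint : ∀ j a a′ → T (edge B (t a) j) → T (edge B (t a′) j) → a ≡ a′)
    (b-isolated : ∀ a → ¬ T (edge B (t a) b)) where

    private
      G = toGraph B
      open ComponentCovers {G} (sides n m) sides-complete _≟ᵛ_

      centre? : ∀ i → Dec (∃[ a ] t a ≡ i)
      centre? i = Finₚ.any? λ a → t a Fin.≟ i

      near? : ∀ j → Dec (∃[ a ] T (edge B (t a) j))
      near? j = Finₚ.any? λ a → T? (edge B (t a) j)

      hue : Fin n → Fin m → Fin 2
      hue i j = if does (centre? i) ∨ not (does (near? j)) then zero else suc zero

      χ : Colouring G 2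
      χ = record
        { colour = λ { (inj₁ i) (inj₂ j) → hue i j
                     ; (inj₂ j) (inj₁ i) → hue i j
                     ; (inj₁ _) (inj₁ _) → zero
                     ; (inj₂ _) (inj₂ _) → zero }
        ; symmC = λ { (inj₁ _) (inj₂ _) _ → refl ; (inj₂ _) (inj₁ _) _ → refl }
        }

      hue-centre : ∀ a j → hue (t a) j ≡ zero
      hue-centre a j with centre? (t a)
      ... | yes _ = refl
      ... | no ¬c = contradiction (a , refl) ¬c

      hue-near : ∀ a i j → T (edge B (t a) j) → hue i j ≡ zero → ∃[ a′ ] t a′ ≡ i
      hue-near a i j e h with centre? i | near? j
      ... | yes c | _     = c
      hue-near a i j e () | no _ | yes _
      ... | no _  | no ¬n = contradiction (a , e) ¬n

      -- The whole component of `t a` in colour `κ`: its star if `κ` is red, and `t a` alone if `κ`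
      -- is blue.
      StarOf : Fin k → Fin 2 → Fin n ⊎ Fin m → Set
      StarOf a κ v = v ≡ inj₁ (t a) ⊎ ∃[ j ] v ≡ inj₂ j × T (edge B (t a) j) × κ ≡ zero

      -- All edges at `t a` are red. A red edge at a neighbour of `t a` ends in some centre, and
      -- that centre is `t a` because the neighbourhoods are disjoint.
      starOf-closed : ∀ a κ {u v} → Mono χ κ u v → StarOf a κ u → StarOf a κ v
      starOf-closed a κ {v = inj₂ j} (e , c) (inj₁ refl) = inj₂ (j , refl , e , trans (sym c) (hue-centre a j))
      starOf-closed a κ {v = inj₁ i} (e , c) (inj₂ (j , refl , e′ , refl))
        with a′ , refl ← hue-near a i j e′ c = inj₁ (cong (inj₁ ∘ t) (t-disjoint j a′ a e e′))
      starOf-closed a κ {v = inj₁ i} (() , _) (inj₁ refl)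
      starOf-closed a κ {v = inj₂ i} (() , _) (inj₂ (j , refl , _))

      path-in-star : ∀ a κ {u v} → Star (Mono χ κ) u v → StarOf a κ u → StarOf a κ v
      path-in-star a κ ε       s = s
      path-in-star a κ (e ◅ p) s = path-in-star a κ p (starOf-closed a κ e s)

      -- `b` has index 0, so when two indices collide in a tree the larger one is always a centre,
      -- and its star can be followed.
      w : Fin (suc k) → Fin n ⊎ Fin m
      w zero    = inj₂ b
      w (suc a) = inj₁ (t a)

      separated : ∀ a κ q → StarOf a κ (w q) → q ≡ suc a
      separated a κ zero    (inj₂ (_ , refl , e , _)) = contradiction e (b-isolated a)
      separated a κ (suc q) (inj₁ e) = cong suc (t-injective q a (inj₁-injective e))
        where
        inj₁-injective : ∀ {i i′ : Fin n} → _≡_ {A = Fin n ⊎ Fin m} (inj₁ i) (inj₁ i′) → i ≡ i′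
        inj₁-injective refl = refl
      separated a κ (suc q) (inj₂ (_ , () , _))

    disjoint-rows⇒uncoverable : ¬ CoverableBy 2 G k
    disjoint-rows⇒uncoverable cover with cover χ
    ... | j , j≤k , f , cov with Finₚ.pigeonhole (s≤s j≤k) (λ q → proj₁ (cov (w q)))
    ... | p , suc a , p<q , same = contradiction (cong Fin.toℕ p≡q) (ℕₚ.<⇒≢ p<q)
      where
      tree = f (proj₁ (cov (w (suc a))))
      p∈ : w p ∈ᵗ tree
      p∈ = subst (λ i → w p ∈ᵗ f i) same (proj₂ (cov (w p)))
      path = proj₂ (proj₁ (MonochromaticTree.isTree tree)) (w (suc a)) (w p) (proj₂ (cov (w (suc a)))) p∈
      p≡q : p ≡ suc a
      p≡q = separated a _ p (path-in-star a _ (tree-path χ tree path) (inj₁ refl))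

-- Hubs
module _ where
  open import Data.Nat using (_+_; _*_; _∸_; _≤_; _<_; z≤n; s≤s)

  private variable
    a k n : ℕ

  Relation : ℕ → ℕ → Set
  Relation a k = Fin a → Fin k → Bool

  edgeCount : Relation a k → Subset a → Subset k → ℕ
  edgeCount E W H = sum λ j → count λ i → H j ∧ (W i ∧ E i j)

  Satisfied : (R S : Relation a k) (H φ : Subset k) → Fin a → Set
  Satisfied R S H φ i = ∃[ j ] T (H j) × (T (φ j) × T (R i j) ⊎ ¬ T (φ j) × T (S i j))

  -- The hubs decide one after another: each takes whichever of R and S serves more of the vertices
  -- that are not yet satisfied, so it satisfies at least half of its neighbours among them.
  halve : (R S : Relation a k) (H : Subset k) (W : Subset a) →
    Σ[ φ ∈ Subset k ] Σ[ W′ ∈ Subset a ]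
      (∀ i → T (W′ i) → T (W i)) ×
      (∀ i → T (W i) → ¬ T (W′ i) → Satisfied R S H φ i) ×
      edgeCount (λ i j → R i j ∨ S i j) W′ H + 2 * count W′ ≤ 2 * count W
  halve {k = zero} R S H W = (λ ()) , W , (λ _ w → w) , (λ i w ¬w → contradiction w ¬w) , ℕₚ.≤-refl
  halve {a} {suc k} R S H W = result (ℕₚ.≤-total y x)
    where
    r s : Subset a
    r i = H zero ∧ (W i ∧ R i zero)
    s i = H zero ∧ (W i ∧ S i zero)
    x = count r
    y = count s

    Goal = Σ[ φ ∈ Subset (suc k) ] Σ[ W′ ∈ Subset a ]
      (∀ i → T (W′ i) → T (W i)) ×
      (∀ i → T (W i) → ¬ T (W′ i) → Satisfied R S H φ i) ×
      edgeCount (λ i j → R i j ∨ S i j) W′ H + 2 * count W′ ≤ 2 * count W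

    module Choose (b : Bool) (Q : Relation a (suc k))
      (Q-sat : ∀ {i} → T (Q i zero) → T b × T (R i zero) ⊎ ¬ T b × T (S i zero))
      (better : x + y ≤ 2 * count (λ i → H zero ∧ (W i ∧ Q i zero))) where

      q W₁ : Subset a
      q i = H zero ∧ (W i ∧ Q i zero)
      W₁ = W ∖ q

      IH = halve (λ i j → R i (suc j)) (λ i j → S i (suc j)) (H ∘ suc) W₁
      φ₁ = proj₁ IH
      W′ = proj₁ (proj₂ IH)
      W′⊆W₁ = proj₁ (proj₂ (proj₂ IH))
      sat₁ = proj₁ (proj₂ (proj₂ (proj₂ IH)))
      bound₁ = proj₂ (proj₂ (proj₂ (proj₂ IH)))

      W′⊆W : ∀ i → T (W′ i) → T (W i)
      W′⊆W i w = proj₁ (∧⁻ (W′⊆W₁ i w))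

      φ : Subset (suc k)
      φ zero    = b
      φ (suc j) = φ₁ j

      sat : ∀ i → T (W i) → ¬ T (W′ i) → Satisfied R S H φ i
      sat i w ¬w′ with em (q i)
      ... | inj₁ qi = let h , wq = ∧⁻ qi in zero , h , Q-sat (proj₂ (∧⁻ {W i} wq))
      ... | inj₂ ¬qi = let j , h , p = sat₁ i (∧⁺ w (not⁺ ¬qi)) ¬w′ in suc j , h , p

      e₀ e₁ : ℕ
      e₀ = count λ i → H zero ∧ (W′ i ∧ (R i zero ∨ S i zero))
      e₁ = edgeCount (λ i j → R i (suc j) ∨ S i (suc j)) W′ (H ∘ suc)

      -- Edges are counted only from the final set `W′`. It lies in `W`, so the first hub
      -- contributes at most what it saw when it chose.
      e₀≤ : e₀ ≤ x + y
      e₀≤ = count-∪ λ i p → let h , wp = ∧⁻ p ; w′ , rs = ∧⁻ {W′ i} wp in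
        go i h (W′⊆W i w′) (∨⁻ rs)
        where
        go : ∀ i → T (H zero) → T (W i) → T (R i zero) ⊎ T (S i zero) → T (r i) ⊎ T (s i)
        go i h w (inj₁ p) = inj₁ (∧⁺ h (∧⁺ w p))
        go i h w (inj₂ p) = inj₂ (∧⁺ h (∧⁺ w p))

      W₁≤ : count q + count W₁ ≤ count W
      W₁≤ = count-⊎ (λ i p → proj₁ (∧⁻ {W i} (proj₂ (∧⁻ {H zero} p)))) (λ i p → proj₁ (∧⁻ {W i} p))
        (λ i p p₁ → not⁻ (proj₂ (∧⁻ {W i} p₁)) p)

      goal : Goal
      goal = φ , W′ , W′⊆W , sat , (begin
        e₀ + e₁ + 2 * count W′      ≡⟨ ℕₚ.+-assoc e₀ e₁ _ ⟩
        e₀ + (e₁ + 2 * count W′)    ≤⟨ ℕₚ.+-mono-≤ (ℕₚ.≤-trans e₀≤ better) bound₁ ⟩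
        2 * count q + 2 * count W₁  ≡⟨ ℕₚ.*-distribˡ-+ 2 (count q) (count W₁) ⟨
        2 * (count q + count W₁)    ≤⟨ ℕₚ.*-monoʳ-≤ 2 W₁≤ ⟩
        2 * count W                 ∎)
        where open ℕₚ.≤-Reasoning

    result : y ≤ x ⊎ x ≤ y → Goal
    result (inj₁ y≤x) = Choose.goal true R (λ p → inj₁ (tt , p))
      (ℕₚ.≤-trans (ℕₚ.+-monoʳ-≤ x y≤x) (ℕₚ.≤-reflexive (cong (x +_) (sym (ℕₚ.+-identityʳ x)))))
    result (inj₂ x≤y) = Choose.goal false S (λ p → inj₂ ((λ ()) , p))
      (ℕₚ.≤-trans (ℕₚ.+-monoˡ-≤ y x≤y) (ℕₚ.≤-reflexive (cong (y +_) (sym (ℕₚ.+-identityʳ y)))))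

  Expands : Relation a k → ℕ → ℕ → Set
  Expands E s m = ∀ X Y → s ≤ count X → m ≤ count Y → ∃[ i ] ∃[ j ] T (X i) × T (Y j) × T (E i j)

  -- `W` contains `t` disjoint pieces of size `s`. Fewer than `m` vertices of `H` have no neighbour
  -- in a given piece, so each piece sends at least `count H ∸ m` edges into `H`.
  many-edges : (E : Relation a k) {s m : ℕ} → Expands E s m → ∀ t W H → t * s ≤ count W →
    t * (count H ∸ m) ≤ edgeCount E W H
  many-edges E exp zero W H _ = z≤n
  many-edges {a} {k} E {s} {m} exp (suc t) W H large = begin
    (count H ∸ m) + t * (count H ∸ m)          ≤⟨ ℕₚ.+-mono-≤ one (many-edges E exp t (W ∖ P) H rest) ⟩
    edgeCount E P H + edgeCount E (W ∖ P) H    ≡⟨ ∑-distrib-+ (λ j → count λ i → H j ∧ (P i ∧ E i j)) _ ⟨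
    (sum λ j → count (λ i → H j ∧ (P i ∧ E i j)) + count (λ i → H j ∧ ((W ∖ P) i ∧ E i j)))
      ≤⟨ sum-mono _ _ (λ j → count-⊎ {P = λ i → H j ∧ (W i ∧ E i j)}
           (λ i p → let h , pe = ∧⁻ {H j} p ; pi , e = ∧⁻ {P i} pe in ∧⁺ {H j} h (∧⁺ (P⊆W i pi) e))
           (λ i p → let h , pe = ∧⁻ {H j} p ; pi , e = ∧⁻ {(W ∖ P) i} pe in
             ∧⁺ {H j} h (∧⁺ (proj₁ (∧⁻ {W i} pi)) e))
           (λ i p p′ → not⁻ (proj₂ (∧⁻ {W i} (proj₁ (∧⁻ {(W ∖ P) i} (proj₂ (∧⁻ {H j} p′))))))
                         (proj₁ (∧⁻ {P i} (proj₂ (∧⁻ {H j} p)))))) ⟩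
    edgeCount E W H                            ∎
    where
    open ℕₚ.≤-Reasoning
    piece = subset-of-size W s (ℕₚ.m+n≤o⇒m≤o s large)
    P = proj₁ piece
    P⊆W = proj₁ (proj₂ piece)
    rest : t * s ≤ count (W ∖ P)
    rest = ℕₚ.+-cancelˡ-≤ s _ _ (ℕₚ.≤-trans large
      (ℕₚ.≤-trans (count-∖ {P = W} {P}) (ℕₚ.≤-reflexive (cong (_+ count (W ∖ P)) (proj₂ (proj₂ piece))))))
    N? : ∀ j → Dec (∃[ i ] T (H j ∧ (P i ∧ E i j)))
    N? j = Finₚ.any? λ i → T? _
    N : Subset k
    N j = does (N? j)
    H∖N<m : count (H ∖ N) < m
    H∖N<m = ℕₚ.≰⇒> λ m≤ →
      let i , j , p , hn , e = exp P (H ∖ N) (ℕₚ.≤-reflexive (sym (proj₂ (proj₂ piece)))) m≤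
          h , ¬nj = ∧⁻ hn
      in not⁻ ¬nj (T-does⁺ (N? j) (i , ∧⁺ h (∧⁺ p e)))
    N≤ : ∀ j → bit (N j) ≤ count λ i → H j ∧ (P i ∧ E i j)
    N≤ j with N? j
    ... | no _ = z≤n
    ... | yes (i , p) = positive i p
      where
      positive : ∀ {n} {Q : Subset n} i → T (Q i) → 1 ≤ count Q
      positive {Q = Q} zero p = ℕₚ.≤-trans (bit-mono {true} λ _ → p) (ℕₚ.m≤m+n (bit (Q zero)) _)
      positive {Q = Q} (suc i) p = ℕₚ.≤-trans (positive i p) (ℕₚ.m≤n+m _ (bit (Q zero)))
    one : count H ∸ m ≤ edgeCount E P H
    one = ℕₚ.≤-trans (ℕₚ.m≤n+o⇒m∸n≤o (count H) m (ℕₚ.≤-trans (count-∖ {P = H} {N})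
      (ℕₚ.≤-trans (ℕₚ.+-monoʳ-≤ (count N) (ℕₚ.<⇒≤ H∖N<m)) (ℕₚ.≤-reflexive (ℕₚ.+-comm (count N) m)))))
      (sum-mono _ _ N≤)

  -- A first pass with 2m hubs leaves fewer than 2js unsatisfied vertices; a second pass then has
  -- enough hubs for every single one of them.
  serve-all : (R S : Relation a k) {s m j : ℕ} → Expands (λ i l → R i l ∨ S i l) s m →
    a < j * m → 4 * (j * s) ≤ m → (H : Subset k) → 4 * m ≤ count H →
    Σ[ φ ∈ Subset k ] Σ[ W ∈ Subset a ] count W < s × (∀ i → ¬ T (W i) → Satisfied R S H φ i)
  serve-all {a} {k} R S {s} {m} {j} exp a<jm 4js≤m H 4m≤H = φ , W₂ , W₂<s , sat
    where
    open ℕₚ.≤-Reasoning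
    E : Relation a k
    E i l = R i l ∨ S i l
    all : Subset a
    all _ = true

    part = subset-of-size H (2 * m) (ℕₚ.≤-trans (ℕₚ.*-monoˡ-≤ m {2} {4} (s≤s (s≤s z≤n))) 4m≤H)
    H₁ = proj₁ part
    H₁⊆H = proj₁ (proj₂ part)
    H₁-size = proj₂ (proj₂ part)
    H₂ = H ∖ H₁
    H₂-size : 2 * m ≤ count H₂
    H₂-size = ℕₚ.+-cancelˡ-≤ (2 * m) _ _ (begin
      2 * m + 2 * m       ≡⟨ ℕₚ.*-distribʳ-+ m 2 2 ⟨
      4 * m               ≤⟨ 4m≤H ⟩
      count H             ≤⟨ count-∖ {P = H} {H₁} ⟩
      count H₁ + count H₂ ≡⟨ cong (_+ count H₂) H₁-size ⟩
      2 * m + count H₂    ∎)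

    pass₁ = halve R S H₁ all
    φ₁ = proj₁ pass₁
    W₁ = proj₁ (proj₂ pass₁)
    sat₁ = proj₁ (proj₂ (proj₂ (proj₂ pass₁)))
    bound₁ = proj₂ (proj₂ (proj₂ (proj₂ pass₁)))

    pass₂ = halve R S H₂ W₁
    φ₂ = proj₁ pass₂
    W₂ = proj₁ (proj₂ pass₂)
    sat₂ = proj₁ (proj₂ (proj₂ (proj₂ pass₂)))
    bound₂ = proj₂ (proj₂ (proj₂ (proj₂ pass₂)))

    m≤H₁∸m : ∀ {H : Subset k} → 2 * m ≤ count H → m ≤ count H ∸ m
    m≤H₁∸m 2m≤ = ℕₚ.≤-trans
      (ℕₚ.≤-reflexive (sym (trans (cong (λ z → (m + z) ∸ m) (ℕₚ.+-identityʳ m)) (ℕₚ.m+n∸m≡n m m))))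
      (ℕₚ.∸-monoˡ-≤ m 2m≤)

    -- Otherwise `2j` pieces would send `m` edges each into `H₁`, but the first pass leaves at most
    -- `2a`, which is less than `2jm`.
    W₁<2js : count W₁ < 2 * j * s
    W₁<2js = ℕₚ.≰⇒> λ large → ℕₚ.<⇒≱ a<jm (ℕₚ.*-cancelˡ-≤ 2 (begin
      2 * (j * m)                          ≡⟨ ℕₚ.*-assoc 2 j m ⟨
      2 * j * m                            ≤⟨ ℕₚ.*-monoʳ-≤ (2 * j) (m≤H₁∸m {H₁} (ℕₚ.≤-reflexive (sym H₁-size))) ⟩
      2 * j * (count H₁ ∸ m)               ≤⟨ many-edges E exp (2 * j) W₁ H₁ large ⟩
      edgeCount E W₁ H₁                    ≤⟨ ℕₚ.m≤m+n _ _ ⟩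
      edgeCount E W₁ H₁ + 2 * count W₁     ≤⟨ bound₁ ⟩
      2 * count all                        ≡⟨ cong (2 *_) (count-all a) ⟩
      2 * a                                ∎))

    -- A single piece would send `m` edges into `H₂`, more than the `2 * count W₁` that the second
    -- pass allows.
    W₂<s : count W₂ < s
    W₂<s = ℕₚ.≰⇒> λ large → ℕₚ.<-irrefl refl (begin-strict
      m                                    ≤⟨ m≤H₁∸m {H₂} H₂-size ⟩
      count H₂ ∸ m                         ≡⟨ ℕₚ.*-identityˡ _ ⟨
      1 * (count H₂ ∸ m)                   ≤⟨ many-edges E exp 1 W₂ H₂ (ℕₚ.≤-trans (ℕₚ.≤-reflexive (ℕₚ.*-identityˡ s)) large) ⟩
      edgeCount E W₂ H₂                    ≤⟨ ℕₚ.m≤m+n _ _ ⟩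
      edgeCount E W₂ H₂ + 2 * count W₂     ≤⟨ bound₂ ⟩
      2 * count W₁                         <⟨ ℕₚ.*-monoʳ-< 2 W₁<2js ⟩
      2 * (2 * j * s)                      ≡⟨ cong (2 *_) (ℕₚ.*-assoc 2 j s) ⟩
      2 * (2 * (j * s))                    ≡⟨ ℕₚ.*-assoc 2 2 (j * s) ⟨
      4 * (j * s)                          ≤⟨ 4js≤m ⟩
      m                                    ∎)

    φ : Subset k
    φ l = if H₁ l then φ₁ l else φ₂ l

    φ-H₁ : ∀ l → T (H₁ l) → φ l ≡ φ₁ l
    φ-H₁ l h with H₁ l
    ... | true = refl

    φ-H₂ : ∀ l → T (not (H₁ l)) → φ l ≡ φ₂ l
    φ-H₂ l h with H₁ l
    ... | false = refl

    move : ∀ i l (ψ : Subset k) → φ l ≡ ψ l → T (ψ l) × T (R i l) ⊎ ¬ T (ψ l) × T (S i l) →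
      T (φ l) × T (R i l) ⊎ ¬ T (φ l) × T (S i l)
    move i l ψ e = subst (λ b → T b × T (R i l) ⊎ ¬ T b × T (S i l)) (sym e)

    sat : ∀ i → ¬ T (W₂ i) → Satisfied R S H φ i
    sat i ¬w with em (W₁ i)
    ... | inj₁ w₁ = let l , h , p = sat₂ i w₁ ¬w ; h′ , ¬h₁ = ∧⁻ h in l , h′ , move i l φ₂ (φ-H₂ l ¬h₁) p
    ... | inj₂ ¬w₁ = let l , h , p = sat₁ i tt ¬w₁ in l , H₁⊆H l h , move i l φ₁ (φ-H₁ l h) p

-- Disjoint trees from cores, hubs and leaves
module _ where
  open import Data.Nat using (_+_; _*_; _∸_; _≤_; _<_; z≤n; s≤s)
  open import Relation.Binary.Construct.Closure.ReflexiveTransitive as Star using (Star; ε; _◅_; _◅◅_)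

  count-cong : ∀ {n} {P Q : Subset n} → (∀ i → P i ≡ Q i) → count P ≡ count Q
  count-cong h = sum-cong-≗ (λ i → cong bit (h i))

  length-filterᵇ-tabulate : ∀ {n} {A : Set} (P : A → Bool) (f : Fin n → A) →
    length (List.filterᵇ P (List.tabulate f)) ≡ count (P ∘ f)
  length-filterᵇ-tabulate {zero}  P f = refl
  length-filterᵇ-tabulate {suc n} P f with P (f zero)
  ... | true  = cong suc (length-filterᵇ-tabulate P (f ∘ suc))
  ... | false = length-filterᵇ-tabulate P (f ∘ suc)

  other : Fin 2 → Fin 2
  other zero       = suc zero
  other (suc zero) = zero

  ≡-or-other : ∀ (c κ : Fin 2) → c ≡ κ ⊎ c ≡ other κ
  ≡-or-other zero       zero       = inj₁ refl
  ≡-or-other zero       (suc zero) = inj₂ refl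
  ≡-or-other (suc zero) zero       = inj₂ refl
  ≡-or-other (suc zero) (suc zero) = inj₁ refl

  -- Disjoint trees as the classes of a partial labelling.

  module DisjointTrees {n : ℕ} (B : BipartiteGraph n n) (χ : Colouring (toGraph B) 2) where
    G = toGraph B
    open Graph G
    open Colouring χ
    open ComponentCovers {G} (sides n n) sides-complete _≟ᵛ_ using (Mono)
    open SpanningTree {G} (sides n n) sides-complete _≟ᵛ_ χ
    open FiniteSearch (sides n n) sides-complete

    M : Fin 2 → V → V → Set
    M = Mono χ

    M? : ∀ κ u v → Dec (M κ u v)
    M? κ u v = T? (adj u v) ×-dec (colour u v Fin.≟ κ)

    M-sym : ∀ {κ} u v → M κ u v → M κ v u
    M-sym u v (a , c) = symm u v a , trans (sym (symmC u v a)) c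

    M-colour : ∀ κ {u v} → T (adj u v) → M κ u v ⊎ M (other κ) u v
    M-colour κ {u} {v} a with ≡-or-other (colour u v) κ
    ... | inj₁ c = inj₁ (a , c)
    ... | inj₂ c = inj₂ (a , c)

    record ConnectedIn (κ : Fin 2) (C : V → Bool) : Set where
      field
        root  : V
        root∈ : T (C root)
        paths : ∀ v → T (C v) → Star (Step κ C) v root

    step-mono : ∀ {κ C C′} → (∀ v → T (C v) → T (C′ v)) → ∀ {u v} →
      Star (Step κ C) u v → Star (Step κ C′) u v
    step-mono ⊆ = Star.map λ (a , b , e) → ⊆ _ a , ⊆ _ b , e

    connected-resp : ∀ {κ C C′} → (∀ v → T (C v) → T (C′ v)) → (∀ v → T (C′ v) → T (C v)) →
      ConnectedIn κ C → ConnectedIn κ C′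
    connected-resp ⊆ ⊇ c = record
      { root  = root
      ; root∈ = ⊆ root root∈
      ; paths = λ v v∈ → step-mono ⊆ (paths v (⊇ v v∈))
      }
      where open ConnectedIn c

    module _ {k : ℕ} (col : Fin k → Fin 2) where

      class : (V → Maybe (Fin k)) → Fin k → V → Bool
      class lab q v = does (Maybeₚ.≡-dec Fin._≟_ (lab v) (just q))

      class⁺ : ∀ lab {q} v → lab v ≡ just q → T (class lab q v)
      class⁺ lab {q} v = T-does⁺ (Maybeₚ.≡-dec Fin._≟_ (lab v) (just q))

      class⁻ : ∀ lab {q} v → T (class lab q v) → lab v ≡ just q
      class⁻ lab {q} v = T-does⁻ (Maybeₚ.≡-dec Fin._≟_ (lab v) (just q))

      -- Classes of different labels are disjoint by construction, so while trees grow only their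
      -- connectedness has to be maintained.
      record Labelling : Set where
        field
          lab       : V → Maybe (Fin k)
          connected : ∀ q → ConnectedIn (col q) (class lab q)

      fromFamily : (C : Fin k → V → Bool) → (∀ q → ConnectedIn (col q) (C q)) →
        (∀ q q′ v → T (C q v) → T (C q′ v) → q ≡ q′) →
        Σ[ L ∈ Labelling ] (∀ q v → T (C q v) → Labelling.lab L v ≡ just q) ×
                           (∀ v → (∀ q → ¬ T (C q v)) → Labelling.lab L v ≡ nothing)
      fromFamily C conn disj = record
          { lab = lab
          ; connected = λ q → connected-resp (λ v c → class⁺ lab v (lab⁺ q v c))
              (λ v c → lab⁻ q v (class⁻ lab v c)) (conn q) }
        , lab⁺ , lab-nothing
        where
        in? : ∀ v → Dec (∃[ q ] T (C q v))
        in? v = Finₚ.any? λ q → T? (C q v)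
        lab : V → Maybe (Fin k)
        lab v with in? v
        ... | yes (q , _) = just q
        ... | no _        = nothing
        lab⁺ : ∀ q v → T (C q v) → lab v ≡ just q
        lab⁺ q v c with in? v
        ... | yes (q′ , c′) = cong just (disj q′ q v c′ c)
        ... | no ¬c         = contradiction (q , c) ¬c
        lab⁻ : ∀ q v → lab v ≡ just q → T (C q v)
        lab⁻ q v e with in? v
        lab⁻ q v refl | yes (q , c) = c
        lab-nothing : ∀ v → (∀ q → ¬ T (C q v)) → lab v ≡ nothing
        lab-nothing v ¬c with in? v
        ... | yes (q , c) = contradiction c (¬c q)
        ... | no _        = refl

      module _ (L : Labelling) where
        open Labelling L

        Holds : Fin k → V → Set
        Holds q v = ∃[ u ] lab u ≡ just q × M (col q) v u

        -- Old labels take precedence, so no tree loses a vertex, and every new vertex hangs by one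
        -- edge of the right colour on a vertex that was labelled before.
        extend : (f : V → Maybe (Fin k)) → (∀ v q → lab v ≡ nothing → f v ≡ just q → Holds q v) →
          Labelling
        extend f held = record { lab = lab′ ; connected = conn }
          where
          lab′ : V → Maybe (Fin k)
          lab′ v = lab v <∣> f v
          keep : ∀ {q v} → lab v ≡ just q → lab′ v ≡ just q
          keep {v = v} e with just _ ← lab v = e
          keepᶜ : ∀ {q} v → T (class lab q v) → T (class lab′ q v)
          keepᶜ v c = class⁺ lab′ v (keep (class⁻ lab v c))
          path : ∀ q v → lab′ v ≡ just q → (m : Maybe (Fin k)) → lab v ≡ m →
            Star (Step (col q) (class lab′ q)) v (ConnectedIn.root (connected q))
          path q v e (just q′) l = step-mono keepᶜ (ConnectedIn.paths (connected q) v
            (class⁺ lab v (trans l (sym (trans (sym e) (keep l))))))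
          path q v e nothing l with held v q l (trans (sym (cong (_<∣> f v) l)) e)
          ... | u , lu , m = (class⁺ lab′ v e , keepᶜ u (class⁺ lab u lu) , m) ◅
                  step-mono keepᶜ (ConnectedIn.paths (connected q) u (class⁺ lab u lu))
          conn : ∀ q → ConnectedIn (col q) (class lab′ q)
          conn q = record
            { root  = ConnectedIn.root (connected q)
            ; root∈ = keepᶜ _ (ConnectedIn.root∈ (connected q))
            ; paths = λ v c → path q v (class⁻ lab′ v c) (lab v) refl
            }

        DisjointCover : ℕ → Set
        DisjointCover N = Σ[ t ∈ (Fin k → MonochromaticTree χ) ]
          (∀ q q′ → q ≢ q′ → Disjoint (t q) (t q′)) ×
          Σ[ xs ∈ List V ] length xs ≤ N × (∀ v → v ∈ xs ⊎ ∃[ q ] v ∈ᵗ t q)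

      toTrees : (L : Labelling) (W : V → Bool) →
        (∀ v → ¬ T (W v) → ∃[ q ] Labelling.lab L v ≡ just q) →
        DisjointCover L (count (W ∘ inj₁) + count (W ∘ inj₂))
      toTrees L W cov = t , disj , xs , length≤ , covers
        where
        open Labelling L
        t : Fin k → MonochromaticTree χ
        t q = spanningTree (col q) (class lab q) root root∈ paths
          where open ConnectedIn (connected q)
        disj : ∀ q q′ → q ≢ q′ → Disjoint (t q) (t q′)
        disj q q′ q≢q′ v (c , c′) = q≢q′ (Maybeₚ.just-injective
          (trans (sym (class⁻ lab v c)) (class⁻ lab v c′)))
        WA = List.filterᵇ (W ∘ inj₁) (List.allFin n)
        WB = List.filterᵇ (W ∘ inj₂) (List.allFin n)
        xs = List.map inj₁ WA ++ List.map inj₂ WB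
        length≤ : length xs ≤ count (W ∘ inj₁) + count (W ∘ inj₂)
        length≤ = ℕₚ.≤-reflexive (trans (Listₚ.length-++ (List.map inj₁ WA))
          (cong₂ _+_ (trans (Listₚ.length-map inj₁ WA) (length-filterᵇ-tabulate (W ∘ inj₁) id))
                     (trans (Listₚ.length-map inj₂ WB) (length-filterᵇ-tabulate (W ∘ inj₂) id))))
        member : ∀ v → T (W v) → v ∈ xs
        member (inj₁ i) w = ∈ₚ.∈-++⁺ˡ (∈ₚ.∈-map⁺ inj₁ (∈ₚ.∈-filter⁺ (T? ∘ W ∘ inj₁) (∈ₚ.∈-allFin i) w))
        member (inj₂ j) w = ∈ₚ.∈-++⁺ʳ (List.map inj₁ WA)
          (∈ₚ.∈-map⁺ inj₂ (∈ₚ.∈-filter⁺ (T? ∘ W ∘ inj₂) (∈ₚ.∈-allFin j) w))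
        covers : ∀ v → v ∈ xs ⊎ ∃[ q ] v ∈ᵗ t q
        covers v with em (W v)
        ... | inj₁ w  = inj₁ (member v w)
        ... | inj₂ ¬w = let q , e = cov v ¬w in inj₂ (q , class⁺ lab v e)

      attach-leaves : (L : Labelling) (W : V → Bool) → (∀ v → ¬ T (W v) → ∃[ q ] Holds L q v) →
        Σ[ L′ ∈ Labelling ] DisjointCover L′ (count (W ∘ inj₁) + count (W ∘ inj₂))
      attach-leaves L W cov = L′ , toTrees L′ W labelled
        where
        open Labelling L
        holds? : ∀ v → Dec (∃[ q ] Holds L q v)
        holds? v = Finₚ.any? λ q → exists? λ u →
          Maybeₚ.≡-dec Fin._≟_ (lab u) (just q) ×-dec M? (col q) v u
        f : V → Maybe (Fin k)
        f v with holds? v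
        ... | yes (q , _) = just q
        ... | no _        = nothing
        f-held : ∀ v q → lab v ≡ nothing → f v ≡ just q → Holds L q v
        f-held v q _ e with holds? v
        f-held v q _ refl | yes (q , h) = h
        f-def : ∀ v → ∃[ q ] Holds L q v → ∃[ q ] f v ≡ just q
        f-def v h with holds? v
        ... | yes (q , _) = q , refl
        ... | no ¬h       = contradiction h ¬h
        L′ = extend L f f-held
        labelled : ∀ v → ¬ T (W v) → ∃[ q ] Labelling.lab L′ v ≡ just q
        labelled v ¬w with lab v
        ... | just q  = q , refl
        ... | nothing = f-def v (cov v ¬w)

    -- The arguments about hubs are needed once for each class. `l` and `r` exchange the roles of
    -- the classes, and `glue` assembles a vertex set from its two halves; `glue-l` and `glue-r` are
    -- equations because they do not compute for a variable orientation.
    record Orientation : Set where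
      field
        l r    : Fin n → V
        glue   : Subset n → Subset n → V → Bool
        glue-l : ∀ P Q i → glue P Q (l i) ≡ P i
        glue-r : ∀ P Q j → glue P Q (r j) ≡ Q j
        cases  : ∀ v → (∃[ i ] v ≡ l i) ⊎ (∃[ j ] v ≡ r j)

    forward backward : Orientation
    forward = record
      { l = inj₁ ; r = inj₂
      ; glue = λ { P Q (inj₁ i) → P i ; P Q (inj₂ j) → Q j }
      ; glue-l = λ _ _ _ → refl ; glue-r = λ _ _ _ → refl
      ; cases = λ { (inj₁ i) → inj₁ (i , refl) ; (inj₂ j) → inj₂ (j , refl) }
      }
    backward = record
      { l = inj₂ ; r = inj₁
      ; glue = λ { P Q (inj₂ i) → P i ; P Q (inj₁ j) → Q j }
      ; glue-l = λ _ _ _ → refl ; glue-r = λ _ _ _ → refl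
      ; cases = λ { (inj₂ i) → inj₁ (i , refl) ; (inj₁ j) → inj₂ (j , refl) }
      }

    module _ {k : ℕ} {col : Fin k → Fin 2} where

      record Hubs (L : Labelling col) (o : Orientation) (N : ℕ) : Set where
        open Orientation o
        open Labelling L
        field
          H      : Subset n
          tag    : Fin n → Fin k
          fresh  : ∀ j → T (H j) → lab (r j) ≡ nothing
          held   : ∀ j → T (H j) → Holds col L (tag j) (r j)
          W      : Subset n
          W≤     : count W ≤ N
          served : ∀ i → ¬ T (W i) → ∃[ j ] T (H j) × M (col (tag j)) (l i) (r j)

      -- `held` refers to the labels before any hub has joined, so the hubs of both classes are
      -- added in one extension. A second extension hangs the served vertices on the hubs.
      fromHubs : ∀ (L : Labelling col) {N₁ N₂} → Hubs L forward N₁ → Hubs L backward N₂ →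
        ∃[ L′ ] DisjointCover col L′ (N₁ + N₂)
      fromHubs L {N₁} {N₂} h₁ h₂ = let L″ , t , d , xs , len , c = attach-leaves col L′ W held′ in
        L″ , t , d , xs , ℕₚ.≤-trans len (ℕₚ.+-mono-≤ (Hubs.W≤ h₁) (Hubs.W≤ h₂)) , c
        where
        open Labelling L
        module h₁ = Hubs h₁
        module h₂ = Hubs h₂
        W : V → Bool
        W (inj₁ i) = h₁.W i
        W (inj₂ j) = h₂.W j
        f : V → Maybe (Fin k)
        f (inj₁ i) = if h₂.H i then just (h₂.tag i) else nothing
        f (inj₂ j) = if h₁.H j then just (h₁.tag j) else nothing
        f-held : ∀ v q → lab v ≡ nothing → f v ≡ just q → Holds col L q v
        f-held (inj₁ i) q _ e with h₂.H i | h₂.held i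
        f-held (inj₁ i) q _ refl | true | h = h tt
        f-held (inj₂ j) q _ e with h₁.H j | h₁.held j
        f-held (inj₂ j) q _ refl | true | h = h tt
        L′ = extend col L f f-held
        hub₁ : ∀ j → T (h₁.H j) → Labelling.lab L′ (inj₂ j) ≡ just (h₁.tag j)
        hub₁ j h with lab (inj₂ j) | h₁.fresh j h | h₁.H j | h
        ... | nothing | _ | true | _ = refl
        hub₂ : ∀ j → T (h₂.H j) → Labelling.lab L′ (inj₁ j) ≡ just (h₂.tag j)
        hub₂ j h with lab (inj₁ j) | h₂.fresh j h | h₂.H j | h
        ... | nothing | _ | true | _ = refl
        held′ : ∀ v → ¬ T (W v) → ∃[ q ] Holds col L′ q v
        held′ (inj₁ i) ¬w = let j , h , m = h₁.served i ¬w in h₁.tag j , inj₂ j , hub₁ j h , m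
        held′ (inj₂ i) ¬w = let j , h , m = h₂.served i ¬w in h₂.tag j , inj₁ j , hub₂ j h , m

    -- A large monochromatic component, or two large sets without an edge of that colour.

    module _ (o : Orientation) (κ : Fin 2) (U : V → Bool) {α β : ℕ}
      (large-l : 3 * α ≤ count (U ∘ Orientation.l o)) (large-r : 3 * β ≤ count (U ∘ Orientation.r o))
      where
      open Orientation o

      Gap : Set
      Gap = Σ[ X ∈ Subset n ] Σ[ Y ∈ Subset n ]
        (∀ i → T (X i) → T (U (l i))) × (∀ j → T (Y j) → T (U (r j))) ×
        α ≤ count X × β ≤ count Y × (∀ i j → T (X i) → T (Y j) → ¬ M κ (l i) (r j))

      record LargeCore : Set where
        field
          C          : V → Bool
          C⊆U        : ∀ v → T (C v) → T (U v)
          connected  : ConnectedIn κ C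
          misses-l   : count (U ∘ l) ≤ count (C ∘ l) + 2 * α
          misses-r   : count (U ∘ r) ≤ count (C ∘ r) + 2 * β

      private
        open Reachability (sides n n) sides-complete _≟ᵛ_ (Step? κ U)

        -- Empty if `c` lies outside `U`, since walks stay in `U`; this is why `comp-connected` asks
        -- for a member.
        comp : V → V → Bool
        comp c v = U v ∧ does (star? v c)

        -- Built along the list so that it grows by at most one component at a time, up to all of
        -- `U` for the full list of vertices.
        D : List V → V → Bool
        D []       v = false
        D (c ∷ ws) v = comp c v ∨ D ws v

        comp-closed : ∀ c {u v} → T (comp c u) → Step κ U u v → T (comp c v)
        comp-closed c {u} {v} cu s = ∧⁺ (proj₁ (proj₂ s))
          (T-does⁺ (star? v c) (step-sym s ◅ T-does⁻ (star? u c) (proj₂ (∧⁻ {U u} cu))))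

        D-closed : ∀ ws {u v} → T (D ws u) → Step κ U u v → T (D ws v)
        D-closed (c ∷ ws) {u} d s with ∨⁻ {comp c u} d
        ... | inj₁ cu = ∨⁺ˡ (comp-closed c cu s)
        ... | inj₂ du = ∨⁺ʳ (D-closed ws du s)

        D-full : ∀ ws {v} → v ∈ ws → T (U v) → T (D ws v)
        D-full (c ∷ ws) {v} (here refl) u = ∨⁺ˡ (∧⁺ u (T-does⁺ (star? v v) ε))
        D-full (c ∷ ws) (there m) u = ∨⁺ʳ (D-full ws m u)

        D⊆U : ∀ ws {v} → T (D ws v) → T (U v)
        D⊆U (c ∷ ws) {v} d with ∨⁻ {comp c v} d
        ... | inj₁ cv = proj₁ (∧⁻ cv)
        ... | inj₂ dv = D⊆U ws dv

        Reached : List V → Set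
        Reached ws = α ≤ count (D ws ∘ l) ⊎ β ≤ count (D ws ∘ r)

        reached? : ∀ ws → Dec (Reached ws)
        reached? ws = (α ℕ.≤? count (D ws ∘ l)) ⊎-dec (β ℕ.≤? count (D ws ∘ r))

        comp-connected : ∀ c v₀ → T (comp c v₀) → ConnectedIn κ (comp c)
        comp-connected c v₀ v₀∈ = record
          { root  = c
          ; root∈ = ∧⁺ (end (proj₁ (∧⁻ v₀∈)) (T-does⁻ (star? v₀ c) (proj₂ (∧⁻ {U v₀} v₀∈))))
                       (T-does⁺ (star? c c) ε)
          ; paths = λ v v∈ → inside (proj₁ (∧⁻ v∈)) (T-does⁻ (star? v c) (proj₂ (∧⁻ {U v} v∈)))
          }
          where
          end : ∀ {v} → T (U v) → Star (Step κ U) v c → T (U c)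
          end u ε       = u
          end u (s ◅ p) = end (proj₁ (proj₂ s)) p
          inside : ∀ {v} → T (U v) → Star (Step κ U) v c → Star (Step κ (comp c)) v c
          inside u ε = ε
          inside {v} u (_◅_ {j = w} s p) =
            (∧⁺ u (T-does⁺ (star? v c) (s ◅ p)) , ∧⁺ (proj₁ (proj₂ s)) (T-does⁺ (star? w c) p) , proj₂ (proj₂ s))
            ◅ inside (proj₁ (proj₂ s)) p

        -- c is the component whose addition makes the union D reach one of the two sizes.
        module Threshold (0<α : 0 < α) (c : V) (ws : List V) (reached : Reached (c ∷ ws))
          (small : ¬ Reached ws) where
          open ℕₚ.≤-Reasoning

          D₁ = D (c ∷ ws)
          A = U ∖ D₁

          no-edge : ∀ {u v} → T (D₁ u) → T (A v) → ¬ M κ u v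
          no-edge {u} {v} d a m = not⁻ (proj₂ (∧⁻ {U v} a))
            (D-closed (c ∷ ws) d (D⊆U (c ∷ ws) d , proj₁ (∧⁻ a) , m))

          split : ∀ (e : Fin n → V) → count (U ∘ e) ≤ count (D₁ ∘ e) + count (A ∘ e)
          split e = count-∖ {P = U ∘ e} {D₁ ∘ e}

          split₁ : ∀ (e : Fin n → V) → count (D₁ ∘ e) ≤ count (comp c ∘ e) + count (D ws ∘ e)
          split₁ e = count-∪ λ i d → ∨⁻ {comp c (e i)} d

          grow : ∀ {x d a} → 3 * x ≤ d + a → a < x → x ≤ d
          grow {x} {d} {a} h a<x = ℕₚ.+-cancelʳ-≤ x _ _ (begin
            x + x           ≤⟨ ℕₚ.m≤m+n (x + x) x ⟩
            x + x + x       ≡⟨ trans (ℕₚ.+-assoc x x x) (cong (λ z → x + (x + z)) (sym (ℕₚ.+-identityʳ x))) ⟩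
            3 * x           ≤⟨ h ⟩
            d + a           ≤⟨ ℕₚ.+-monoʳ-≤ d (ℕₚ.<⇒≤ a<x) ⟩
            d + x           ∎)

          misses : ∀ (e : Fin n → V) {x} → count (D ws ∘ e) < x → count (A ∘ e) < x →
            count (U ∘ e) ≤ count (comp c ∘ e) + 2 * x
          misses e {x} d<x a<x = begin
            count (U ∘ e)                                            ≤⟨ split e ⟩
            count (D₁ ∘ e) + count (A ∘ e)                           ≤⟨ ℕₚ.+-mono-≤ (split₁ e) (ℕₚ.<⇒≤ a<x) ⟩
            count (comp c ∘ e) + count (D ws ∘ e) + x                ≤⟨ ℕₚ.+-monoˡ-≤ x (ℕₚ.+-monoʳ-≤ _ (ℕₚ.<⇒≤ d<x)) ⟩
            count (comp c ∘ e) + x + x                               ≡⟨ trans (ℕₚ.+-assoc _ x x) (cong (λ z → count (comp c ∘ e) + (x + z)) (sym (ℕₚ.+-identityʳ x))) ⟩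
            count (comp c ∘ e) + 2 * x                               ∎

          gap₁ : α ≤ count (D₁ ∘ l) → β ≤ count (A ∘ r) → Gap
          gap₁ x y = D₁ ∘ l , A ∘ r , (λ i d → D⊆U (c ∷ ws) d) , (λ j a → proj₁ (∧⁻ a)) , x , y ,
            λ i j → no-edge

          gap₂ : α ≤ count (A ∘ l) → β ≤ count (D₁ ∘ r) → Gap
          gap₂ x y = A ∘ l , D₁ ∘ r , (λ i a → proj₁ (∧⁻ a)) , (λ j d → D⊆U (c ∷ ws) d) , x , y ,
            λ i j a d m → no-edge d a (M-sym (l i) (r j) m)

          core : count (A ∘ l) < α → count (A ∘ r) < β → LargeCore
          core al<α ar<β = record
            { C         = comp c
            ; C⊆U       = λ v v∈ → proj₁ (∧⁻ v∈)
            ; connected = let i , i∈ = inhabited in comp-connected c (l i) i∈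
            ; misses-l  = ml
            ; misses-r  = misses r (ℕₚ.≰⇒> (small ∘ inj₂)) ar<β
            }
            where
            ml : count (U ∘ l) ≤ count (comp c ∘ l) + 2 * α
            ml = misses l (ℕₚ.≰⇒> (small ∘ inj₁)) al<α
            inhabited : ∃[ i ] T (comp c (l i))
            inhabited = count-inhabited (comp c ∘ l) (ℕₚ.<-≤-trans 0<α
              (ℕₚ.+-cancelʳ-≤ (2 * α) _ _ (ℕₚ.≤-trans large-l ml)))

          decide : Gap ⊎ LargeCore
          decide = go (α ℕ.≤? count (A ∘ l)) (β ℕ.≤? count (A ∘ r)) reached
            where
            go : Dec (α ≤ count (A ∘ l)) → Dec (β ≤ count (A ∘ r)) → Reached (c ∷ ws) → Gap ⊎ LargeCore
            go (no  al) (no  ar) _         = inj₂ (core (ℕₚ.≰⇒> al) (ℕₚ.≰⇒> ar))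
            go _        (yes ar) (inj₁ dl) = inj₁ (gap₁ dl ar)
            go (yes al) _        (inj₂ dr) = inj₁ (gap₂ al dr)
            -- Few vertices on the right are outside the union, so the union has at least `β` of the
            -- `3 * β` there as well.
            go (yes al) (no  ar) (inj₁ dl) =
              inj₁ (gap₂ al (grow (ℕₚ.≤-trans large-r (split r)) (ℕₚ.≰⇒> ar)))
            go (no  al) (yes ar) (inj₂ dr) =
              inj₁ (gap₁ (grow (ℕₚ.≤-trans large-l (split l)) (ℕₚ.≰⇒> al)) ar)

        unreached-[] : 0 < α → 0 < β → ¬ Reached []
        unreached-[] 0<α 0<β (inj₁ x) = ℕₚ.<⇒≱ 0<α
          (ℕₚ.≤-trans x (ℕₚ.≤-reflexive (count-empty {n} {λ _ → false} (λ _ ()))))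
        unreached-[] 0<α 0<β (inj₂ y) = ℕₚ.<⇒≱ 0<β
          (ℕₚ.≤-trans y (ℕₚ.≤-reflexive (count-empty {n} {λ _ → false} (λ _ ()))))

        search : 0 < α → 0 < β → ∀ ws → Reached ws → Gap ⊎ LargeCore
        search 0<α 0<β [] reached = contradiction reached (unreached-[] 0<α 0<β)
        search 0<α 0<β (c ∷ ws) reached with reached? ws
        ... | yes r = search 0<α 0<β ws r
        ... | no ¬r = Threshold.decide 0<α c ws reached ¬r

      -- No edge of colour `κ` leaves a union of components. If, at the moment when the union
      -- becomes large, enough of `U` is still outside, this is a gap. If not, the component added
      -- last is itself large: on each side it misses fewer than one unit in the earlier components
      -- and fewer than one outside.
      gap-or-core : 0 < α → 0 < β → Gap ⊎ LargeCore
      gap-or-core 0<α 0<β = search 0<α 0<β (sides n n) (inj₁ (begin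
        α                                ≤⟨ ℕₚ.m≤n*m α 3 ⟩
        3 * α                            ≤⟨ large-l ⟩
        count (U ∘ l)                    ≤⟨ count-⊆ (λ i u → D-full (sides n n) (sides-complete (l i)) u) ⟩
        count (D (sides n n) ∘ l)        ∎))
        where open ℕₚ.≤-Reasoning

  -- Few disjoint trees from expansion alone.

  module Cover {n : ℕ} (B : BipartiteGraph n n) (χ : Colouring (toGraph B) 2) {s m j : ℕ}
    (expand₁ : Expands (edge B) s m) (expand₂ : Expands (edge B) m s)
    (0<s : 0 < s) (n<jm : n < j * m) (4js≤m : 4 * (j * s) ≤ m) where

    open DisjointTrees B χ
    open Graph G
    open ℕₚ.≤-Reasoning

    s≤m : s ≤ m
    s≤m = go j n<jm 4js≤m
      where
      go : ∀ j → n < j * m → 4 * (j * s) ≤ m → s ≤ m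
      go (suc j) _ h = ℕₚ.≤-trans (ℕₚ.m≤m+n s (j * s)) (ℕₚ.≤-trans (ℕₚ.m≤n*m _ 4) h)

    0<m : 0 < m
    0<m = ℕₚ.<-≤-trans 0<s s≤m

    widen : ∀ {E : Relation n n} → Expands E s m → Expands E m m
    widen exp X Y x y = exp X Y (ℕₚ.≤-trans s≤m x) y

    Adj : Orientation → Relation n n
    Adj o i j = adj (Orientation.l o i) (Orientation.r o j)

    coloured : ∀ o κ {u v} → Expands (Adj o) u v → Expands (λ i j →
      does (M? (other κ) (Orientation.l o i) (Orientation.r o j)) ∨
      does (M? κ (Orientation.l o i) (Orientation.r o j))) u v
    coloured o κ exp X Y x y = let i , j , i∈ , j∈ , e = exp X Y x y in i , j , i∈ , j∈ , go i j e
      where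
      open Orientation o
      go : ∀ i j → T (adj (l i) (r j)) → T (does (M? (other κ) (l i) (r j)) ∨ does (M? κ (l i) (r j)))
      go i j e with M-colour κ {l i} {r j} e
      ... | inj₁ b = ∨⁺ʳ {does (M? (other κ) (l i) (r j))} (T-does⁺ (M? κ (l i) (r j)) b)
      ... | inj₂ a = ∨⁺ˡ (T-does⁺ (M? (other κ) (l i) (r j)) a)

    Served : Orientation → Fin 2 → Fin 2 → Subset n → Subset n → Fin n → Set
    Served o κ₁ κ₀ H φ i = ∃[ j ] T (H j) ×
      (T (φ j) × M κ₁ (l i) (r j) ⊎ ¬ T (φ j) × M κ₀ (l i) (r j))
      where open Orientation o

    serve : ∀ o κ → Expands (Adj o) s m → (H : Subset n) → 4 * m ≤ count H →
      Σ[ φ ∈ Subset n ] Σ[ W ∈ Subset n ] count W < s × (∀ i → ¬ T (W i) → Served o (other κ) κ H φ i)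
    serve o κ exp H H-size =
      let φ , W , W<s , sat = serve-all R S {j = j} (coloured o κ exp) n<jm 4js≤m H H-size in
      φ , W , W<s , λ i ¬w → go φ i (sat i ¬w)
      where
      open Orientation o
      R S : Relation n n
      R i j = does (M? (other κ) (l i) (r j))
      S i j = does (M? κ (l i) (r j))
      go : ∀ φ i → Satisfied R S H φ i → Served o (other κ) κ H φ i
      go φ i (h , h∈ , inj₁ (t , e)) = h , h∈ , inj₁ (t , T-does⁻ (M? (other κ) (l i) (r h)) e)
      go φ i (h , h∈ , inj₂ (t , e)) = h , h∈ , inj₂ (t , T-does⁻ (M? κ (l i) (r h)) e)

    module _ {k : ℕ} (col : Fin k → Fin 2) (L : Labelling col) (o : Orientation) where
      open Orientation o
      open Labelling L

      -- `q₀` is the default that every hub can join, whereas `q₁` must be open only to hubs that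
      -- choose it. A dummy core that no hub chooses thus fits the same interface.
      mkHubs : ∀ {N} q₁ q₀ (H φ W : Subset n) → count W ≤ N →
        (∀ i → ¬ T (W i) → Served o (col q₁) (col q₀) H φ i) →
        (∀ j → T (H j) → lab (r j) ≡ nothing) →
        (∀ j → T (H j) → T (φ j) → Holds col L q₁ (r j)) →
        (∀ j → T (H j) → Holds col L q₀ (r j)) → Hubs L o N
      mkHubs q₁ q₀ H φ W W≤ served fresh held₁ held₀ = record
        { H      = H
        ; tag    = tag
        ; fresh  = fresh
        ; held   = held
        ; W      = W
        ; W≤     = W≤
        ; served = λ i ¬w → served′ i (served i ¬w)
        }
        where
        tag : Fin n → Fin k
        tag j = if φ j then q₁ else q₀
        held : ∀ j → T (H j) → Holds col L (tag j) (r j)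
        held j h with φ j | held₁ j h
        ... | true  | h₁ = h₁ tt
        ... | false | _  = held₀ j h
        served′ : ∀ i → Served o (col q₁) (col q₀) H φ i → ∃[ j ] T (H j) × M (col (tag j)) (l i) (r j)
        served′ i (j , h , e) = j , h , go (φ j) e
          where
          go : ∀ b → T b × M (col q₁) (l i) (r j) ⊎ ¬ T b × M (col q₀) (l i) (r j) →
            M (col (if b then q₁ else q₀)) (l i) (r j)
          go true  (inj₁ (_ , e)) = e
          go true  (inj₂ (f , _)) = contradiction tt f
          go false (inj₂ (_ , e)) = e

    SmallCover : Set
    SmallCover = ∃[ k ] k ≤ 3 × Σ[ t ∈ (Fin k → MonochromaticTree χ) ]
      (∀ q q′ → q ≢ q′ → Disjoint (t q) (t q′)) ×
      Σ[ xs ∈ List V ] length xs ≤ 8 * s × (∀ v → v ∈ xs ⊎ ∃[ q ] v ∈ᵗ t q)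

    toSmallCover : ∀ {k} {col : Fin k → Fin 2} → k ≤ 3 → (L : Labelling col) → ∀ {N₁ N₂} →
      N₁ ≤ 4 * s → N₂ ≤ 4 * s → Hubs L forward N₁ → Hubs L backward N₂ → SmallCover
    toSmallCover k≤3 L N₁≤ N₂≤ h₁ h₂ = let _ , t , d , xs , len , c = fromHubs L h₁ h₂ in
      _ , k≤3 , t , d , xs , ℕₚ.≤-trans len (ℕₚ.≤-trans (ℕₚ.+-mono-≤ N₁≤ N₂≤)
        (ℕₚ.≤-reflexive (sym (ℕₚ.*-distribʳ-+ s 4 4)))) , c

    -- The pair (X , Y) is κ-coloured throughout and Yh ⊆ Y.  E is a core of the other colour that
    -- meets neither X nor Y ∖ Yh; the hubs in Yh may join E or a core of colour κ.
    record SideCore (o : Orientation) (κ : Fin 2) (X Yh : Subset n) : Set where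
      open Orientation o
      field
        E         : V → Bool
        connected : ConnectedIn (other κ) E
        E-l       : ∀ i → T (E (l i)) → ¬ T (X i)
        E-r       : ∀ j → T (E (r j)) → T (Yh j)
        H φ W     : Subset n
        H⊆Yh      : ∀ j → T (H j) → T (Yh j)
        H∩E       : ∀ j → T (H j) → ¬ T (E (r j))
        held      : ∀ j → T (H j) → T (φ j) → ∃[ u ] T (E u) × M (other κ) (r j) u
        W≤        : count W ≤ 4 * s
        served    : ∀ i → ¬ T (W i) → Served o (other κ) κ H φ i

    module _ (o : Orientation) (exp : Expands (Adj o) s m) (κ : Fin 2) (X Y Yh : Subset n)
      (pure : ∀ i j → T (X i) → T (Y j) → ¬ M (other κ) (Orientation.l o i) (Orientation.r o j))
      (Yh⊆Y : ∀ j → T (Yh j) → T (Y j)) (Yh-size : 9 * m ≤ count Yh) where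
      open Orientation o

      private
        κ′ = other κ

        y₀∃ : ∃[ j ] T (Yh j)
        y₀∃ = count-inhabited Yh (ℕₚ.<-≤-trans 0<m (ℕₚ.≤-trans (ℕₚ.m≤n*m m 9) Yh-size))

        y₀ : Fin n
        y₀ = proj₁ y₀∃

        -- `y₀` is kept back to be a core by itself in the case `Dummy`.
        Y° : Subset n
        Y° j = Yh j ∧ not (does (j Fin.≟ y₀))

        Y°⊆Yh : ∀ j → T (Y° j) → T (Yh j)
        Y°⊆Yh j y = proj₁ (∧⁻ y)

        Y°-size : 8 * m ≤ count Y°
        Y°-size = ℕₚ.≤-pred (begin
          1 + 8 * m       ≤⟨ ℕₚ.+-monoˡ-≤ (8 * m) 0<m ⟩
          9 * m           ≤⟨ Yh-size ⟩
          count Yh        ≤⟨ count-remove {P = Yh} y₀ ⟩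
          suc (count Y°)  ∎)

        m≤Y° : m ≤ count Y°
        m≤Y° = ℕₚ.≤-trans (ℕₚ.m≤n*m m 8) Y°-size

        touched? : ∀ i → Dec (∃[ j ] T (Y° j) × M κ (l i) (r j))
        touched? i = Finₚ.any? λ j → T? (Y° j) ×-dec M? κ (l i) (r j)

        untouched : Subset n
        untouched i = not (does (touched? i))

        untouched-free : ∀ i j → T (untouched i) → T (Y° j) → ¬ M κ (l i) (r j)
        untouched-free i j u y e = not⁻ u (T-does⁺ (touched? i) (j , y , e))

        -- No edge between `Z` and `Y°` has colour `κ`: a second pair, pure in the opposite colour.
        Z : Subset n
        Z = untouched ∖ X

      -- Almost every vertex sees `Y°` in colour `κ`, so all hubs join the `κ`-core. The single
      -- vertex `r y₀` stands in for the other core, so that the family has three members in every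
      -- case.
      module Dummy (Z-small : count Z < 3 * s) where
        E : V → Bool
        E = glue (λ _ → false) (λ j → does (j Fin.≟ y₀))

        E-cases : ∀ v → T (E v) → v ≡ r y₀
        E-cases v e with cases v
        ... | inj₁ (i , refl) = ⊥-elim (subst T (glue-l (λ _ → false) _ i) e)
        ... | inj₂ (j , refl) = cong r (T-does⁻ (j Fin.≟ y₀) (subst T (glue-r (λ _ → false) _ j) e))

        -- An edge between this set and `Y°` could have neither colour.
        bad<s : count (λ i → X i ∧ untouched i) < s
        bad<s = ℕₚ.≰⇒> λ s≤ → let i , j , i∈ , j∈ , e = exp (λ i → X i ∧ untouched i) Y° s≤ m≤Y° in
          [ untouched-free i j (proj₂ (∧⁻ {X i} i∈)) j∈
          , pure i j (proj₁ (∧⁻ i∈)) (Yh⊆Y j (Y°⊆Yh j j∈)) ]′ (M-colour κ {l i} {r j} e)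

        result : SideCore o κ X Yh
        result = record
          { E = E
          ; connected = record
              { root  = r y₀
              ; root∈ = subst T (sym (glue-r (λ _ → false) _ y₀)) (T-does⁺ (y₀ Fin.≟ y₀) refl)
              ; paths = λ v v∈ → subst (λ w → Star _ w (r y₀)) (sym (E-cases v v∈)) ε
              }
          ; E-l    = λ i e → ⊥-elim (subst T (glue-l (λ _ → false) _ i) e)
          ; E-r    = λ j e → subst (T ∘ Yh) (sym (T-does⁻ (j Fin.≟ y₀) (subst T (glue-r (λ _ → false) _ j) e)))
              (proj₂ y₀∃)
          ; H      = Y°
          ; φ      = λ _ → false
          ; W      = untouched
          ; H⊆Yh   = Y°⊆Yh
          ; H∩E    = λ j h e → not⁻ (proj₂ (∧⁻ {Yh j} h)) (subst T (glue-r (λ _ → false) _ j) e)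
          ; held   = λ j h ()
          -- Untouched vertices in `X` number less than `s`, those outside `X` less than `3 * s`.
          ; W≤     = ℕₚ.≤-trans (count-∪ λ i u → split i u (em (X i)))
                       (ℕₚ.+-mono-≤ (ℕₚ.<⇒≤ bad<s) (ℕₚ.<⇒≤ Z-small))
          ; served = λ i ¬w → let j , y , e = T-does⁻ (touched? i) (double i ¬w) in
              j , y , inj₂ (id , e)
          }
          where
          split : ∀ i → T (untouched i) → T (X i) ⊎ ¬ T (X i) → T (X i ∧ untouched i) ⊎ T (Z i)
          split i u (inj₁ x) = inj₁ (∧⁺ x u)
          split i u (inj₂ x) = inj₂ (∧⁺ u (not⁺ x))
          double : ∀ i → ¬ T (untouched i) → T (does (touched? i))
          double i ¬u with touched? i
          ... | yes _ = tt
          ... | no _  = contradiction tt ¬u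

      -- Since only `κ′` occurs between `Z` and `Y°`, expansion leaves no gap and yields a `κ′`-core
      -- on `Z` and the reserved set `Yr`. Almost all of `Y° ∖ Yr` sees that core, which makes these
      -- vertices hubs for both colours.
      module Genuine (Z-large : 3 * s ≤ count Z) where
        Yr∃ = subset-of-size Y° (3 * m) (ℕₚ.≤-trans (ℕₚ.*-monoˡ-≤ m {3} {8} (s≤s (s≤s (s≤s z≤n)))) Y°-size)
        Yr = proj₁ Yr∃
        Yr⊆Y° = proj₁ (proj₂ Yr∃)
        U = glue Z Yr

        Z-full : ∀ i j → T (Z i) → T (Y° j) → ¬ M κ (l i) (r j)
        Z-full i j z y = untouched-free i j (proj₁ (∧⁻ z)) y

        U-l : ∀ i → T (U (l i)) → T (Z i)
        U-l i = subst T (glue-l Z Yr i)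

        U-r : ∀ j → T (U (r j)) → T (Yr j)
        U-r j = subst T (glue-r Z Yr j)

        size-l : count (U ∘ l) ≡ count Z
        size-l = count-cong (glue-l Z Yr)

        U-l-size : 3 * s ≤ count (U ∘ l)
        U-l-size = ℕₚ.≤-trans Z-large (ℕₚ.≤-reflexive (sym size-l))

        U-r-size : 3 * m ≤ count (U ∘ r)
        U-r-size = ℕₚ.≤-reflexive (sym (trans (count-cong (glue-r Z Yr)) (proj₂ (proj₂ Yr∃))))

        no-gap : ¬ Gap o κ′ U {s} {m} U-l-size U-r-size
        no-gap (X′ , Y′ , X′⊆ , Y′⊆ , x , y , free) = let i , j , i∈ , j∈ , e = exp X′ Y′ x y in
          [ Z-full i j (U-l i (X′⊆ i i∈)) (Yr⊆Y° j (U-r j (Y′⊆ j j∈))) , free i j i∈ j∈ ]′ (M-colour κ {l i} {r j} e)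

        core : LargeCore o κ′ U {s} {m} U-l-size U-r-size
        core = [ (λ g → contradiction g no-gap) , id ]′ (gap-or-core o κ′ U U-l-size U-r-size 0<s 0<m)
        open LargeCore core renaming (C to E)

        E-left : s ≤ count (E ∘ l)
        E-left = ℕₚ.+-cancelʳ-≤ (2 * s) _ _ (begin
          3 * s                   ≤⟨ Z-large ⟩
          count Z                 ≡⟨ size-l ⟨
          count (U ∘ l)           ≤⟨ misses-l ⟩
          count (E ∘ l) + 2 * s   ∎)

        good? : ∀ j → Dec (∃[ i ] T (E (l i)) × M κ′ (l i) (r j))
        good? j = Finₚ.any? λ i → T? (E (l i)) ×-dec M? κ′ (l i) (r j)

        Yg H : Subset n
        Yg = Y° ∖ Yr
        H j = Yg j ∧ does (good? j)

        lost : Subset n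
        lost j = Yg j ∧ not (does (good? j))

        lost<m : count lost < m
        lost<m = ℕₚ.≰⇒> λ m≤ → let i , j , i∈ , j∈ , e = exp (E ∘ l) lost E-left m≤ ; yg , ¬g = ∧⁻ {Yg j} j∈ in
          [ Z-full i j (U-l i (C⊆U (l i) i∈)) (proj₁ (∧⁻ yg))
          , (λ e′ → not⁻ ¬g (T-does⁺ (good? j) (i , i∈ , e′))) ]′ (M-colour κ {l i} {r j} e)

        H-size : 4 * m ≤ count H
        H-size = ℕₚ.+-cancelˡ-≤ (4 * m) _ _ (begin
          4 * m + 4 * m                       ≡⟨ ℕₚ.*-distribʳ-+ m 4 4 ⟨
          8 * m                               ≤⟨ Y°-size ⟩
          count Y°                            ≤⟨ count-∖ {P = Y°} {Yr} ⟩
          count Yr + count Yg                 ≤⟨ ℕₚ.+-mono-≤ (ℕₚ.≤-reflexive (proj₂ (proj₂ Yr∃))) (count-∪ {Q = lost} {H} split) ⟩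
          3 * m + (count lost + count H)      ≤⟨ ℕₚ.+-monoʳ-≤ (3 * m) (ℕₚ.+-monoˡ-≤ (count H) (ℕₚ.<⇒≤ lost<m)) ⟩
          3 * m + (m + count H)               ≡⟨ ℕₚ.+-assoc (3 * m) m (count H) ⟨
          3 * m + m + count H                 ≡⟨ cong (_+ count H) (ℕₚ.+-comm (3 * m) m) ⟩
          4 * m + count H                     ∎)
          where
          split : ∀ j → T (Yg j) → T (lost j) ⊎ T (H j)
          split j = ∧-split {Yg j} (does (good? j))

        result : SideCore o κ X Yh
        result = let φ , W , W<s , sat = serve o κ exp H H-size in record
          { E         = E
          ; connected = connected
          ; E-l       = λ i e → not⁻ (proj₂ (∧⁻ {untouched i} (U-l i (C⊆U (l i) e))))
          ; E-r       = λ j e → Y°⊆Yh j (Yr⊆Y° j (U-r j (C⊆U (r j) e)))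
          ; H         = H
          ; φ         = φ
          ; W         = W
          ; H⊆Yh      = λ j h → Y°⊆Yh j (proj₁ (∧⁻ (proj₁ (∧⁻ {Yg j} h))))
          ; H∩E       = λ j h e → not⁻ (proj₂ (∧⁻ {Y° j} (proj₁ (∧⁻ {Yg j} h)))) (U-r j (C⊆U (r j) e))
          ; held      = λ j h _ → let i , i∈ , e = T-does⁻ (good? j) (proj₂ (∧⁻ {Yg j} h)) in
              l i , i∈ , M-sym (l i) (r j) e
          ; W≤        = ℕₚ.≤-trans (ℕₚ.<⇒≤ W<s) (ℕₚ.m≤n*m s 4)
          ; served    = sat
          }

      sideCore : SideCore o κ X Yh
      sideCore = go (3 * s ℕ.≤? count Z)
        where
        go : Dec (3 * s ≤ count Z) → SideCore o κ X Yh
        go (yes large) = Genuine.result large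
        go (no ¬large) = Dummy.result (ℕₚ.≰⇒> ¬large)

    forward-expand : Expands (Adj forward) s m
    forward-expand = expand₁

    backward-expand : Expands (Adj backward) s m
    backward-expand X Y x y = let j , i , j∈ , i∈ , e = expand₂ Y X y x in i , j , i∈ , j∈ , e

    -- In each class 14m = 4m + m + 9m: room for the `κ`-core, for vertices that do not see it, and
    -- for candidates for hubs. Of those 9m, at most m pay for `y₀`, 3m hold a core of the other
    -- colour, m may fail to see that core, and 4m become hubs.
    record PurePair (κ : Fin 2) : Set where
      field
        X Y    : Subset n
        X-size : 14 * m ≤ count X
        Y-size : 14 * m ≤ count Y
        pure   : ∀ i j → T (X i) → T (Y j) → ¬ M (other κ) (inj₁ i) (inj₂ j)

    -- The `κ`-core `D` lives in `Xb` and `Yb` and is shared by both classes. Almost all of `X ∖ Xb`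
    -- and `Y ∖ Yb` sees it in colour `κ`, and from there each orientation adds a core of the other
    -- colour.
    module FromPurePair {κ : Fin 2} (pair : PurePair κ) where
      open PurePair pair

      pure⁻ : ∀ j i → T (Y j) → T (X i) → ¬ M (other κ) (inj₂ j) (inj₁ i)
      pure⁻ j i y x e = pure i j x y (M-sym (inj₂ j) (inj₁ i) e)

      Xb∃ = subset-of-size X (4 * m) (ℕₚ.≤-trans (ℕₚ.*-monoˡ-≤ m {4} {14} (s≤s (s≤s (s≤s (s≤s z≤n))))) X-size)
      Yb∃ = subset-of-size Y (4 * m) (ℕₚ.≤-trans (ℕₚ.*-monoˡ-≤ m {4} {14} (s≤s (s≤s (s≤s (s≤s z≤n))))) Y-size)
      Xb = proj₁ Xb∃
      Yb = proj₁ Yb∃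
      Xb⊆X = proj₁ (proj₂ Xb∃)
      Yb⊆Y = proj₁ (proj₂ Yb∃)
      U = Orientation.glue forward Xb Yb

      3m≤4m : ∀ {c} → c ≡ 4 * m → 3 * m ≤ c
      3m≤4m e = ℕₚ.≤-trans (ℕₚ.*-monoˡ-≤ m {3} {4} (s≤s (s≤s (s≤s z≤n)))) (ℕₚ.≤-reflexive (sym e))

      core : LargeCore forward κ U {m} {m} (3m≤4m (proj₂ (proj₂ Xb∃))) (3m≤4m (proj₂ (proj₂ Yb∃)))
      core = [ (λ (X′ , Y′ , X′⊆ , Y′⊆ , x , y , free) →
                 let i , j , i∈ , j∈ , e = widen forward-expand X′ Y′ x y in
                 [ (λ b → contradiction b (free i j i∈ j∈))
                 , (λ r → contradiction r (pure i j (Xb⊆X i (X′⊆ i i∈)) (Yb⊆Y j (Y′⊆ j j∈))))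
                 ]′ (M-colour κ {inj₁ i} {inj₂ j} e))
             , id ]′ (gap-or-core forward κ U _ _ 0<m 0<m)
      open LargeCore core renaming (C to D; C⊆U to D⊆U; connected to D-connected)

      s≤core : ∀ {c d} → c ≡ 4 * m → c ≤ d + 2 * m → s ≤ d
      s≤core {c} {d} e h = ℕₚ.+-cancelʳ-≤ (2 * m) _ _ (begin
        s + 2 * m        ≤⟨ ℕₚ.+-monoˡ-≤ (2 * m) (ℕₚ.≤-trans s≤m (ℕₚ.m≤n*m m 2)) ⟩
        2 * m + 2 * m    ≡⟨ ℕₚ.*-distribʳ-+ m 2 2 ⟨
        4 * m            ≡⟨ e ⟨
        c                ≤⟨ h ⟩
        d + 2 * m        ∎)

      module Hubs⁺ (o : Orientation) (exp : Expands (Adj o) s m) (X Y Yb : Subset n)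
        (pure : ∀ i j → T (X i) → T (Y j) → ¬ M (other κ) (Orientation.l o i) (Orientation.r o j))
        (D⊆X : ∀ i → T (D (Orientation.l o i)) → T (X i))
        (D-size : s ≤ count (D ∘ Orientation.l o))
        (Y-size : 14 * m ≤ count Y) (Yb-size : count Yb ≡ 4 * m) where
        open Orientation o

        held? : ∀ j → Dec (∃[ u ] T (D (l u)) × M κ (r j) (l u))
        held? j = Finₚ.any? λ u → T? (D (l u)) ×-dec M? κ (r j) (l u)

        Yh : Subset n
        Yh j = (Y ∖ Yb) j ∧ does (held? j)

        Yh⊆Y : ∀ j → T (Yh j) → T (Y j)
        Yh⊆Y j y = proj₁ (∧⁻ (proj₁ (∧⁻ {(Y ∖ Yb) j} y)))

        Yh⊆∁Yb : ∀ j → T (Yh j) → ¬ T (Yb j)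
        Yh⊆∁Yb j y = not⁻ (proj₂ (∧⁻ {Y j} (proj₁ (∧⁻ {(Y ∖ Yb) j} y))))

        Yh-held : ∀ j → T (Yh j) → ∃[ u ] T (D u) × M κ (r j) u
        Yh-held j y = let i , d , e = T-does⁻ (held? j) (proj₂ (∧⁻ {(Y ∖ Yb) j} y)) in l i , d , e

        lost : Subset n
        lost j = (Y ∖ Yb) j ∧ not (does (held? j))

        lost<m : count lost < m
        lost<m = ℕₚ.≰⇒> λ m≤ → let i , j , i∈ , j∈ , e = exp (D ∘ l) lost D-size m≤ ; y , ¬h = ∧⁻ {(Y ∖ Yb) j} j∈ in
          [ (λ b → not⁻ ¬h (T-does⁺ (held? j) (i , i∈ , M-sym (l i) (r j) b)))
          , pure i j (D⊆X i i∈) (proj₁ (∧⁻ y)) ]′ (M-colour κ {l i} {r j} e)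

        Yh-size : 9 * m ≤ count Yh
        Yh-size = ℕₚ.+-cancelˡ-≤ (5 * m) _ _ (begin
          5 * m + 9 * m                       ≡⟨ ℕₚ.*-distribʳ-+ m 5 9 ⟨
          14 * m                              ≤⟨ Y-size ⟩
          count Y                             ≤⟨ count-∖ {P = Y} {Yb} ⟩
          count Yb + count (Y ∖ Yb)           ≤⟨ ℕₚ.+-mono-≤ (ℕₚ.≤-reflexive Yb-size) (count-∪ {Q = lost} {Yh} split) ⟩
          4 * m + (count lost + count Yh)     ≤⟨ ℕₚ.+-monoʳ-≤ (4 * m) (ℕₚ.+-monoˡ-≤ (count Yh) (ℕₚ.<⇒≤ lost<m)) ⟩
          4 * m + (m + count Yh)              ≡⟨ ℕₚ.+-assoc (4 * m) m (count Yh) ⟨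
          4 * m + m + count Yh                ≡⟨ cong (_+ count Yh) (ℕₚ.+-comm (4 * m) m) ⟩
          5 * m + count Yh                    ∎)
          where
          split : ∀ j → T ((Y ∖ Yb) j) → T (lost j) ⊎ T (Yh j)
          split j = ∧-split {(Y ∖ Yb) j} (does (held? j))

        side : SideCore o κ X Yh
        side = sideCore o exp κ X Y Yh pure Yh⊆Y Yh-size

      module F = Hubs⁺ forward forward-expand X Y Yb pure (λ i d → Xb⊆X i (D⊆U (inj₁ i) d))
        (s≤core (proj₂ (proj₂ Xb∃)) misses-l) Y-size (proj₂ (proj₂ Yb∃))
      module R = Hubs⁺ backward backward-expand Y X Xb pure⁻ (λ i d → Yb⊆Y i (D⊆U (inj₂ i) d))
        (s≤core (proj₂ (proj₂ Yb∃)) misses-r) X-size (proj₂ (proj₂ Xb∃))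
      module E₁ = SideCore F.side
      module E₂ = SideCore R.side

      col : Fin 3 → Fin 2
      col zero    = κ
      col (suc _) = other κ

      family : Fin 3 → V → Bool
      family zero             = D
      family (suc zero)       = E₁.E
      family (suc (suc zero)) = E₂.E

      family-connected : ∀ q → ConnectedIn (col q) (family q)
      family-connected zero             = D-connected
      family-connected (suc zero)       = E₁.connected
      family-connected (suc (suc zero)) = E₂.connected

      D∩E₁ : ∀ v → T (D v) → ¬ T (E₁.E v)
      D∩E₁ (inj₁ i) d e = E₁.E-l i e (Xb⊆X i (D⊆U (inj₁ i) d))
      D∩E₁ (inj₂ j) d e = F.Yh⊆∁Yb j (E₁.E-r j e) (D⊆U (inj₂ j) d)

      D∩E₂ : ∀ v → T (D v) → ¬ T (E₂.E v)
      D∩E₂ (inj₁ i) d e = R.Yh⊆∁Yb i (E₂.E-r i e) (D⊆U (inj₁ i) d)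
      D∩E₂ (inj₂ j) d e = E₂.E-l j e (Yb⊆Y j (D⊆U (inj₂ j) d))

      -- In the first class `E₁` avoids `X` while `E₂` lies inside `X`; in the second class the
      -- roles are exchanged with `Y`.
      E₁∩E₂ : ∀ v → T (E₁.E v) → ¬ T (E₂.E v)
      E₁∩E₂ (inj₁ i) e e′ = E₁.E-l i e (R.Yh⊆Y i (E₂.E-r i e′))
      E₁∩E₂ (inj₂ j) e e′ = E₂.E-l j e′ (F.Yh⊆Y j (E₁.E-r j e))

      family-disjoint : ∀ q q′ v → T (family q v) → T (family q′ v) → q ≡ q′
      family-disjoint zero zero v a b = refl
      family-disjoint zero (suc zero) v a b = contradiction b (D∩E₁ v a)
      family-disjoint zero (suc (suc zero)) v a b = contradiction b (D∩E₂ v a)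
      family-disjoint (suc zero) zero v a b = contradiction a (D∩E₁ v b)
      family-disjoint (suc zero) (suc zero) v a b = refl
      family-disjoint (suc zero) (suc (suc zero)) v a b = contradiction b (E₁∩E₂ v a)
      family-disjoint (suc (suc zero)) zero v a b = contradiction a (D∩E₂ v b)
      family-disjoint (suc (suc zero)) (suc zero) v a b = contradiction a (E₁∩E₂ v b)
      family-disjoint (suc (suc zero)) (suc (suc zero)) v a b = refl

      L∃ = fromFamily col family family-connected family-disjoint
      L = proj₁ L∃
      label = proj₁ (proj₂ L∃)
      unlabelled = proj₂ (proj₂ L∃)

      hubs₁ : Hubs L forward (4 * s)
      hubs₁ = mkHubs col L forward (suc zero) zero E₁.H E₁.φ E₁.W E₁.W≤ E₁.served
        (λ j h → unlabelled (inj₂ j) λ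
          { zero d             → F.Yh⊆∁Yb j (E₁.H⊆Yh j h) (D⊆U (inj₂ j) d)
          ; (suc zero) e       → E₁.H∩E j h e
          ; (suc (suc zero)) e → E₂.E-l j e (F.Yh⊆Y j (E₁.H⊆Yh j h)) })
        (λ j h t → let u , e , a = E₁.held j h t in u , label (suc zero) u e , a)
        (λ j h → let u , d , a = F.Yh-held j (E₁.H⊆Yh j h) in u , label zero u d , a)

      hubs₂ : Hubs L backward (4 * s)
      hubs₂ = mkHubs col L backward (suc (suc zero)) zero E₂.H E₂.φ E₂.W E₂.W≤ E₂.served
        (λ i h → unlabelled (inj₁ i) λ
          { zero d             → R.Yh⊆∁Yb i (E₂.H⊆Yh i h) (D⊆U (inj₁ i) d)
          ; (suc zero) e       → E₁.E-l i e (R.Yh⊆Y i (E₂.H⊆Yh i h))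
          ; (suc (suc zero)) e → E₂.H∩E i h e })
        (λ i h t → let u , e , a = E₂.held i h t in u , label (suc (suc zero)) u e , a)
        (λ i h → let u , d , a = R.Yh-held i (E₂.H⊆Yh i h) in u , label zero u d , a)

      small-cover : SmallCover
      small-cover = toSmallCover ℕₚ.≤-refl L ℕₚ.≤-refl ℕₚ.≤-refl hubs₁ hubs₂


    other-other : ∀ c → other (other c) ≡ c
    other-other zero       = refl
    other-other (suc zero) = refl

    MonochromaticPair : Set
    MonochromaticPair = ∃[ κ ] PurePair κ

    forward-pair : ∀ c (X Y : Subset n) → 14 * m ≤ count X → 14 * m ≤ count Y →
      (∀ i j → T (X i) → T (Y j) → ¬ M c (inj₁ i) (inj₂ j)) → MonochromaticPair
    forward-pair c X Y x y free = other c , record { X = X ; Y = Y ; X-size = x ; Y-size = y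
      ; pure = λ i j i∈ j∈ e → free i j i∈ j∈ (subst (λ κ → M κ (inj₁ i) (inj₂ j)) (other-other c) e) }

    backward-pair : ∀ c (X Y : Subset n) → 14 * m ≤ count X → 14 * m ≤ count Y →
      (∀ i j → T (X i) → T (Y j) → ¬ M c (inj₂ i) (inj₁ j)) → MonochromaticPair
    backward-pair c X Y x y free = forward-pair c Y X y x
      λ i j i∈ j∈ e → free j i j∈ i∈ (M-sym (inj₁ i) (inj₂ j) e)

    -- Part 0 of both classes is searched for a core of colour 0, part 1 for one of colour 1, and
    -- part 2 supplies the hubs. A failure at the scale 14m produces a pure pair, which is handled
    -- separately.
    module Parts (P : Fin 3 → Subset n) (P-size : ∀ a → 3 * (14 * m) ≤ count (P a))
      (P-disjoint : ∀ a a′ i → T (P a i) → T (P a′ i) → a ≡ a′) where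

      θ = 14 * m

      0<θ : 0 < θ
      0<θ = ℕₚ.<-≤-trans 0<m (ℕₚ.m≤n*m m 14)

      U : Fin 3 → V → Bool
      U a = Orientation.glue forward (P a) (P a)

      θ≤ : ∀ {c d} → 3 * θ ≤ c → c ≤ d + 2 * θ → θ ≤ d
      θ≤ {c} {d} x y = ℕₚ.+-cancelʳ-≤ (2 * θ) _ _ (ℕₚ.≤-trans x y)

      module TwoCores
        (E : LargeCore forward zero (U zero) {θ} {θ} (P-size zero) (P-size zero))
        (D : LargeCore forward (suc zero) (U (suc zero)) {θ} {θ} (P-size (suc zero)) (P-size (suc zero)))
        where
        module E = LargeCore E
        module D = LargeCore D

        family : Fin 2 → V → Bool
        family zero       = E.C
        family (suc zero) = D.C

        family⊆ : ∀ q v → T (family q v) → T (U (Fin.inject₁ q) v)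
        family⊆ zero       = E.C⊆U
        family⊆ (suc zero) = D.C⊆U

        family-connected : ∀ q → ConnectedIn q (family q)
        family-connected zero       = E.connected
        family-connected (suc zero) = D.connected

        U-disjoint : ∀ a a′ v → T (U a v) → T (U a′ v) → a ≡ a′
        U-disjoint a a′ (inj₁ i) = P-disjoint a a′ i
        U-disjoint a a′ (inj₂ j) = P-disjoint a a′ j

        last : Fin 3
        last = suc (suc zero)

        last-free : ∀ v → T (U last v) → ∀ q → ¬ T (family q v)
        last-free v u q f = inject₁≢last q (U-disjoint (Fin.inject₁ q) last v (family⊆ q v f) u)
          where
          inject₁≢last : ∀ q → Fin.inject₁ q ≢ last
          inject₁≢last zero ()
          inject₁≢last (suc zero) ()

        family-disjoint : ∀ q q′ v → T (family q v) → T (family q′ v) → q ≡ q′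
        family-disjoint q q′ v f f′ =
          Finₚ.inject₁-injective (U-disjoint _ _ v (family⊆ q v f) (family⊆ q′ v f′))

        L∃ = fromFamily {2} id family family-connected family-disjoint
        L = proj₁ L∃
        label = proj₁ (proj₂ L∃)
        unlabelled = proj₂ (proj₂ L∃)

        module Side (o : Orientation) (exp : Expands (Adj o) s m)
          (last-r : ∀ j → T (P last j) → T (U last (Orientation.r o j)))
          (pair : ∀ c (X Y : Subset n) → θ ≤ count X → θ ≤ count Y →
            (∀ i j → T (X i) → T (Y j) → ¬ M c (Orientation.l o i) (Orientation.r o j)) → MonochromaticPair)
          (size : ∀ q → θ ≤ count (family q ∘ Orientation.l o)) where
          open Orientation o

          near? : ∀ q j → Dec (∃[ i ] T (family q (l i)) × M q (l i) (r j))
          near? q j = Finₚ.any? λ i → T? (family q (l i)) ×-dec M? q (l i) (r j)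

          near far : Fin 2 → Subset n
          near q j = does (near? q j)
          far q j = P last j ∧ not (near q j)

          H : Subset n
          H j = P last j ∧ (near zero j ∧ near (suc zero) j)

          -- Between one side of a core and the vertices that the core does not reach there is no
          -- edge of its colour.
          far-pair : ∀ q → θ ≤ count (far q) → MonochromaticPair
          far-pair q x = pair q (family q ∘ l) (far q) (size q) x λ i j i∈ j∈ e →
            not⁻ (proj₂ (∧⁻ {P last j} j∈)) (T-does⁺ (near? q j) (i , i∈ , e))

          -- The hubs need both cores. Of the 3θ vertices of the last part, each core fails to reach
          -- fewer than θ.
          H-size : count (far zero) < θ → count (far (suc zero)) < θ → 4 * m ≤ count H
          H-size x y = ℕₚ.≤-trans (ℕₚ.*-monoˡ-≤ m {4} {14} (s≤s (s≤s (s≤s (s≤s z≤n)))))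
            (θ≤ (P-size last) (begin
              count (P last)                                          ≤⟨ count-∪ {Q = far zero} split₀ ⟩
              count (far zero) + count (λ j → P last j ∧ near zero j) ≤⟨ ℕₚ.+-mono-≤ (ℕₚ.<⇒≤ x) (count-∪ {Q = far (suc zero)} {H} split₁) ⟩
              θ + (count (far (suc zero)) + count H)                  ≤⟨ ℕₚ.+-monoʳ-≤ θ (ℕₚ.+-monoˡ-≤ (count H) (ℕₚ.<⇒≤ y)) ⟩
              θ + (θ + count H)                                       ≡⟨ ℕₚ.+-assoc θ θ (count H) ⟨
              θ + θ + count H                                         ≡⟨ ℕₚ.+-comm (θ + θ) (count H) ⟩
              count H + (θ + θ)                                       ≡⟨ cong (λ z → count H + (θ + z)) (sym (ℕₚ.+-identityʳ θ)) ⟩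
              count H + 2 * θ                                         ∎))
            where
            split₀ : ∀ j → T (P last j) → T (far zero j) ⊎ T (P last j ∧ near zero j)
            split₀ j = ∧-split {P last j} (near zero j)
            split₁ : ∀ j → T (P last j ∧ near zero j) → T (far (suc zero) j) ⊎ T (H j)
            split₁ j p = let a , b = ∧⁻ {P last j} p in go a b (∧-split {P last j} (near (suc zero) j) a)
              where
              go : T (P last j) → T (near zero j) →
                T (far (suc zero) j) ⊎ T (P last j ∧ near (suc zero) j) → T (far (suc zero) j) ⊎ T (H j)
              go a b (inj₁ f) = inj₁ f
              go a b (inj₂ p′) = inj₂ (∧⁺ a (∧⁺ b (proj₂ (∧⁻ {P last j} p′))))

          hubs : 4 * m ≤ count H → Hubs L o s
          hubs h =
            let φ , W , W<s , sat = serve o (suc zero) exp H h in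
            mkHubs id L o zero (suc zero) H φ W (ℕₚ.<⇒≤ W<s) sat
              (λ j h → unlabelled (r j) (last-free (r j) (last-r j (proj₁ (∧⁻ h)))))
              (λ j h _ → held zero j (proj₁ (∧⁻ (proj₂ (∧⁻ {P last j} h)))))
              (λ j h → held (suc zero) j (proj₂ (∧⁻ {near zero j} (proj₂ (∧⁻ {P last j} h)))))
            where
            held : ∀ q j → T (near q j) → Holds id L q (r j)
            held q j x = let i , i∈ , e = T-does⁻ (near? q j) x in
              l i , label q (l i) i∈ , M-sym (l i) (r j) e

          pair-or-hubs : MonochromaticPair ⊎ Hubs L o s
          pair-or-hubs = go (θ ℕ.≤? count (far zero)) (θ ℕ.≤? count (far (suc zero)))
            where
            go : Dec (θ ≤ count (far zero)) → Dec (θ ≤ count (far (suc zero))) → MonochromaticPair ⊎ Hubs L o s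
            go (yes x) _       = inj₁ (far-pair zero x)
            go (no _)  (yes y) = inj₁ (far-pair (suc zero) y)
            go (no x)  (no y)  = inj₂ (hubs (H-size (ℕₚ.≰⇒> x) (ℕₚ.≰⇒> y)))

        size₁ : ∀ q → θ ≤ count (family q ∘ inj₁)
        size₁ zero       = θ≤ (P-size zero) E.misses-l
        size₁ (suc zero) = θ≤ (P-size (suc zero)) D.misses-l

        size₂ : ∀ q → θ ≤ count (family q ∘ inj₂)
        size₂ zero       = θ≤ (P-size zero) E.misses-r
        size₂ (suc zero) = θ≤ (P-size (suc zero)) D.misses-r

        pair-or-cover : MonochromaticPair ⊎ SmallCover
        pair-or-cover = go
          (Side.pair-or-hubs forward forward-expand (λ j p → p) forward-pair size₁)
          (Side.pair-or-hubs backward backward-expand (λ j p → p) backward-pair size₂)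
          where
          go : MonochromaticPair ⊎ Hubs L forward s → MonochromaticPair ⊎ Hubs L backward s →
            MonochromaticPair ⊎ SmallCover
          go (inj₁ p) _        = inj₁ p
          go (inj₂ _) (inj₁ p) = inj₁ p
          go (inj₂ h) (inj₂ h′) = inj₂ (toSmallCover (s≤s (s≤s z≤n)) L (ℕₚ.m≤n*m s 4) (ℕₚ.m≤n*m s 4) h h′)

      pair-or-cover : MonochromaticPair ⊎ SmallCover
      pair-or-cover = go
        (gap-or-core forward zero (U zero) {θ} {θ} (P-size zero) (P-size zero) 0<θ 0<θ)
        (gap-or-core forward (suc zero) (U (suc zero)) {θ} {θ} (P-size (suc zero)) (P-size (suc zero)) 0<θ 0<θ)
        where
        gap : ∀ c → Gap forward c (U (Fin.inject₁ c)) {θ} {θ} (P-size (Fin.inject₁ c)) (P-size (Fin.inject₁ c)) → MonochromaticPair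
        gap c (X , Y , _ , _ , x , y , free) = forward-pair c X Y x y free
        go : _ ⊎ _ → _ ⊎ _ → MonochromaticPair ⊎ SmallCover
        go (inj₁ g) _        = inj₁ (gap zero g)
        go (inj₂ _) (inj₁ g) = inj₁ (gap (suc zero) g)
        go (inj₂ E) (inj₂ D) = TwoCores.pair-or-cover E D

    small-cover : let t = 3 * (14 * m) in t + (t + t) ≤ n → SmallCover
    small-cover large = let P , P-size , P-disjoint = three-parts (3 * (14 * m)) large in
      [ (λ (κ , pair) → FromPurePair.small-cover pair) , id ]′ (Parts.pair-or-cover P P-size P-disjoint)

-- Rational arithmetic
module _ where
  open import Data.Rational using (_+_; _*_; _-_; -_; _≤_; _<_; ∣_∣)
  open import Data.Rational.Properties using (≤-trans; ≤-reflexive; ≤-refl)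
  open +-*-Solver using (solve; _:+_; _:*_; :-_; _:-_; _:=_; con)

  0≤1 : 0ℚ ≤ 1ℚ
  0≤1 = ℚₚ.nonNegative⁻¹ 1ℚ

  0≤½ : 0ℚ ≤ ½
  0≤½ = ℚₚ.nonNegative⁻¹ ½

  *-monoʳ : ∀ a {b c} → 0ℚ ≤ a → b ≤ c → a * b ≤ a * c
  *-monoʳ a a≥0 = ℚₚ.*-monoˡ-≤-nonNeg a {{ℚ.nonNegative a≥0}}

  *-monoˡ : ∀ a {b c} → 0ℚ ≤ a → b ≤ c → b * a ≤ c * a
  *-monoˡ a a≥0 = ℚₚ.*-monoʳ-≤-nonNeg a {{ℚ.nonNegative a≥0}}

  *-mono : ∀ {a b c d} → 0ℚ ≤ c → 0ℚ ≤ b → a ≤ b → c ≤ d → a * c ≤ b * d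
  *-mono {a} {b} {c} {d} c≥0 b≥0 a≤b c≤d = ≤-trans (*-monoˡ c c≥0 a≤b) (*-monoʳ b b≥0 c≤d)

  *-nonNeg : ∀ {a b} → 0ℚ ≤ a → 0ℚ ≤ b → 0ℚ ≤ a * b
  *-nonNeg {a} {b} a≥0 b≥0 = subst (_≤ a * b) (ℚₚ.*-zeroʳ a) (*-monoʳ a a≥0 b≥0)

  +-nonNeg : ∀ {a b} → 0ℚ ≤ a → 0ℚ ≤ b → 0ℚ ≤ a + b
  +-nonNeg {a} {b} a≥0 b≥0 = ℚₚ.+-mono-≤ a≥0 b≥0

  *-pos : ∀ {a b} → 0ℚ < a → 0ℚ < b → 0ℚ < a * b
  *-pos {a} {b} a>0 b>0 = ℚₚ.positive⁻¹ (a * b) {{ℚₚ.pos*pos⇒pos a {{ℚ.positive a>0}} b {{ℚ.positive b>0}}}}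

  x≤x+y : ∀ x {y} → 0ℚ ≤ y → x ≤ x + y
  x≤x+y x {y} y≥0 = subst (_≤ x + y) (ℚₚ.+-identityʳ x) (ℚₚ.+-monoʳ-≤ x y≥0)

  x≤y+x : ∀ x {y} → 0ℚ ≤ y → x ≤ y + x
  x≤y+x x {y} y≥0 = subst (x ≤_) (ℚₚ.+-comm x y) (x≤x+y x y≥0)

  x-y≤x : ∀ x {y} → 0ℚ ≤ y → x - y ≤ x
  x-y≤x x {y} y≥0 = subst (x - y ≤_) (ℚₚ.+-identityʳ x) (ℚₚ.+-monoʳ-≤ x (ℚₚ.neg-antimono-≤ y≥0))

  ≤⇒0≤- : ∀ {x y} → x ≤ y → 0ℚ ≤ y - x
  ≤⇒0≤- {x} {y} h = subst (_≤ y - x) (ℚₚ.+-inverseʳ x) (ℚₚ.+-monoˡ-≤ (- x) h)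

  0≤-⇒≤ : ∀ {x y} → 0ℚ ≤ y - x → x ≤ y
  0≤-⇒≤ {x} {y} h = subst₂ _≤_ (ℚₚ.+-identityˡ x) (solve 2 (λ x y → y :- x :+ x := y) refl x y) (ℚₚ.+-monoˡ-≤ x h)

  *-cancelʳ : ∀ {a b} c → 0ℚ < c → a * c ≤ b * c → a ≤ b
  *-cancelʳ c c>0 = ℚₚ.*-cancelʳ-≤-pos c {{ℚ.positive c>0}}

  *-cancelˡ : ∀ {a b} c → 0ℚ < c → c * a ≤ c * b → a ≤ b
  *-cancelˡ c c>0 = ℚₚ.*-cancelˡ-≤-pos c {{ℚ.positive c>0}}

  square-nonNeg : ∀ a → 0ℚ ≤ a * a
  square-nonNeg a with ℚₚ.≤-total 0ℚ a
  ... | inj₁ a≥0 = *-nonNeg a≥0 a≥0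
  ... | inj₂ a≤0 = subst (0ℚ ≤_) (solve 1 (λ a → (:- a) :* (:- a) := a :* a) refl a)
                     (*-nonNeg (ℚₚ.neg-antimono-≤ a≤0) (ℚₚ.neg-antimono-≤ a≤0))

  n<2^n : ∀ n → n ℕ.< 2 ℕ.^ n
  n<2^n zero    = ℕ.s≤s ℕ.z≤n
  n<2^n (suc n) = ℕₚ.+-mono-≤ (ℕₚ.≤-trans (ℕ.s≤s ℕ.z≤n) (n<2^n n))
    (ℕₚ.≤-trans (n<2^n n) (ℕₚ.≤-reflexive (sym (ℕₚ.+-identityʳ (2 ℕ.^ n)))))

  -- Recursive, so that `ι (suc k)` unfolds to `1ℚ + ι k` in inductions without normalising
  -- fractions; `ι-/1` links it to the library form.
  ι : ℕ → ℚ
  ι zero    = 0ℚ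
  ι (suc k) = 1ℚ + ι k

  ι≥0 : ∀ k → 0ℚ ≤ ι k
  ι≥0 zero    = ≤-refl
  ι≥0 (suc k) = +-nonNeg 0≤1 (ι≥0 k)

  ι>0 : ∀ k → 0ℚ < ι (suc k)
  ι>0 k = ℚₚ.<-≤-trans (ℚₚ.positive⁻¹ 1ℚ) (x≤x+y 1ℚ (ι≥0 k))

  ι-mono : ∀ {j k} → j ℕ.≤ k → ι j ≤ ι k
  ι-mono {k = k} ℕ.z≤n = ι≥0 k
  ι-mono (ℕ.s≤s h)     = ℚₚ.+-monoʳ-≤ 1ℚ (ι-mono h)

  ι-+ : ∀ j k → ι (j ℕ.+ k) ≡ ι j + ι k
  ι-+ zero    k = sym (ℚₚ.+-identityˡ (ι k))
  ι-+ (suc j) k = trans (cong (_+_ 1ℚ) (ι-+ j k)) (sym (ℚₚ.+-assoc 1ℚ (ι j) (ι k)))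

  ι-* : ∀ j k → ι (j ℕ.* k) ≡ ι j * ι k
  ι-* zero    k = sym (ℚₚ.*-zeroˡ (ι k))
  ι-* (suc j) k = trans (ι-+ k (j ℕ.* k)) (trans (cong (ι k +_) (ι-* j k))
    (solve 2 (λ a b → b :+ a :* b := (con 1ℚ :+ a) :* b) refl (ι j) (ι k)))

  ι-cancel-≤ : ∀ {j k} → ι j ≤ ι k → j ℕ.≤ k
  ι-cancel-≤ {j} {k} h = ℕₚ.≮⇒≥ λ k<j → ℚₚ.<-irrefl refl (ℚₚ.<-≤-trans
    (subst (_< 1ℚ + ι k) (ℚₚ.+-identityˡ (ι k)) (ℚₚ.+-monoˡ-< (ι k) (ℚₚ.positive⁻¹ 1ℚ)))
    (≤-trans (ι-mono k<j) h))

  ι-/1 : ∀ k → ι k ≡ ℤ.+ k ℚ./ 1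
  ι-/1 zero    = refl
  ι-/1 (suc k) = trans (cong (_+_ 1ℚ) (ι-/1 k)) (ℚₚ.toℚᵘ-injective (ℚᵘₚ.≃-trans
    (ℚₚ.toℚᵘ-homo-+ 1ℚ (ℤ.+ k ℚ./ 1))
    (ℚᵘₚ.≃-trans (ℚᵘₚ.+-cong (ℚᵘₚ.≃-refl {ℚ.toℚᵘ 1ℚ}) (ℚₚ.toℚᵘ-fromℚᵘ (mkℚᵘ (ℤ.+ k) 0)))
      (ℚᵘₚ.≃-trans (ℚᵘ.*≡* (cong (ℤ._* ℤ.+ 1) (cong (λ z → ℤ.+ 1 ℤ.+ z) (ℤₚ.*-identityʳ (ℤ.+ k)))))
        (ℚᵘₚ.≃-sym (ℚₚ.toℚᵘ-fromℚᵘ (mkℚᵘ (ℤ.+ suc k) 0)))))))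

  -- Shifted by one: `1/ k` is 1/(k+1), in accordance with the terms of `log` and the accuracy of
  -- `√`.
  1/ : ℕ → ℚ
  1/ k = ℤ.+ 1 ℚ./ suc k

  ι*1/ : ∀ k → ι (suc k) * 1/ k ≡ 1ℚ
  ι*1/ k = trans (cong (_* 1/ k) (ι-/1 (suc k))) (ℚₚ.toℚᵘ-injective (ℚᵘₚ.≃-trans
      (ℚₚ.toℚᵘ-homo-* (ℤ.+ suc k ℚ./ 1) (1/ k))
      (ℚᵘₚ.≃-trans
        (ℚᵘₚ.*-cong (ℚₚ.toℚᵘ-fromℚᵘ (mkℚᵘ (ℤ.+ suc k) 0)) (ℚₚ.toℚᵘ-fromℚᵘ (mkℚᵘ (ℤ.+ 1) k)))
        (ℚᵘ.*≡* (trans (ℤₚ.*-identityʳ _) (trans (ℤₚ.*-identityʳ (ℤ.+ suc k))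
          (sym (trans (ℤₚ.*-identityˡ _) (ℤₚ.*-identityˡ (ℤ.+ suc k))))))))))

  1/≥0 : ∀ k → 0ℚ ≤ 1/ k
  1/≥0 k = ℚₚ.nonNegative⁻¹ (1/ k) {{ℚₚ.normalize-nonNeg 1 (suc k)}}

  1/>0 : ∀ k → 0ℚ < 1/ k
  1/>0 k = ℚₚ.positive⁻¹ (1/ k) {{ℚₚ.normalize-pos 1 (suc k)}}

  ≤*1/ : ∀ k {x y} → ι (suc k) * x ≤ y → x ≤ y * 1/ k
  ≤*1/ k {x} {y} h = subst (_≤ y * 1/ k)
    (trans (solve 3 (λ a b c → a :* b :* c := (a :* c) :* b) refl (ι (suc k)) x (1/ k))
      (trans (cong (_* x) (ι*1/ k)) (ℚₚ.*-identityˡ x)))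
    (*-monoˡ (1/ k) (1/≥0 k) h)

  *1/≤ : ∀ k {x y} → x ≤ ι (suc k) * y → x * 1/ k ≤ y
  *1/≤ k {x} {y} h = subst (x * 1/ k ≤_)
    (trans (solve 3 (λ a b c → a :* b :* c := (a :* c) :* b) refl (ι (suc k)) y (1/ k))
      (trans (cong (_* y) (ι*1/ k)) (ℚₚ.*-identityˡ y)))
    (*-monoˡ (1/ k) (1/≥0 k) h)

  1/-anti : ∀ {j k} → j ℕ.≤ k → 1/ k ≤ 1/ j
  1/-anti {j} {k} h = subst (_≤ 1/ j) (ℚₚ.*-identityˡ (1/ k))
    (*1/≤ k (subst (_≤ ι (suc k) * 1/ j) (ι*1/ j) (*-monoˡ (1/ j) (1/≥0 j) (ι-mono (ℕ.s≤s h)))))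

  recip>0 : ∀ q (q>0 : 0ℚ < q) → 0ℚ < recip q q>0
  recip>0 q q>0 = ℚₚ.positive⁻¹ (recip q q>0) {{ℚₚ.1/pos⇒pos q {{ℚ.positive q>0}}}}

  archimedean : ∀ ε → 0ℚ < ε → ∃[ k ] 1/ k ≤ ε
  archimedean ε@(ℚ.mkℚ ℤ.+[1+ a ] d c) _ = d , subst₂ _≤_ refl (sym ε≡) (x≤′ (1/≥0 d))
    where
    ε≡ : ε ≡ ι (suc a) * 1/ d
    ε≡ = trans (sym (ℚₚ.fromℚᵘ-toℚᵘ ε)) (ℚₚ.toℚᵘ-injective (ℚᵘₚ.≃-trans
      (ℚₚ.toℚᵘ-fromℚᵘ (mkℚᵘ ℤ.+[1+ a ] d)) (ℚᵘₚ.≃-sym (ℚᵘₚ.≃-trans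
        (ℚₚ.toℚᵘ-homo-* (ι (suc a)) (1/ d)) (ℚᵘₚ.≃-trans
          (ℚᵘₚ.*-cong (ℚᵘₚ.≃-trans (ℚᵘₚ.≃-reflexive (cong ℚ.toℚᵘ (ι-/1 (suc a)))) (ℚₚ.toℚᵘ-fromℚᵘ (mkℚᵘ (ℤ.+ suc a) 0)))
                      (ℚₚ.toℚᵘ-fromℚᵘ (mkℚᵘ (ℤ.+ 1) d)))
          (ℚᵘ.*≡* (cong₂ ℤ._*_ (ℤₚ.*-identityʳ (ℤ.+ suc a))
            (cong (λ z → ℤ.+ suc z) (sym (ℕₚ.+-identityʳ d))))))))))
    x≤′ : 0ℚ ≤ 1/ d → 1/ d ≤ ι (suc a) * 1/ d
    x≤′ h = subst (_≤ ι (suc a) * 1/ d) (ℚₚ.*-identityˡ (1/ d)) (*-monoˡ (1/ d) h (x≤x+y 1ℚ (ι≥0 a)))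
  archimedean (ℚ.mkℚ (ℤ.+ 0) d c) (ℚ.*<* (ℤ.+<+ ()))
  archimedean (ℚ.mkℚ ℤ.-[1+ a ] d c) (ℚ.*<* ())

  ^-nonNeg : ∀ {x} → 0ℚ ≤ x → ∀ k → 0ℚ ≤ x ^ℚ k
  ^-nonNeg x≥0 zero    = 0≤1
  ^-nonNeg x≥0 (suc k) = *-nonNeg x≥0 (^-nonNeg x≥0 k)

  ^-pos : ∀ {x} → 0ℚ < x → ∀ k → 0ℚ < x ^ℚ k
  ^-pos x>0 zero    = ℚₚ.positive⁻¹ 1ℚ
  ^-pos x>0 (suc k) = *-pos x>0 (^-pos x>0 k)

  ^-monoˡ : ∀ {x y} → 0ℚ ≤ x → x ≤ y → ∀ k → x ^ℚ k ≤ y ^ℚ k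
  ^-monoˡ x≥0 x≤y zero    = ≤-refl
  ^-monoˡ x≥0 x≤y (suc k) = *-mono (^-nonNeg x≥0 k) (≤-trans x≥0 x≤y) x≤y (^-monoˡ x≥0 x≤y k)

  1^ : ∀ k → 1ℚ ^ℚ k ≡ 1ℚ
  1^ zero    = refl
  1^ (suc k) = trans (ℚₚ.*-identityˡ (1ℚ ^ℚ k)) (1^ k)

  ^≤1 : ∀ {x} → 0ℚ ≤ x → x ≤ 1ℚ → ∀ k → x ^ℚ k ≤ 1ℚ
  ^≤1 {x} x≥0 x≤1 k = subst (x ^ℚ k ≤_) (1^ k) (^-monoˡ x≥0 x≤1 k)

  ^-+ : ∀ x j k → x ^ℚ (j ℕ.+ k) ≡ x ^ℚ j * x ^ℚ k
  ^-+ x zero    k = sym (ℚₚ.*-identityˡ (x ^ℚ k))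
  ^-+ x (suc j) k = trans (cong (x *_) (^-+ x j k)) (sym (ℚₚ.*-assoc x (x ^ℚ j) (x ^ℚ k)))

  ^-distrib : ∀ x y k → (x * y) ^ℚ k ≡ x ^ℚ k * y ^ℚ k
  ^-distrib x y zero    = sym (ℚₚ.*-identityˡ 1ℚ)
  ^-distrib x y (suc k) = trans (cong (_*_ (x * y)) (^-distrib x y k))
    (solve 4 (λ a b c d → a :* b :* (c :* d) := a :* c :* (b :* d)) refl x y (x ^ℚ k) (y ^ℚ k))

  ^-* : ∀ x j k → x ^ℚ (j ℕ.* k) ≡ (x ^ℚ k) ^ℚ j
  ^-* x zero    k = refl
  ^-* x (suc j) k = trans (^-+ x k (j ℕ.* k)) (cong (x ^ℚ k *_) (^-* x j k))

  ^-antiʳ : ∀ {x} → 0ℚ ≤ x → x ≤ 1ℚ → ∀ {j k} → j ℕ.≤ k → x ^ℚ k ≤ x ^ℚ j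
  ^-antiʳ {x} x≥0 x≤1 {zero}  {k} _     = ^≤1 x≥0 x≤1 k
  ^-antiʳ {x} x≥0 x≤1 (ℕ.s≤s h) = *-monoʳ x x≥0 (^-antiʳ x≥0 x≤1 h)

  ^-monoʳ : ∀ {x} → 1ℚ ≤ x → ∀ {j k} → j ℕ.≤ k → x ^ℚ j ≤ x ^ℚ k
  ^-monoʳ {x} x≥1 {zero} {zero}  _ = ≤-refl
  ^-monoʳ {x} x≥1 {zero} {suc k} _ = subst (_≤ x * x ^ℚ k) (ℚₚ.*-identityˡ 1ℚ)
    (*-mono 0≤1 (≤-trans 0≤1 x≥1) x≥1 (^-monoʳ x≥1 {zero} {k} ℕ.z≤n))
  ^-monoʳ {x} x≥1 (ℕ.s≤s h) = *-monoʳ x (≤-trans 0≤1 x≥1) (^-monoʳ x≥1 h)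

  bernoulli : ∀ a → a ≤ 1ℚ → ∀ k → 1ℚ - ι k * a ≤ (1ℚ - a) ^ℚ k
  bernoulli a a≤1 zero    = ≤-reflexive (solve 1 (λ a → con 1ℚ :- con 0ℚ :* a := con 1ℚ) refl a)
  bernoulli a a≤1 (suc k) = begin
    1ℚ - (1ℚ + ι k) * a                    ≤⟨ x≤x+y _ (*-nonNeg (ι≥0 k) (square-nonNeg a)) ⟩
    1ℚ - (1ℚ + ι k) * a + ι k * (a * a)    ≡⟨ solve 2 (λ a k → con 1ℚ :- (con 1ℚ :+ k) :* a :+ k :* (a :* a)
                                                := (con 1ℚ :- a) :* (con 1ℚ :- k :* a)) refl a (ι k) ⟩
    (1ℚ - a) * (1ℚ - ι k * a)              ≤⟨ *-monoʳ (1ℚ - a) (≤⇒0≤- a≤1) (bernoulli a a≤1 k) ⟩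
    (1ℚ - a) * (1ℚ - a) ^ℚ k               ∎
    where
    open ℚₚ.≤-Reasoning

  -- Each step of the induction loses exactly `(k+1) a²` times the power, whatever the sign of
  -- `1 - k a`. It bounds (1 + a)^k from above without exponentials.
  inverse-bernoulli : ∀ a → 0ℚ ≤ a → ∀ k → (1ℚ + a) ^ℚ k * (1ℚ - ι k * a) ≤ 1ℚ
  inverse-bernoulli a a≥0 zero = ≤-reflexive (solve 1 (λ a → con 1ℚ :* (con 1ℚ :- con 0ℚ :* a) := con 1ℚ) refl a)
  inverse-bernoulli a a≥0 (suc k) = begin
    (1ℚ + a) * (1ℚ + a) ^ℚ k * (1ℚ - (1ℚ + ι k) * a)
      ≡⟨ solve 3 (λ a k p → (con 1ℚ :+ a) :* p :* (con 1ℚ :- (con 1ℚ :+ k) :* a)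
           := p :* (con 1ℚ :- k :* a) :- p :* ((con 1ℚ :+ k) :* (a :* a))) refl a (ι k) ((1ℚ + a) ^ℚ k) ⟩
    (1ℚ + a) ^ℚ k * (1ℚ - ι k * a) - (1ℚ + a) ^ℚ k * ((1ℚ + ι k) * (a * a))
      ≤⟨ x-y≤x _ (*-nonNeg (^-nonNeg (+-nonNeg 0≤1 a≥0) k) (*-nonNeg (ι≥0 (suc k)) (*-nonNeg a≥0 a≥0))) ⟩
    (1ℚ + a) ^ℚ k * (1ℚ - ι k * a)
      ≤⟨ inverse-bernoulli a a≥0 k ⟩
    1ℚ ∎
    where open ℚₚ.≤-Reasoning

  -- A substitute for (1 - g)^k ≤ e^(-kg), written without division. It decays only like 1/(kg),
  -- which is enough for a failure probability that tends to 0.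
  reciprocal-bernoulli : ∀ g → 0ℚ ≤ g → g ≤ 1ℚ → ∀ k → (1ℚ - g) ^ℚ k * (1ℚ + ι k * g) ≤ 1ℚ
  reciprocal-bernoulli g g≥0 g≤1 zero = ≤-reflexive (solve 1 (λ a → con 1ℚ :* (con 1ℚ :+ con 0ℚ :* a) := con 1ℚ) refl g)
  reciprocal-bernoulli g g≥0 g≤1 (suc k) = begin
    (1ℚ - g) * (1ℚ - g) ^ℚ k * (1ℚ + (1ℚ + ι k) * g)
      ≡⟨ solve 3 (λ a k p → (con 1ℚ :- a) :* p :* (con 1ℚ :+ (con 1ℚ :+ k) :* a)
           := p :* (con 1ℚ :+ k :* a) :- p :* ((con 1ℚ :+ k) :* (a :* a))) refl g (ι k) ((1ℚ - g) ^ℚ k) ⟩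
    (1ℚ - g) ^ℚ k * (1ℚ + ι k * g) - (1ℚ - g) ^ℚ k * ((1ℚ + ι k) * (g * g))
      ≤⟨ x-y≤x _ (*-nonNeg (^-nonNeg (≤⇒0≤- g≤1) k) (*-nonNeg (ι≥0 (suc k)) (*-nonNeg g≥0 g≥0))) ⟩
    (1ℚ - g) ^ℚ k * (1ℚ + ι k * g)
      ≤⟨ reciprocal-bernoulli g g≥0 g≤1 k ⟩
    1ℚ ∎
    where open ℚₚ.≤-Reasoning

  2ℚ : ℚ
  2ℚ = 1ℚ + 1ℚ

  1≤2 : 1ℚ ≤ 2ℚ
  1≤2 = x≤x+y 1ℚ 0≤1

  0≤2 : 0ℚ ≤ 2ℚ
  0≤2 = ≤-trans 0≤1 1≤2

  2*½≤⇒ : ∀ {x y} → x * ½ ≤ y → x ≤ 2ℚ * y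
  2*½≤⇒ {x} {y} h = subst (_≤ 2ℚ * y) (solve 1 (λ x → (con 1ℚ :+ con 1ℚ) :* (x :* con ½) := x) refl x)
    (*-monoʳ 2ℚ 0≤2 h)

  [1+a]^≤2 : ∀ a → 0ℚ ≤ a → ∀ k → ι k * a ≤ ½ → (1ℚ + a) ^ℚ k ≤ 2ℚ
  [1+a]^≤2 a a≥0 k h = ≤-trans (2*½≤⇒ (≤-trans
      (*-monoʳ _ (^-nonNeg (+-nonNeg 0≤1 a≥0) k) (ℚₚ.+-monoʳ-≤ 1ℚ (ℚₚ.neg-antimono-≤ h)))
      (inverse-bernoulli a a≥0 k)))
    (≤-reflexive (ℚₚ.*-identityʳ 2ℚ))

  2^½^ : ∀ k → 2ℚ ^ℚ k * ½ ^ℚ k ≡ 1ℚ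
  2^½^ k = trans (sym (^-distrib 2ℚ ½ k)) (1^ k)

  ι-2^ : ∀ k → ι (2 ℕ.^ k) ≡ 2ℚ ^ℚ k
  ι-2^ zero    = refl
  ι-2^ (suc k) = trans (ι-* 2 (2 ℕ.^ k)) (cong (2ℚ *_) (ι-2^ k))

-- Finite probability spaces
module _ where
  open import Data.Rational using (_+_; _*_; _-_; -_; _≤_; _<_; ∣_∣)
  open import Data.Rational.Properties using (≤-trans; ≤-reflexive; ≤-refl)
  open +-*-Solver using (solve; _:+_; _:*_; :-_; _:-_; _:=_; con)

  private variable
    A C : Set

  ∑ : List A → (A → ℚ) → ℚ
  ∑ []       f = 0ℚ
  ∑ (a ∷ as) f = f a + ∑ as f

  ∑-cong : (as : List A) {f g : A → ℚ} → (∀ a → f a ≡ g a) → ∑ as f ≡ ∑ as g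
  ∑-cong []       h = refl
  ∑-cong (a ∷ as) h = cong₂ _+_ (h a) (∑-cong as h)

  ∑-mono : (as : List A) {f g : A → ℚ} → (∀ a → f a ≤ g a) → ∑ as f ≤ ∑ as g
  ∑-mono []       h = ≤-refl
  ∑-mono (a ∷ as) h = ℚₚ.+-mono-≤ (h a) (∑-mono as h)

  ∑-zero : (as : List A) → ∑ as (λ _ → 0ℚ) ≡ 0ℚ
  ∑-zero []       = refl
  ∑-zero (a ∷ as) = trans (ℚₚ.+-identityˡ _) (∑-zero as)

  ∑-nonNeg : (as : List A) {f : A → ℚ} → (∀ a → 0ℚ ≤ f a) → 0ℚ ≤ ∑ as f
  ∑-nonNeg as {f} h = subst (_≤ ∑ as f) (∑-zero as) (∑-mono as h)

  ∑-+ : (as : List A) (f g : A → ℚ) → ∑ as (λ a → f a + g a) ≡ ∑ as f + ∑ as g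
  ∑-+ []       f g = sym (ℚₚ.+-identityˡ 0ℚ)
  ∑-+ (a ∷ as) f g = trans (cong (f a + g a +_) (∑-+ as f g))
    (solve 4 (λ a b c d → a :+ b :+ (c :+ d) := a :+ c :+ (b :+ d)) refl (f a) (g a) (∑ as f) (∑ as g))

  ∑-*ˡ : (as : List A) (c : ℚ) (f : A → ℚ) → ∑ as (λ a → c * f a) ≡ c * ∑ as f
  ∑-*ˡ []       c f = sym (ℚₚ.*-zeroʳ c)
  ∑-*ˡ (a ∷ as) c f = trans (cong (c * f a +_) (∑-*ˡ as c f)) (sym (ℚₚ.*-distribˡ-+ c (f a) (∑ as f)))

  ∑-*ʳ : (as : List A) (f : A → ℚ) (c : ℚ) → ∑ as (λ a → f a * c) ≡ ∑ as f * c
  ∑-*ʳ as f c = trans (∑-cong as (λ a → ℚₚ.*-comm (f a) c)) (trans (∑-*ˡ as c f) (ℚₚ.*-comm c (∑ as f)))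

  ∑-comm : (as : List A) (cs : List C) (f : A → C → ℚ) →
    ∑ as (λ a → ∑ cs (f a)) ≡ ∑ cs (λ c → ∑ as (λ a → f a c))
  ∑-comm []       cs f = sym (∑-zero cs)
  ∑-comm (a ∷ as) cs f = trans (cong (∑ cs (f a) +_) (∑-comm as cs f)) (sym (∑-+ cs (f a) _))

  ∑-++ : (as bs : List A) (f : A → ℚ) → ∑ (as ++ bs) f ≡ ∑ as f + ∑ bs f
  ∑-++ []       bs f = sym (ℚₚ.+-identityˡ (∑ bs f))
  ∑-++ (a ∷ as) bs f = trans (cong (f a +_) (∑-++ as bs f)) (sym (ℚₚ.+-assoc (f a) (∑ as f) (∑ bs f)))

  ∑-map : (g : A → C) (as : List A) (f : C → ℚ) → ∑ (List.map g as) f ≡ ∑ as (f ∘ g)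
  ∑-map g []       f = refl
  ∑-map g (a ∷ as) f = cong (f (g a) +_) (∑-map g as f)

  ∑-allVecs-suc : (as : List A) (k : ℕ) (f : Vec A (suc k) → ℚ) →
    ∑ (allVecs as (suc k)) f ≡ ∑ as (λ a → ∑ (allVecs as k) (λ v → f (a ∷ v)))
  ∑-allVecs-suc as k f = go as
    where
    go : ∀ bs → ∑ (List.cartesianProductWith _∷_ bs (allVecs as k)) f ≡
      ∑ bs (λ a → ∑ (allVecs as k) (λ v → f (a ∷ v)))
    go []       = refl
    go (b ∷ bs) = trans (∑-++ (List.map (b ∷_) (allVecs as k)) _ f)
      (cong₂ _+_ (∑-map (b ∷_) (allVecs as k) f) (go bs))

  ∏ : ∀ {k} → (A → ℚ) → Vec A k → ℚ
  ∏ w []      = 1ℚ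
  ∏ w (a ∷ v) = w a * ∏ w v

  ∏-nonNeg : ∀ {k} {w : A → ℚ} → (∀ a → 0ℚ ≤ w a) → (v : Vec A k) → 0ℚ ≤ ∏ w v
  ∏-nonNeg h []      = 0≤1
  ∏-nonNeg h (a ∷ v) = *-nonNeg (h a) (∏-nonNeg h v)

  ∑-∏ : (as : List A) (w : A → ℚ) (k : ℕ) → ∑ (allVecs as k) (∏ w) ≡ ∑ as w ^ℚ k
  ∑-∏ as w zero    = ℚₚ.+-identityʳ 1ℚ
  ∑-∏ as w (suc k) = trans (∑-allVecs-suc as k (∏ w))
    (trans (∑-cong as (λ a → trans (∑-*ˡ (allVecs as k) (w a) (∏ w)) (cong (w a *_) (∑-∏ as w k))))
           (∑-*ʳ as w (∑ as w ^ℚ k)))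

  record Distribution (A : Set) : Set where
    field
      support : List A
      mass    : A → ℚ
      nonNeg  : ∀ a → 0ℚ ≤ mass a
      total   : ∑ support mass ≡ 1ℚ

  open Distribution

  𝔼 : Distribution A → (A → ℚ) → ℚ
  𝔼 D f = ∑ (support D) (λ a → mass D a * f a)

  power : Distribution A → (k : ℕ) → Distribution (Vec A k)
  power D k = record
    { support = allVecs (support D) k
    ; mass    = ∏ (mass D)
    ; nonNeg  = ∏-nonNeg (nonNeg D)
    ; total   = trans (∑-∏ (support D) (mass D) k) (trans (cong (_^ℚ k) (total D)) (1^ k))
    }

  𝔼-cong : (D : Distribution A) {f g : A → ℚ} → (∀ a → f a ≡ g a) → 𝔼 D f ≡ 𝔼 D g
  𝔼-cong D h = ∑-cong (support D) (λ a → cong (mass D a *_) (h a))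

  𝔼-mono : (D : Distribution A) {f g : A → ℚ} → (∀ a → f a ≤ g a) → 𝔼 D f ≤ 𝔼 D g
  𝔼-mono D h = ∑-mono (support D) (λ a → *-monoʳ (mass D a) (nonNeg D a) (h a))

  𝔼-+ : (D : Distribution A) (f g : A → ℚ) → 𝔼 D (λ a → f a + g a) ≡ 𝔼 D f + 𝔼 D g
  𝔼-+ D f g = trans (∑-cong (support D) (λ a → ℚₚ.*-distribˡ-+ (mass D a) (f a) (g a)))
    (∑-+ (support D) _ _)

  𝔼-const : (D : Distribution A) (c : ℚ) → 𝔼 D (λ _ → c) ≡ c
  𝔼-const D c = trans (∑-*ʳ (support D) (mass D) c) (trans (cong (_* c) (total D)) (ℚₚ.*-identityˡ c))

  𝔼-*ˡ : (D : Distribution A) (c : ℚ) (f : A → ℚ) → 𝔼 D (λ a → c * f a) ≡ c * 𝔼 D f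
  𝔼-*ˡ D c f = trans (∑-cong (support D) (λ a →
      solve 3 (λ w c f → w :* (c :* f) := c :* (w :* f)) refl (mass D a) c (f a)))
    (∑-*ˡ (support D) c _)

  𝔼-*ʳ : (D : Distribution A) (f : A → ℚ) (c : ℚ) → 𝔼 D (λ a → f a * c) ≡ 𝔼 D f * c
  𝔼-*ʳ D f c = trans (𝔼-cong D (λ a → ℚₚ.*-comm (f a) c)) (trans (𝔼-*ˡ D c f) (ℚₚ.*-comm c (𝔼 D f)))

  𝔼-∑ : (D : Distribution A) (cs : List C) (f : C → A → ℚ) →
    𝔼 D (λ a → ∑ cs (λ c → f c a)) ≡ ∑ cs (λ c → 𝔼 D (f c))
  𝔼-∑ D cs f = trans (∑-cong (support D) (λ a → sym (∑-*ˡ cs (mass D a) (λ c → f c a))))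
    (∑-comm (support D) cs _)

  𝔼-power-suc : (D : Distribution A) (k : ℕ) (f : Vec A (suc k) → ℚ) →
    𝔼 (power D (suc k)) f ≡ 𝔼 D (λ a → 𝔼 (power D k) (λ v → f (a ∷ v)))
  𝔼-power-suc D k f = trans (∑-allVecs-suc (support D) k _) (∑-cong (support D) λ a →
    trans (∑-cong (allVecs (support D) k) (λ v → ℚₚ.*-assoc (mass D a) (∏ (mass D) v) (f (a ∷ v))))
          (∑-*ˡ (allVecs (support D) k) (mass D a) _))

  -- Independence of the first coordinate from the others.
  𝔼-power-* : (D : Distribution A) (k : ℕ) (u : A → ℚ) (t : Vec A k → ℚ) →
    𝔼 (power D (suc k)) (λ v → u (head v) * t (tail v)) ≡ 𝔼 D u * 𝔼 (power D k) t
  𝔼-power-* D k u t = trans (𝔼-power-suc D k _)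
    (trans (𝔼-cong D (λ a → 𝔼-*ˡ (power D k) (u a) t)) (𝔼-*ʳ D u (𝔼 (power D k) t)))

  ind : Bool → ℚ
  ind true  = 1ℚ
  ind false = 0ℚ

  ind≥0 : ∀ b → 0ℚ ≤ ind b
  ind≥0 true  = 0≤1
  ind≥0 false = ≤-refl

  ind≤1 : ∀ b → ind b ≤ 1ℚ
  ind≤1 true  = ≤-refl
  ind≤1 false = 0≤1

  ind-∧ : ∀ b c → ind (b ∧ c) ≡ ind b * ind c
  ind-∧ true  c = sym (ℚₚ.*-identityˡ (ind c))
  ind-∧ false c = sym (ℚₚ.*-zeroˡ (ind c))

  ind-∨ : ∀ b c → ind (b ∨ c) ≤ ind b + ind c
  ind-∨ true  c = x≤x+y 1ℚ (ind≥0 c)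
  ind-∨ false c = ≤-reflexive (sym (ℚₚ.+-identityˡ (ind c)))

  ind-not : ∀ b → ind (not b) ≡ 1ℚ - ind b
  ind-not true  = refl
  ind-not false = refl

  not-∨ : ∀ b c → not (b ∨ c) ≡ not b ∧ not c
  not-∨ true  c = refl
  not-∨ false c = refl

  ind-any : (P : A → Bool) (as : List A) → ind (any P as) ≤ ∑ as (ind ∘ P)
  ind-any P []       = ≤-refl
  ind-any P (a ∷ as) = ≤-trans (ind-∨ (P a) (any P as)) (ℚₚ.+-monoʳ-≤ (ind (P a)) (ind-any P as))

  ℙ : Distribution A → (A → Bool) → ℚ
  ℙ D P = 𝔼 D (ind ∘ P)

  ℙ≤1 : (D : Distribution A) (P : A → Bool) → ℙ D P ≤ 1ℚ
  ℙ≤1 D P = ≤-trans (𝔼-mono D (ind≤1 ∘ P)) (≤-reflexive (𝔼-const D 1ℚ))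

  ℙ-not : (D : Distribution A) (P : A → Bool) → ℙ D (not ∘ P) ≡ 1ℚ - ℙ D P
  ℙ-not D P = trans (𝔼-cong D λ a → trans (ind-not (P a))
      (cong (1ℚ +_) (sym (trans (ℚₚ.*-comm (- 1ℚ) (ind (P a)))
        (solve 1 (λ x → x :* (:- con 1ℚ) := :- x) refl (ind (P a)))))))
    (trans (𝔼-+ D (λ _ → 1ℚ) (λ a → - 1ℚ * ind (P a)))
      (cong₂ _+_ (𝔼-const D 1ℚ) (trans (𝔼-*ˡ D (- 1ℚ) (ind ∘ P))
        (solve 1 (λ x → (:- con 1ℚ) :* x := :- x) refl (ℙ D P)))))

  -- Three rows with disjoint neighbourhoods in a sparse random graph.

  atMostOne allFalse : Bool → Bool → Bool → Bool
  atMostOne a b c = not (a ∧ b) ∧ (not (a ∧ c) ∧ not (b ∧ c))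
  allFalse a b c = not a ∧ (not b ∧ not c)

  disjointRows : ∀ {m} → Vec Bool m → Vec Bool m → Vec Bool m → Bool
  disjointRows []      []      []      = true
  disjointRows (a ∷ x) (b ∷ y) (c ∷ z) = atMostOne a b c ∧ disjointRows x y z

  -- The missed column is fixed in advance to be the first one, which costs only a factor (1 - q)³
  -- in the probability.
  isolatedTriple : ∀ {m} → Vec Bool (suc m) → Vec Bool (suc m) → Vec Bool (suc m) → Bool
  isolatedTriple (a ∷ x) (b ∷ y) (c ∷ z) = allFalse a b c ∧ disjointRows x y z

  -- Only blocks of three consecutive rows are tested, so the recursion follows the product
  -- structure of the distribution.
  hasIsolatedTriple : ∀ {n m} → Vec (Vec Bool (suc m)) n → Bool
  hasIsolatedTriple (x ∷ y ∷ z ∷ B) = isolatedTriple x y z ∨ hasIsolatedTriple B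
  hasIsolatedTriple (x ∷ y ∷ [])    = false
  hasIsolatedTriple (x ∷ [])        = false
  hasIsolatedTriple []              = false

  module Coins (q : ℚ) (q≥0 : 0ℚ ≤ q) (q≤1 : q ≤ 1ℚ) where

    coin : Distribution Bool
    coin = record
      { support = bits
      ; mass    = λ b → if b then q else 1ℚ - q
      ; nonNeg  = λ { true → q≥0 ; false → ≤⇒0≤- q≤1 }
      ; total   = solve 1 (λ q → con 1ℚ :- q :+ (q :+ con 0ℚ) := con 1ℚ) refl q
      }

    row : ∀ m → Distribution (Vec Bool m)
    row = power coin

    graph : ∀ n m → Distribution (Vec (Vec Bool m) n)
    graph n m = power (row m) n

    module SparseTriples where

      𝔼³ : {A : Set} → Distribution A → (A → A → A → ℚ) → ℚ
      𝔼³ D f = 𝔼 D λ x → 𝔼 D λ y → 𝔼 D λ z → f x y z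

      𝔼³-cong : {A : Set} (D : Distribution A) {f g : A → A → A → ℚ} →
        (∀ x y z → f x y z ≡ g x y z) → 𝔼³ D f ≡ 𝔼³ D g
      𝔼³-cong D h = 𝔼-cong D λ x → 𝔼-cong D λ y → 𝔼-cong D λ z → h x y z

      -- Takes the first column off three independent rows; the rows are treated from the innermost
      -- expectation outwards.
      𝔼³-* : ∀ m (u : Bool → Bool → Bool → ℚ) (t : Vec Bool m → Vec Bool m → Vec Bool m → ℚ) →
        𝔼³ (row (suc m)) (λ x y z → u (head x) (head y) (head z) * t (tail x) (tail y) (tail z))
          ≡ 𝔼³ coin u * 𝔼³ (row m) t
      𝔼³-* m u t = trans
        (𝔼-cong R λ x → trans
          (𝔼-cong R λ y → 𝔼-power-* coin m (u (head x) (head y)) (t (tail x) (tail y)))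
          (𝔼-power-* coin m (λ b → 𝔼 coin (u (head x) b)) (λ y → 𝔼 (row m) (t (tail x) y))))
        (𝔼-power-* coin m (λ a → 𝔼 coin λ b → 𝔼 coin (u a b)) (λ x → 𝔼 (row m) λ y → 𝔼 (row m) (t x y)))
        where R = row (suc m)

      κ : ℚ
      κ = 1ℚ - (q * q + q * q + q * q) + (q * q * q + q * q * q)

      atMostOne-probability : 𝔼³ coin (λ a b c → ind (atMostOne a b c)) ≡ κ
      atMostOne-probability = solve 1 (λ q →
        let E = λ f → (con 1ℚ :- q) :* f false :+ (q :* f true :+ con 0ℚ) in
        (E λ a → E λ b → E λ c → con (ind (atMostOne a b c)))
          := con 1ℚ :- (q :* q :+ q :* q :+ q :* q) :+ (q :* q :* q :+ q :* q :* q)) refl q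

      allFalse-probability : 𝔼³ coin (λ a b c → ind (allFalse a b c)) ≡ (1ℚ - q) ^ℚ 3
      allFalse-probability = solve 1 (λ q →
        let E = λ f → (con 1ℚ :- q) :* f false :+ (q :* f true :+ con 0ℚ) in
        (E λ a → E λ b → E λ c → con (ind (allFalse a b c)))
          := (con 1ℚ :- q) :* ((con 1ℚ :- q) :* ((con 1ℚ :- q) :* con 1ℚ))) refl q

      disjointRows-probability : ∀ m → 𝔼³ (row m) (λ x y z → ind (disjointRows x y z)) ≡ κ ^ℚ m
      disjointRows-probability zero    = refl
      disjointRows-probability (suc m) = trans
        (𝔼³-cong (row (suc m)) λ { (a ∷ x) (b ∷ y) (c ∷ z) → ind-∧ (atMostOne a b c) (disjointRows x y z) })
        (trans (𝔼³-* m (λ a b c → ind (atMostOne a b c)) (λ x y z → ind (disjointRows x y z)))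
          (cong₂ _*_ atMostOne-probability (disjointRows-probability m)))

      g : ℕ → ℚ
      g m = (1ℚ - q) ^ℚ 3 * κ ^ℚ m

      isolatedTriple-probability : ∀ m → 𝔼³ (row (suc m)) (λ x y z → ind (isolatedTriple x y z)) ≡ g m
      isolatedTriple-probability m = trans
        (𝔼³-cong (row (suc m)) λ { (a ∷ x) (b ∷ y) (c ∷ z) → ind-∧ (allFalse a b c) (disjointRows x y z) })
        (trans (𝔼³-* m (λ a b c → ind (allFalse a b c)) (λ x y z → ind (disjointRows x y z)))
          (cong₂ _*_ allFalse-probability (disjointRows-probability m)))

      𝔼-1- : {A : Set} (D : Distribution A) (f : A → ℚ) → 𝔼 D (λ a → 1ℚ - f a) ≡ 1ℚ - 𝔼 D f
      𝔼-1- D f = trans (𝔼-cong D λ a → cong (1ℚ +_) (neg (f a)))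
        (trans (𝔼-+ D (λ _ → 1ℚ) (λ a → - 1ℚ * f a))
          (cong₂ _+_ (𝔼-const D 1ℚ) (trans (𝔼-*ˡ D (- 1ℚ) f) (sym (neg (𝔼 D f))))))
        where
        neg : ∀ x → - x ≡ - 1ℚ * x
        neg = solve 1 (λ x → :- x := (:- con 1ℚ) :* x) refl

      bad-probability : ∀ m → 𝔼³ (row (suc m)) (λ x y z → ind (not (isolatedTriple x y z))) ≡ 1ℚ - g m
      bad-probability m = trans (𝔼³-cong R λ x y z → ind-not (isolatedTriple x y z))
        (trans (𝔼-cong R λ x → trans (𝔼-cong R λ y → 𝔼-1- R λ z → ind (isolatedTriple x y z))
            (𝔼-1- R λ y → 𝔼 R λ z → ind (isolatedTriple x y z)))
          (trans (𝔼-1- R λ x → 𝔼 R λ y → 𝔼 R λ z → ind (isolatedTriple x y z)) (cong (λ z → 1ℚ - z) (isolatedTriple-probability m))))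
        where R = row (suc m)

      1-g≥0 : ∀ m → 0ℚ ≤ 1ℚ - g m
      1-g≥0 m = subst (0ℚ ≤_) (bad-probability m)
        (𝔼≥0 R λ x → 𝔼≥0 R λ y → 𝔼≥0 R λ z → ind≥0 (not (isolatedTriple x y z)))
        where
        R = row (suc m)
        𝔼≥0 : {A : Set} (D : Distribution A) {f : A → ℚ} → (∀ a → 0ℚ ≤ f a) → 0ℚ ≤ 𝔼 D f
        𝔼≥0 D h = ∑-nonNeg (support D) λ a → *-nonNeg (nonNeg D a) (h a)

      -- The first three rows are independent of the remaining ones, so every further block
      -- multiplies the bound by `1 - g m`. Leftover rows only help, whence the inequality.
      fail-probability : ∀ k n m → k ℕ.* 3 ℕ.≤ n →
        ℙ (graph n (suc m)) (not ∘ hasIsolatedTriple) ≤ (1ℚ - g m) ^ℚ k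
      fail-probability zero n m _ = ℙ≤1 (graph n (suc m)) (not ∘ hasIsolatedTriple)
      fail-probability (suc k) (suc (suc (suc n))) m (ℕ.s≤s (ℕ.s≤s (ℕ.s≤s h))) = begin
        ℙ (power R (3 ℕ.+ n)) (not ∘ hasIsolatedTriple)
          ≡⟨ trans (𝔼-power-suc R (2 ℕ.+ n) _) (𝔼-cong R λ x →
               trans (𝔼-power-suc R (1 ℕ.+ n) _) (𝔼-cong R λ y → 𝔼-power-suc R n _)) ⟩
        𝔼³ R (λ x y z → 𝔼 (power R n) λ B → ind (not (isolatedTriple x y z ∨ hasIsolatedTriple B)))
          ≡⟨ 𝔼³-cong R (λ x y z → trans
               (𝔼-cong (power R n) λ B → trans (cong ind (not-∨ (isolatedTriple x y z) (hasIsolatedTriple B)))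
                                                (ind-∧ (not (isolatedTriple x y z)) (not (hasIsolatedTriple B))))
               (𝔼-*ˡ (power R n) (ind (not (isolatedTriple x y z))) (ind ∘ not ∘ hasIsolatedTriple))) ⟩
        𝔼³ R (λ x y z → ind (not (isolatedTriple x y z)) * F)
          ≡⟨ trans (𝔼-cong R λ x → trans (𝔼-cong R λ y → 𝔼-*ʳ R (λ z → ind (not (isolatedTriple x y z))) F)
               (𝔼-*ʳ R (λ y → 𝔼 R λ z → ind (not (isolatedTriple x y z))) F))
               (𝔼-*ʳ R (λ x → 𝔼 R λ y → 𝔼 R λ z → ind (not (isolatedTriple x y z))) F) ⟩
        𝔼³ R (λ x y z → ind (not (isolatedTriple x y z))) * F
          ≡⟨ cong (_* F) (bad-probability m) ⟩
        (1ℚ - g m) * F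
          ≤⟨ *-monoʳ (1ℚ - g m) (1-g≥0 m) (fail-probability k n m h) ⟩
        (1ℚ - g m) * (1ℚ - g m) ^ℚ k ∎
        where
        open ℚₚ.≤-Reasoning
        R = row (suc m)
        F = ℙ (power R n) (not ∘ hasIsolatedTriple)

      q²≥0 : 0ℚ ≤ q * q
      q²≥0 = *-nonNeg q≥0 q≥0

      t : ℚ
      t = q * q + q * q + q * q

      t≥0 : 0ℚ ≤ t
      t≥0 = +-nonNeg (+-nonNeg q²≥0 q²≥0) q²≥0

      -- J plays the role of (log₂ n) / 2.
      module _ (m J : ℕ) (1≤J : 1 ℕ.≤ J) (4^J≤n : 2 ℕ.^ J ℕ.* 2 ℕ.^ J ℕ.≤ suc m)
        (sparse : ι 64 * (ι (suc m) * (q * q)) ≤ ι (J ℕ.+ 2)) where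
        open ℚₚ.≤-Reasoning
        private

          n = suc m

          J<n : suc J ℕ.≤ n
          J<n = ℕₚ.≤-trans (n<2^n J) (ℕₚ.≤-trans (ℕₚ.m≤m*n (2 ℕ.^ J) (2 ℕ.^ J) {{ℕₚ.m^n≢0 2 J}}) 4^J≤n)

          J+2≤3J : J ℕ.+ 2 ℕ.≤ 3 ℕ.* J
          J+2≤3J = ℕₚ.+-monoʳ-≤ J (ℕₚ.+-mono-≤ 1≤J (ℕₚ.≤-trans 1≤J (ℕₚ.≤-reflexive (sym (ℕₚ.+-identityʳ J)))))

          blocks : ∃[ b ] n ℕ.≤ J ℕ.* b × J ℕ.* b ℕ.≤ n ℕ.+ J
          blocks = go J 1≤J
            where
            go : ∀ J → 1 ℕ.≤ J → ∃[ b ] n ℕ.≤ J ℕ.* b × J ℕ.* b ℕ.≤ n ℕ.+ J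
            go J@(suc _) _ = suc (n ℕD./ J)
              , ℕₚ.≤-trans (ℕₚ.≤-reflexive (ℕD.m≡m%n+[m/n]*n n J))
                  (ℕₚ.≤-trans (ℕₚ.+-mono-≤ (ℕₚ.<⇒≤ (ℕD.m%n<n n J)) (ℕₚ.≤-reflexive (ℕₚ.*-comm (n ℕD./ J) J)))
                    (ℕₚ.≤-reflexive (sym (ℕₚ.*-suc J (n ℕD./ J)))))
              , ℕₚ.≤-trans (ℕₚ.≤-reflexive (trans (ℕₚ.*-suc J (n ℕD./ J)) (ℕₚ.+-comm J _)))
                  (ℕₚ.+-monoˡ-≤ J (ℕₚ.≤-trans (ℕₚ.≤-reflexive (ℕₚ.*-comm J (n ℕD./ J))) (ℕD.m/n*n≤m n J)))

          b = proj₁ blocks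

          J>0 : 0ℚ < ι J
          J>0 = ℚₚ.<-≤-trans (ι>0 0) (ι-mono 1≤J)

          -- After multiplication by 64J the left side is at most 18J, by J b ≤ 2n and 64 n q² ≤ J +
          -- 2 ≤ 3J with t = 3q², and the right side is 32J.
          bt≤½ : ι b * t ≤ ½
          bt≤½ = *-cancelˡ (ι 64 * ι J) (*-pos (ι>0 63) J>0) (begin
            ι 64 * ι J * (ι b * t)
              ≡⟨ solve 4 (λ c j b t → c :* j :* (b :* t) := c :* (j :* b) :* t) refl (ι 64) (ι J) (ι b) t ⟩
            ι 64 * (ι J * ι b) * t
              ≤⟨ *-monoˡ t t≥0 (*-monoʳ (ι 64) (ι≥0 64) (≤-trans (≤-reflexive (sym (ι-* J b)))
                   (≤-trans (ι-mono (proj₂ (proj₂ blocks))) (ι-mono (ℕₚ.+-monoʳ-≤ n (ℕₚ.≤-trans (ℕₚ.n≤1+n J) J<n)))))) ⟩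
            ι 64 * ι (n ℕ.+ n) * t
              ≡⟨ trans (cong (λ z → ι 64 * z * t) (ι-+ n n))
                   (solve 3 (λ c n q → c :* (n :+ n) :* (q :* q :+ q :* q :+ q :* q) := con (ι 6) :* (c :* (n :* (q :* q)))) refl (ι 64) (ι n) q) ⟩
            ι 6 * (ι 64 * (ι n * (q * q)))
              ≤⟨ *-monoʳ (ι 6) (ι≥0 6) (≤-trans sparse (≤-trans (ι-mono J+2≤3J) (≤-reflexive (ι-* 3 J)))) ⟩
            ι 6 * (ι 3 * ι J)
              ≤⟨ x≤y+x _ (*-nonNeg (ι≥0 14) (ι≥0 J)) ⟩
            ι 14 * ι J + ι 6 * (ι 3 * ι J)
              ≡⟨ solve 1 (λ j → con (ι 14) :* j :+ con (ι 6) :* (con (ι 3) :* j) := con (ι 64) :* j :* con ½) refl (ι J) ⟩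
            ι 64 * ι J * ½ ∎)

          q≤½ : q ≤ ½
          q≤½ = ℚₚ.≮⇒≥ λ ½<q → ℚₚ.<-irrefl refl (begin-strict
            ι (J ℕ.+ 2)                        ≤⟨ ι-mono (ℕₚ.≤-trans J+2≤3J (ℕₚ.*-monoʳ-≤ 3 (ℕₚ.≤-trans (ℕₚ.n≤1+n J) J<n))) ⟩
            ι (3 ℕ.* n)                        ≡⟨ ι-* 3 n ⟩
            ι 3 * ι n                          <⟨ ℚₚ.*-monoˡ-<-pos (ι n) {{ℚ.positive (ι>0 m)}} {ι 3} {ι 16} (toWitness {a? = ι 3 ℚₚ.<? ι 16} _) ⟩
            ι 16 * ι n                         ≡⟨ solve 1 (λ n → con (ι 16) :* n := con (ι 64) :* (n :* (con ½ :* con ½))) refl (ι n) ⟩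
            ι 64 * (ι n * (½ * ½))             ≤⟨ *-monoʳ (ι 64) (ι≥0 64) (*-monoʳ (ι n) (ι≥0 n)
                                                    (*-mono 0≤½ q≥0 (ℚₚ.<⇒≤ ½<q) (ℚₚ.<⇒≤ ½<q))) ⟩
            ι 64 * (ι n * (q * q))             ≤⟨ sparse ⟩
            ι (J ℕ.+ 2)                        ∎)

          t≤1 : t ≤ 1ℚ
          t≤1 = ≤-trans (ℚₚ.+-mono-≤ (ℚₚ.+-mono-≤ q²≤ q²≤) q²≤) (ℚₚ.≤ᵇ⇒≤ _)
            where
            q²≤ : q * q ≤ ½ * ½
            q²≤ = *-mono q≥0 0≤½ q≤½ q≤½

          1-t≤κ : 1ℚ - t ≤ κ
          1-t≤κ = x≤x+y (1ℚ - t) (+-nonNeg (*-nonNeg q²≥0 q≥0) (*-nonNeg q²≥0 q≥0))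

          1-t≥0 : 0ℚ ≤ 1ℚ - t
          1-t≥0 = ≤⇒0≤- t≤1

          κ≥0 : 0ℚ ≤ κ
          κ≥0 = ≤-trans 1-t≥0 1-t≤κ

          -- The n columns fit into `J` groups of `b`, and by Bernoulli each group keeps all its
          -- columns good with probability at least ½. With 4^J ≤ n the result is at least n^(-1/2).
          ½^J≤κ^m : ½ ^ℚ J ≤ κ ^ℚ m
          ½^J≤κ^m = begin
            ½ ^ℚ J                         ≤⟨ ^-monoˡ 0≤½ (≤-trans (subst (_≤ 1ℚ - ι b * t) (solve 0 (con 1ℚ :- con ½ := con ½) refl)
                                                (ℚₚ.+-monoʳ-≤ 1ℚ (ℚₚ.neg-antimono-≤ bt≤½))) (bernoulli t t≤1 b)) J ⟩
            ((1ℚ - t) ^ℚ b) ^ℚ J           ≡⟨ ^-* (1ℚ - t) J b ⟨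
            (1ℚ - t) ^ℚ (J ℕ.* b)          ≤⟨ ^-antiʳ 1-t≥0 (x-y≤x 1ℚ t≥0) (proj₁ (proj₂ blocks)) ⟩
            (1ℚ - t) ^ℚ n                  ≤⟨ ^-antiʳ 1-t≥0 (x-y≤x 1ℚ t≥0) (ℕₚ.n≤1+n m) ⟩
            (1ℚ - t) ^ℚ m                  ≤⟨ ^-monoˡ 1-t≥0 1-t≤κ m ⟩
            κ ^ℚ m                         ∎

          g≥ : ½ ^ℚ 3 * ½ ^ℚ J ≤ g m
          g≥ = *-mono (^-nonNeg 0≤½ J) (^-nonNeg (≤⇒0≤- q≤1) 3)
            (^-monoˡ 0≤½ (subst (_≤ 1ℚ - q) (solve 0 (con 1ℚ :- con ½ := con ½) refl)
              (ℚₚ.+-monoʳ-≤ 1ℚ (ℚₚ.neg-antimono-≤ q≤½))) 3) ½^J≤κ^m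

          k = n ℕD./ 3

          n≤3+3k : n ℕ.≤ 3 ℕ.+ 3 ℕ.* k
          n≤3+3k = ℕₚ.≤-trans (ℕₚ.≤-reflexive (ℕD.m≡m%n+[m/n]*n n 3))
            (ℕₚ.+-mono-≤ (ℕₚ.<⇒≤ (ℕD.m%n<n n 3)) (ℕₚ.≤-reflexive (ℕₚ.*-comm k 3)))

          g≥0 : 0ℚ ≤ g m
          g≥0 = *-nonNeg (^-nonNeg (≤⇒0≤- q≤1) 3) (^-nonNeg κ≥0 m)

          g≤1 : g m ≤ 1ℚ
          g≤1 = 0≤-⇒≤ (1-g≥0 m)

          -- The expected number `k g` of successful blocks is at least of order 2^J: from 4^J ≤ n ≤
          -- 3 + 3k and g ≥ 2^-(J+3) follows 2^J ≤ 24 (1 + k g), and J ≤ 2^J.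
          J≤ : ι J ≤ ι 24 * (1ℚ + ι k * g m)
          J≤ = begin
            ι J                                              ≤⟨ ι-mono (ℕₚ.≤-trans (ℕₚ.n≤1+n J) (n<2^n J)) ⟩
            ι (2 ℕ.^ J)                                      ≡⟨ ι-2^ J ⟩
            2ℚ ^ℚ J                                          ≡⟨ trans (cong (2ℚ ^ℚ J *_) (2^½^ J)) (ℚₚ.*-identityʳ (2ℚ ^ℚ J)) ⟨
            2ℚ ^ℚ J * (2ℚ ^ℚ J * ½ ^ℚ J)                     ≡⟨ ℚₚ.*-assoc (2ℚ ^ℚ J) (2ℚ ^ℚ J) (½ ^ℚ J) ⟨
            2ℚ ^ℚ J * 2ℚ ^ℚ J * ½ ^ℚ J                       ≡⟨ cong (_* ½ ^ℚ J) (trans (ι-* (2 ℕ.^ J) (2 ℕ.^ J)) (cong₂ _*_ (ι-2^ J) (ι-2^ J))) ⟨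
            ι (2 ℕ.^ J ℕ.* 2 ℕ.^ J) * ½ ^ℚ J                 ≤⟨ *-monoˡ (½ ^ℚ J) (^-nonNeg 0≤½ J) (ι-mono (ℕₚ.≤-trans 4^J≤n n≤3+3k)) ⟩
            ι (3 ℕ.+ 3 ℕ.* k) * ½ ^ℚ J                       ≡⟨ cong (_* ½ ^ℚ J) (trans (ι-+ 3 (3 ℕ.* k)) (cong (ι 3 +_) (ι-* 3 k))) ⟩
            (ι 3 + ι 3 * ι k) * ½ ^ℚ J                       ≡⟨ solve 2 (λ k h → (con (ι 3) :+ con (ι 3) :* k) :* h
                                                                  := con (ι 3) :* h :+ con (ι 24) :* (k :* (con (½ ^ℚ 3) :* h))) refl (ι k) (½ ^ℚ J) ⟩
            ι 3 * ½ ^ℚ J + ι 24 * (ι k * (½ ^ℚ 3 * ½ ^ℚ J))  ≤⟨ ℚₚ.+-mono-≤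
                                                                  (*-mono (^-nonNeg 0≤½ J) (ι≥0 24) (ι-mono (ℕₚ.≤ᵇ⇒≤ 3 24 _)) (^≤1 0≤½ (ℚₚ.≤ᵇ⇒≤ _) J))
                                                                  (*-monoʳ (ι 24) (ι≥0 24) (*-monoʳ (ι k) (ι≥0 k) g≥)) ⟩
            ι 24 * 1ℚ + ι 24 * (ι k * g m)                   ≡⟨ ℚₚ.*-distribˡ-+ (ι 24) 1ℚ (ι k * g m) ⟨
            ι 24 * (1ℚ + ι k * g m)                          ∎

        fail-bound : ℙ (graph n n) (not ∘ hasIsolatedTriple) * ι J ≤ ι 24
        fail-bound = begin
          ℙ (graph n n) (not ∘ hasIsolatedTriple) * ι J
            ≤⟨ *-mono (ι≥0 J) (^-nonNeg (1-g≥0 m) k) (fail-probability k n m (ℕD.m/n*n≤m n 3)) J≤ ⟩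
          (1ℚ - g m) ^ℚ k * (ι 24 * (1ℚ + ι k * g m))
            ≡⟨ solve 3 (λ a b c → a :* (b :* c) := b :* (a :* c)) refl ((1ℚ - g m) ^ℚ k) (ι 24) (1ℚ + ι k * g m) ⟩
          ι 24 * ((1ℚ - g m) ^ℚ k * (1ℚ + ι k * g m))
            ≤⟨ *-monoʳ (ι 24) (ι≥0 24) (reciprocal-bernoulli (g m) g≥0 g≤1 k) ⟩
          ι 24 * 1ℚ
            ≡⟨ ℚₚ.*-identityʳ (ι 24) ⟩
          ι 24 ∎

-- From isolated triples of rows to graphs that three trees cannot cover.

module _ where
  open import Data.Nat using (_+_; _*_; _∸_; _≤_; _<_; z≤n; s≤s)

  disjointRows-lookup : ∀ {m} (x y z : Vec Bool m) → T (disjointRows x y z) → ∀ j →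
    T (atMostOne (lookup x j) (lookup y j) (lookup z j))
  disjointRows-lookup (a ∷ x) (b ∷ y) (c ∷ z) d zero    = proj₁ (∧⁻ d)
  disjointRows-lookup (a ∷ x) (b ∷ y) (c ∷ z) d (suc j) = disjointRows-lookup x y z (proj₂ (∧⁻ {atMostOne a b c} d)) j

  allFalse⇒atMostOne : ∀ a b c → T (allFalse a b c) → T (atMostOne a b c)
  allFalse⇒atMostOne false false false _ = tt

  isolatedTriple-lookup : ∀ {m} (x y z : Vec Bool (suc m)) → T (isolatedTriple x y z) → ∀ j →
    T (atMostOne (lookup x j) (lookup y j) (lookup z j))
  isolatedTriple-lookup (a ∷ x) (b ∷ y) (c ∷ z) d zero    = allFalse⇒atMostOne a b c (proj₁ (∧⁻ d))
  isolatedTriple-lookup (a ∷ x) (b ∷ y) (c ∷ z) d (suc j) = disjointRows-lookup x y z (proj₂ (∧⁻ {allFalse a b c} d)) j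

  isolatedTriple-zero : ∀ {m} (x y z : Vec Bool (suc m)) → T (isolatedTriple x y z) →
    ¬ T (lookup x zero) × ¬ T (lookup y zero) × ¬ T (lookup z zero)
  isolatedTriple-zero (a ∷ x) (b ∷ y) (c ∷ z) d =
    let ¬a , bc = ∧⁻ {not a} (proj₁ (∧⁻ {allFalse a b c} d)) ; ¬b , ¬c = ∧⁻ {not b} bc in
    not⁻ ¬a , not⁻ ¬b , not⁻ ¬c

  atMostOne⁻ : ∀ a b c → T (atMostOne a b c) → (T a → ¬ T b) × (T a → ¬ T c) × (T b → ¬ T c)
  atMostOne⁻ true  true  c     ()
  atMostOne⁻ true  false true  ()
  atMostOne⁻ true  false false _  = (λ _ ()) , (λ _ ()) , (λ ())
  atMostOne⁻ false true  true  ()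
  atMostOne⁻ false true  false _  = (λ ()) , (λ ()) , (λ _ ())
  atMostOne⁻ false false c     _  = (λ ()) , (λ ()) , (λ ())

  IsolatedTriple : ∀ {n m} → BipartiteGraph n (suc m) → Set
  IsolatedTriple {n} {m} B = Σ[ t ∈ (Fin 3 → Fin n) ]
    (∀ a a′ → t a ≡ t a′ → a ≡ a′) ×
    (∀ j a a′ → T (edge B (t a) j) → T (edge B (t a′) j) → a ≡ a′) ×
    (∀ a → ¬ T (edge B (t a) zero))

  hasIsolatedTriple⇒ : ∀ {n m} (B : BipartiteGraph n (suc m)) → T (hasIsolatedTriple B) → IsolatedTriple B
  hasIsolatedTriple⇒ {suc (suc (suc n))} {m} (x ∷ y ∷ z ∷ B) s = [ first , later ]′ (∨⁻ {isolatedTriple x y z} s)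
    where
    B₃ : BipartiteGraph (3 ℕ.+ n) (suc m)
    B₃ = x ∷ y ∷ z ∷ B
    later : T (hasIsolatedTriple B) → IsolatedTriple B₃
    later s = let t , inj , disj , iso = hasIsolatedTriple⇒ B s in
      (λ a → suc (suc (suc (t a)))) , (λ a a′ e → inj a a′ (suc³-injective e)) , disj , iso
      where
      suc³-injective : ∀ {i j : Fin n} → _≡_ {A = Fin (3 ℕ.+ n)} (suc (suc (suc i))) (suc (suc (suc j))) → i ≡ j
      suc³-injective refl = refl
    first : T (isolatedTriple x y z) → IsolatedTriple B₃
    first g = t , Finₚ.↑ˡ-injective n , disj , iso
      where
      t : Fin 3 → Fin (3 ℕ.+ n)
      t a = a Fin.↑ˡ n
      pairwise : ∀ j → _
      pairwise j = atMostOne⁻ (lookup x j) (lookup y j) (lookup z j) (isolatedTriple-lookup x y z g j)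
      disj : ∀ j a a′ → T (edge B₃ (t a) j) → T (edge B₃ (t a′) j) → a ≡ a′
      disj j zero             zero             e e′ = refl
      disj j zero             (suc zero)       e e′ = contradiction e′ (proj₁ (pairwise j) e)
      disj j zero             (suc (suc zero)) e e′ = contradiction e′ (proj₁ (proj₂ (pairwise j)) e)
      disj j (suc zero)       zero             e e′ = contradiction e (proj₁ (pairwise j) e′)
      disj j (suc zero)       (suc zero)       e e′ = refl
      disj j (suc zero)       (suc (suc zero)) e e′ = contradiction e′ (proj₂ (proj₂ (pairwise j)) e)
      disj j (suc (suc zero)) zero             e e′ = contradiction e (proj₁ (proj₂ (pairwise j)) e′)
      disj j (suc (suc zero)) (suc zero)       e e′ = contradiction e (proj₂ (proj₂ (pairwise j)) e′)
      disj j (suc (suc zero)) (suc (suc zero)) e e′ = refl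
      iso : ∀ a → ¬ T (edge B₃ (t a) zero)
      iso zero             = proj₁ (isolatedTriple-zero x y z g)
      iso (suc zero)       = proj₁ (proj₂ (isolatedTriple-zero x y z g))
      iso (suc (suc zero)) = proj₂ (proj₂ (isolatedTriple-zero x y z g))

  hasIsolatedTriple⇒uncoverable : ∀ {n m} (B : BipartiteGraph n (suc m)) → T (hasIsolatedTriple B) →
    ¬ CoverableBy 2 (toGraph B) 3
  hasIsolatedTriple⇒uncoverable B s = let t , inj , disj , iso = hasIsolatedTriple⇒ B s in
    disjoint-rows⇒uncoverable B t zero inj disj iso

-- Pairs of vertex sets without edges
module _ where
  open import Data.Rational using (_+_; _*_; _-_; -_; _≤_; _<_; ∣_∣)
  open import Data.Rational.Properties using (≤-trans; ≤-reflexive; ≤-refl)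
  open +-*-Solver using (solve; _:+_; _:*_; :-_; _:-_; _:=_; con)

  ones : ∀ {n} → Vec Bool n → ℕ
  ones []      = 0
  ones (b ∷ v) = bit b ℕ.+ ones v

  ones-tabulate : ∀ {n} (P : Subset n) → ones (Vec.tabulate P) ≡ count P
  ones-tabulate {zero}  P = refl
  ones-tabulate {suc n} P = cong (bit (P zero) ℕ.+_) (ones-tabulate (P ∘ suc))

  avoids : ∀ {m} → Vec Bool m → Vec Bool m → Bool
  avoids []      []      = true
  avoids (y ∷ Y) (b ∷ r) = not (y ∧ b) ∧ avoids Y r

  noEdge : ∀ {n m} → Vec Bool n → Vec Bool m → BipartiteGraph n m → Bool
  noEdge []      Y []      = true
  noEdge (x ∷ X) Y (r ∷ B) = not (x ∧ not (avoids Y r)) ∧ noEdge X Y B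

  avoids⁺ : ∀ {m} (Y r : Vec Bool m) → (∀ j → T (lookup Y j) → ¬ T (lookup r j)) → T (avoids Y r)
  avoids⁺ []      []      h = tt
  avoids⁺ (y ∷ Y) (b ∷ r) h = ∧⁺ {not (y ∧ b)}
    (not⁺ λ yb → let y′ , b′ = ∧⁻ {y} yb in h zero y′ b′) (avoids⁺ Y r (h ∘ suc))

  noEdge⁺ : ∀ {n m} (X : Vec Bool n) (Y : Vec Bool m) (B : BipartiteGraph n m) →
    (∀ i j → T (lookup X i) → T (lookup Y j) → ¬ T (edge B i j)) → T (noEdge X Y B)
  noEdge⁺ []      Y []      h = tt
  noEdge⁺ (x ∷ X) Y (r ∷ B) h = ∧⁺ {not (x ∧ not (avoids Y r))}
    (not⁺ λ xr → let x′ , r′ = ∧⁻ {x} xr in not⁻ r′ (avoids⁺ Y r λ j → h zero j x′))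
    (noEdge⁺ X Y B (h ∘ suc))

  subsets : ∀ n → List (Vec Bool n)
  subsets n = allVecs bits n

  -- Sizes are exact, so that the union bound runs over binomial coefficients; `gapless⇒expands`
  -- shrinks larger sets to these sizes.
  hasGap : ∀ {n m} → ℕ → ℕ → BipartiteGraph n m → Bool
  hasGap {n} {m} s t B = any (λ X → any (λ Y → gap X Y) (subsets m)) (subsets n)
    where
    gap : Vec Bool n → Vec Bool m → Bool
    gap X Y = (ones X ℕ.≡ᵇ s) ∧ ((ones Y ℕ.≡ᵇ t) ∧ noEdge X Y B)

  gappy : ∀ {n} → ℕ → ℕ → BipartiteGraph n n → Bool
  gappy s t B = hasGap s t B ∨ hasGap t s B

  gapless⇒expands : ∀ {n m} s t (B : BipartiteGraph n m) → ¬ T (hasGap s t B) → Expands (edge B) s t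
  gapless⇒expands {n} {m} s t B ¬gap X₀ Y₀ s≤ t≤ = go (Finₚ.any? λ i → Finₚ.any? λ j →
      T? (X i) ×-dec (T? (Y j) ×-dec T? (edge B i j)))
    where
    X∃ = subset-of-size X₀ s s≤
    Y∃ = subset-of-size Y₀ t t≤
    X = proj₁ X∃
    Y = proj₁ Y∃
    go : Dec (∃[ i ] ∃[ j ] T (X i) × T (Y j) × T (edge B i j)) →
      ∃[ i ] ∃[ j ] T (X₀ i) × T (Y₀ j) × T (edge B i j)
    go (yes (i , j , x , y , e)) = i , j , proj₁ (proj₂ X∃) i x , proj₁ (proj₂ Y∃) j y , e
    go (no ¬e) = contradiction
      (Anyₚ.any⁺ _ (lose (allVecs-complete bits-complete (Vec.tabulate X))
        (Anyₚ.any⁺ _ (lose (allVecs-complete bits-complete (Vec.tabulate Y))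
          (∧⁺ (ℕₚ.≡⇒≡ᵇ _ _ (trans (ones-tabulate X) (proj₂ (proj₂ X∃))))
            (∧⁺ (ℕₚ.≡⇒≡ᵇ _ _ (trans (ones-tabulate Y) (proj₂ (proj₂ Y∃))))
              (noEdge⁺ (Vec.tabulate X) (Vec.tabulate Y) B λ i j x y e →
                ¬e (i , j , subst T (Vecₚ.lookup∘tabulate X i) x , subst T (Vecₚ.lookup∘tabulate Y j) y , e))))))))
      ¬gap

  -- Left as a sum over subsets, which is the form that the union bound produces and that `∑-∏`
  -- evaluates.
  binomial : ℕ → ℕ → ℚ
  binomial n k = ∑ (subsets n) (λ X → ind (ones X ℕ.≡ᵇ k))

  binomial≥0 : ∀ n k → 0ℚ ≤ binomial n k
  binomial≥0 n k = ∑-nonNeg (subsets n) (λ X → ind≥0 (ones X ℕ.≡ᵇ k))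

  -- The left side is the contribution of the sets of size `k` to the expansion of (1 + a)^n as the
  -- sum of a^|X| over all sets X.
  binomial-bound : ∀ n k a → 0ℚ ≤ a → binomial n k * a ^ℚ k ≤ (1ℚ + a) ^ℚ n
  binomial-bound n k a a≥0 = begin
    binomial n k * a ^ℚ k                                  ≡⟨ ∑-*ʳ (subsets n) (λ X → ind (ones X ℕ.≡ᵇ k)) (a ^ℚ k) ⟨
    ∑ (subsets n) (λ X → ind (ones X ℕ.≡ᵇ k) * a ^ℚ k)      ≤⟨ ∑-mono (subsets n) (λ X → term X (ones X ℕ.≡ᵇ k) (ℕₚ.≡ᵇ⇒≡ (ones X) k)) ⟩
    ∑ (subsets n) (∏ w)                                    ≡⟨ ∑-∏ bits w n ⟩
    (1ℚ + (a + 0ℚ)) ^ℚ n                                   ≡⟨ cong (λ z → (1ℚ + z) ^ℚ n) (ℚₚ.+-identityʳ a) ⟩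
    (1ℚ + a) ^ℚ n                                          ∎
    where
    open ℚₚ.≤-Reasoning
    w : Bool → ℚ
    w b = if b then a else 1ℚ
    ∏-ones : ∀ {n} (X : Vec Bool n) → ∏ w X ≡ a ^ℚ ones X
    ∏-ones []          = refl
    ∏-ones (true  ∷ X) = cong (a *_) (∏-ones X)
    ∏-ones (false ∷ X) = trans (ℚₚ.*-identityˡ (∏ w X)) (∏-ones X)
    term : ∀ X b → (T b → ones X ≡ k) → ind b * a ^ℚ k ≤ ∏ w X
    term X true  e = ≤-reflexive (trans (ℚₚ.*-identityˡ (a ^ℚ k)) (trans (cong (a ^ℚ_) (sym (e tt))) (sym (∏-ones X))))
    term X false e = subst (_≤ ∏ w X) (sym (ℚₚ.*-zeroˡ (a ^ℚ k)))
      (subst (0ℚ ≤_) (sym (∏-ones X)) (^-nonNeg a≥0 (ones X)))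

  module Gaps (q : ℚ) (q≥0 : 0ℚ ≤ q) (q≤1 : q ≤ 1ℚ) where
    open Coins q q≥0 q≤1
    open ℚₚ.≤-Reasoning

    r : ℚ
    r = 1ℚ - q

    r≥0 : 0ℚ ≤ r
    r≥0 = ≤⇒0≤- q≤1

    avoids-probability : ∀ {m} (Y : Vec Bool m) → ℙ (row m) (avoids Y) ≡ r ^ℚ ones Y
    avoids-probability [] = refl
    avoids-probability {suc m} (y ∷ Y) = trans
      (𝔼-cong (row (suc m)) λ { (b ∷ v) → ind-∧ (not (y ∧ b)) (avoids Y v) })
      (trans (𝔼-power-* coin m (λ b → ind (not (y ∧ b))) (λ v → ind (avoids Y v)))
        (trans (cong (𝔼 coin (λ b → ind (not (y ∧ b))) *_) (avoids-probability Y)) (factor y)))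
      where
      factor : ∀ y → 𝔼 coin (λ b → ind (not (y ∧ b))) * r ^ℚ ones Y ≡ r ^ℚ (bit y ℕ.+ ones Y)
      factor true  = cong (_* r ^ℚ ones Y)
        (solve 1 (λ q → (con 1ℚ :- q) :* con 1ℚ :+ (q :* con 0ℚ :+ con 0ℚ) := con 1ℚ :- q) refl q)
      factor false = trans (cong (_* r ^ℚ ones Y)
        (solve 1 (λ q → (con 1ℚ :- q) :* con 1ℚ :+ (q :* con 1ℚ :+ con 0ℚ) := con 1ℚ) refl q))
        (ℚₚ.*-identityˡ (r ^ℚ ones Y))

    noEdge-probability : ∀ {n m} (X : Vec Bool n) (Y : Vec Bool m) →
      ℙ (graph n m) (noEdge X Y) ≡ (r ^ℚ ones Y) ^ℚ ones X
    noEdge-probability [] Y = refl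
    noEdge-probability {suc n} {m} (x ∷ X) Y = trans
      (𝔼-cong (graph (suc n) m) λ { (v ∷ B) → ind-∧ (not (x ∧ not (avoids Y v))) (noEdge X Y B) })
      (trans (𝔼-power-* (row m) n (λ v → ind (not (x ∧ not (avoids Y v)))) (λ B → ind (noEdge X Y B)))
        (trans (cong (𝔼 (row m) (λ v → ind (not (x ∧ not (avoids Y v)))) *_) (noEdge-probability X Y)) (factor x)))
      where
      c = r ^ℚ ones Y
      factor : ∀ x → 𝔼 (row m) (λ v → ind (not (x ∧ not (avoids Y v)))) * c ^ℚ ones X ≡ c ^ℚ (bit x ℕ.+ ones X)
      factor true  = cong (_* c ^ℚ ones X)
        (trans (𝔼-cong (row m) λ v → cong ind (not-involutive (avoids Y v))) (avoids-probability Y))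
      factor false = trans (cong (_* c ^ℚ ones X) (𝔼-const (row m) 1ℚ)) (ℚₚ.*-identityˡ (c ^ℚ ones X))

    gap-bound : ∀ n m s t → ℙ (graph n m) (hasGap s t) ≤ binomial n s * (binomial m t * (r ^ℚ t) ^ℚ s)
    gap-bound n m s t = begin
      𝔼 G (λ B → ind (hasGap s t B))
        ≤⟨ 𝔼-mono G (λ B → ≤-trans (ind-any _ (subsets n)) (∑-mono (subsets n) λ X → ind-any _ (subsets m))) ⟩
      𝔼 G (λ B → ∑ (subsets n) λ X → ∑ (subsets m) λ Y → ind ((ones X ℕ.≡ᵇ s) ∧ ((ones Y ℕ.≡ᵇ t) ∧ noEdge X Y B)))
        ≡⟨ trans (𝔼-∑ G (subsets n) _) (∑-cong (subsets n) λ X → 𝔼-∑ G (subsets m) _) ⟩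
      (∑ (subsets n) λ X → ∑ (subsets m) λ Y → 𝔼 G λ B → ind ((ones X ℕ.≡ᵇ s) ∧ ((ones Y ℕ.≡ᵇ t) ∧ noEdge X Y B)))
        ≡⟨ ∑-cong (subsets n) (λ X → ∑-cong (subsets m) λ Y → pair X Y) ⟩
      (∑ (subsets n) λ X → ∑ (subsets m) λ Y → ind (ones X ℕ.≡ᵇ s) * (ind (ones Y ℕ.≡ᵇ t) * c))
        ≡⟨ trans (∑-cong (subsets n) λ X → trans (∑-*ˡ (subsets m) (ind (ones X ℕ.≡ᵇ s)) _)
             (cong (ind (ones X ℕ.≡ᵇ s) *_) (∑-*ʳ (subsets m) (λ Y → ind (ones Y ℕ.≡ᵇ t)) c)))
             (∑-*ʳ (subsets n) (λ X → ind (ones X ℕ.≡ᵇ s)) (binomial m t * c)) ⟩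
      binomial n s * (binomial m t * c) ∎
      where
      G = graph n m
      c = (r ^ℚ t) ^ℚ s
      cond : ∀ b {x y} → (T b → x ≡ y) → ind b * x ≡ ind b * y
      cond true  h = cong (1ℚ *_) (h tt)
      cond false {x} {y} h = trans (ℚₚ.*-zeroˡ x) (sym (ℚₚ.*-zeroˡ y))
      pair : ∀ X Y → 𝔼 G (λ B → ind ((ones X ℕ.≡ᵇ s) ∧ ((ones Y ℕ.≡ᵇ t) ∧ noEdge X Y B)))
        ≡ ind (ones X ℕ.≡ᵇ s) * (ind (ones Y ℕ.≡ᵇ t) * c)
      pair X Y = trans
        (𝔼-cong G λ B → trans (ind-∧ (ones X ℕ.≡ᵇ s) _)
          (cong (ind (ones X ℕ.≡ᵇ s) *_) (ind-∧ (ones Y ℕ.≡ᵇ t) (noEdge X Y B))))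
        (trans (𝔼-*ˡ G (ind (ones X ℕ.≡ᵇ s)) _)
          (cond (ones X ℕ.≡ᵇ s) λ x → trans (𝔼-*ˡ G (ind (ones Y ℕ.≡ᵇ t)) _)
            (cond (ones Y ℕ.≡ᵇ t) λ y → trans (noEdge-probability X Y)
              (cong₂ (λ a b → (r ^ℚ a) ^ℚ b) (ℕₚ.≡ᵇ⇒≡ (ones Y) t y) (ℕₚ.≡ᵇ⇒≡ (ones X) s x)))))

    -- The sets have sizes `s` and `t = 2d`. There are at most 2 · 2^((L+2)s) small ones, and the
    -- number of large ones times (1 - q)^(st) is at most 2^(1-d). By `budget` the product is at
    -- most 4 · 2^(-L).
    module _ (n L s d : ℕ) (n≤ : n ℕ.≤ 2 ℕ.^ (L ℕ.+ 1)) (n≤256 : n ℕ.≤ 256 ℕ.* (d ℕ.+ 1))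
      (r^s≤ : r ^ℚ s ≤ ½ ^ℚ 10) (budget : (L ℕ.+ 2) ℕ.* s ℕ.+ L ℕ.≤ d) where

      private
        z = r ^ℚ s
        a = ½ ^ℚ (L ℕ.+ 2)
        t = d ℕ.+ d

        z≥0 : 0ℚ ≤ z
        z≥0 = ^-nonNeg r≥0 s

        2z≥0 : 0ℚ ≤ 2ℚ * z
        2z≥0 = *-nonNeg 0≤2 z≥0

        a≥0 : 0ℚ ≤ a
        a≥0 = ^-nonNeg 0≤½ (L ℕ.+ 2)

        na≤½ : ι n * a ≤ ½
        na≤½ = begin
          ι n * a                                             ≤⟨ *-monoˡ a a≥0 (≤-trans (ι-mono n≤) (≤-reflexive (ι-2^ (L ℕ.+ 1)))) ⟩
          2ℚ ^ℚ (L ℕ.+ 1) * a                                 ≡⟨ cong (2ℚ ^ℚ (L ℕ.+ 1) *_) (trans (cong (½ ^ℚ_) (sym (ℕₚ.+-assoc L 1 1))) (^-+ ½ (L ℕ.+ 1) 1)) ⟩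
          2ℚ ^ℚ (L ℕ.+ 1) * (½ ^ℚ (L ℕ.+ 1) * ½ ^ℚ 1)         ≡⟨ ℚₚ.*-assoc (2ℚ ^ℚ (L ℕ.+ 1)) (½ ^ℚ (L ℕ.+ 1)) (½ ^ℚ 1) ⟨
          2ℚ ^ℚ (L ℕ.+ 1) * ½ ^ℚ (L ℕ.+ 1) * ½ ^ℚ 1           ≡⟨ cong (_* ½ ^ℚ 1) (2^½^ (L ℕ.+ 1)) ⟩
          1ℚ * ½ ^ℚ 1                                         ≡⟨⟩
          ½                                                   ∎

        small-sets : binomial n s * a ^ℚ s ≤ 2ℚ
        small-sets = ≤-trans (binomial-bound n s a a≥0) ([1+a]^≤2 a a≥0 n na≤½)

        256*2z≤½ : ι 256 * (2ℚ * z) ≤ ½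
        256*2z≤½ = ≤-trans (*-monoʳ (ι 256) (ι≥0 256) (*-monoʳ 2ℚ 0≤2 r^s≤)) (ℚₚ.≤ᵇ⇒≤ _)

        -- Since z ≤ 2^-10, the weight `2ℚ * z` lets every 256 vertices contribute a factor of at
        -- most 2. The doubling of z is a factor 4^d on the left, which outweighs 2^(d+1).
        large-sets : binomial n t * (2ℚ * z) ^ℚ t ≤ 2ℚ ^ℚ (d ℕ.+ 1)
        large-sets = begin
          binomial n t * (2ℚ * z) ^ℚ t                  ≤⟨ binomial-bound n t (2ℚ * z) 2z≥0 ⟩
          (1ℚ + 2ℚ * z) ^ℚ n                            ≤⟨ ^-monoʳ (x≤x+y 1ℚ 2z≥0) (ℕₚ.≤-trans n≤256 (ℕₚ.≤-reflexive (ℕₚ.*-comm 256 (d ℕ.+ 1)))) ⟩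
          (1ℚ + 2ℚ * z) ^ℚ ((d ℕ.+ 1) ℕ.* 256)          ≡⟨ ^-* (1ℚ + 2ℚ * z) (d ℕ.+ 1) 256 ⟩
          ((1ℚ + 2ℚ * z) ^ℚ 256) ^ℚ (d ℕ.+ 1)           ≤⟨ ^-monoˡ (^-nonNeg (+-nonNeg 0≤1 2z≥0) 256) ([1+a]^≤2 (2ℚ * z) 2z≥0 256 256*2z≤½) (d ℕ.+ 1) ⟩
          2ℚ ^ℚ (d ℕ.+ 1)                               ∎

        X : ℚ
        X = binomial n s * (binomial n t * z ^ℚ t)

        X≥0 : 0ℚ ≤ X
        X≥0 = *-nonNeg (binomial≥0 n s) (*-nonNeg (binomial≥0 n t) (^-nonNeg z≥0 t))

        e = (L ℕ.+ 2) ℕ.* s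

        a^s : a ^ℚ s ≡ ½ ^ℚ e
        a^s = trans (sym (^-* ½ s (L ℕ.+ 2))) (cong (½ ^ℚ_) (ℕₚ.*-comm s (L ℕ.+ 2)))

        X*2^d*½^e≤4 : X * (2ℚ ^ℚ d * ½ ^ℚ e) ≤ ι 4
        X*2^d*½^e≤4 = *-cancelʳ (2ℚ ^ℚ d) (^-pos (ℚₚ.positive⁻¹ 2ℚ) d) (begin
          X * (2ℚ ^ℚ d * ½ ^ℚ e) * 2ℚ ^ℚ d
            ≡⟨ solve 5 (λ n m z p h → n :* (m :* z) :* (p :* h) :* p := n :* h :* (m :* (p :* p :* z))) refl
                 (binomial n s) (binomial n t) (z ^ℚ t) (2ℚ ^ℚ d) (½ ^ℚ e) ⟩
          binomial n s * ½ ^ℚ e * (binomial n t * (2ℚ ^ℚ d * 2ℚ ^ℚ d * z ^ℚ t))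
            ≡⟨ cong₂ (λ x y → binomial n s * x * (binomial n t * y)) (sym a^s)
                 (trans (cong (_* z ^ℚ t) (sym (^-+ 2ℚ d d))) (sym (^-distrib 2ℚ z t))) ⟩
          binomial n s * a ^ℚ s * (binomial n t * (2ℚ * z) ^ℚ t)
            ≤⟨ *-mono (*-nonNeg (binomial≥0 n t) (^-nonNeg 2z≥0 t)) 0≤2 small-sets large-sets ⟩
          2ℚ * 2ℚ ^ℚ (d ℕ.+ 1)
            ≡⟨ trans (cong (2ℚ *_) (^-+ 2ℚ d 1)) (solve 1 (λ p → con 2ℚ :* (p :* (con 2ℚ :* con 1ℚ)) := con (ι 4) :* p) refl (2ℚ ^ℚ d)) ⟩
          ι 4 * 2ℚ ^ℚ d ∎)

        2^L≤ : 2ℚ ^ℚ L ≤ 2ℚ ^ℚ d * ½ ^ℚ e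
        2^L≤ = begin
          2ℚ ^ℚ L                              ≡⟨ trans (cong (2ℚ ^ℚ L *_) (2^½^ e)) (ℚₚ.*-identityʳ (2ℚ ^ℚ L)) ⟨
          2ℚ ^ℚ L * (2ℚ ^ℚ e * ½ ^ℚ e)         ≡⟨ solve 3 (λ l e h → l :* (e :* h) := e :* l :* h) refl (2ℚ ^ℚ L) (2ℚ ^ℚ e) (½ ^ℚ e) ⟩
          2ℚ ^ℚ e * 2ℚ ^ℚ L * ½ ^ℚ e           ≡⟨ cong (_* ½ ^ℚ e) (^-+ 2ℚ e L) ⟨
          2ℚ ^ℚ (e ℕ.+ L) * ½ ^ℚ e             ≤⟨ *-monoˡ (½ ^ℚ e) (^-nonNeg 0≤½ e) (^-monoʳ 1≤2 budget) ⟩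
          2ℚ ^ℚ d * ½ ^ℚ e                     ∎

      gappy-bound : ℙ (graph n n) (gappy s t) * ι L ≤ ι 8
      gappy-bound = begin
        ℙ (graph n n) (gappy s t) * ι L
          ≤⟨ *-mono (ι≥0 L) (+-nonNeg X≥0 X≥0) union
               (≤-trans (ι-mono (ℕₚ.<⇒≤ (n<2^n L))) (≤-trans (≤-reflexive (ι-2^ L)) 2^L≤)) ⟩
        (X + X) * (2ℚ ^ℚ d * ½ ^ℚ e)
          ≡⟨ ℚₚ.*-distribʳ-+ (2ℚ ^ℚ d * ½ ^ℚ e) X X ⟩
        X * (2ℚ ^ℚ d * ½ ^ℚ e) + X * (2ℚ ^ℚ d * ½ ^ℚ e)
          ≤⟨ ℚₚ.+-mono-≤ X*2^d*½^e≤4 X*2^d*½^e≤4 ⟩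
        ι 8 ∎
        where
        union : ℙ (graph n n) (gappy s t) ≤ X + X
        union = begin
          ℙ (graph n n) (gappy s t)
            ≤⟨ 𝔼-mono (graph n n) (λ B → ind-∨ (hasGap s t B) (hasGap t s B)) ⟩
          𝔼 (graph n n) (λ B → ind (hasGap s t B) + ind (hasGap t s B))
            ≡⟨ 𝔼-+ (graph n n) (λ B → ind (hasGap s t B)) (λ B → ind (hasGap t s B)) ⟩
          ℙ (graph n n) (hasGap s t) + ℙ (graph n n) (hasGap t s)
            ≤⟨ ℚₚ.+-mono-≤ (gap-bound n n s t) (gap-bound n n t s) ⟩
          binomial n s * (binomial n t * (r ^ℚ t) ^ℚ s) + binomial n t * (binomial n s * (r ^ℚ s) ^ℚ t)
            ≡⟨ cong₂ _+_
                 (cong (λ w → binomial n s * (binomial n t * w))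
                   (trans (sym (^-* r s t)) (trans (cong (r ^ℚ_) (ℕₚ.*-comm s t)) (^-* r t s))))
                 (solve 3 (λ a b c → b :* (a :* c) := a :* (b :* c)) refl (binomial n s) (binomial n t) (z ^ℚ t)) ⟩
          X + X ∎

-- The Mercator series
module _ where
  open import Data.Rational using (_+_; _*_; _-_; -_; _≤_; _<_; ∣_∣)
  open import Data.Rational.Properties using (≤-trans; ≤-reflexive; ≤-refl)
  open +-*-Solver using (solve; _:+_; _:*_; :-_; _:-_; _:=_; con)

  2^*½^ : ∀ i → ι (2 ℕ.^ i) * ½ ^ℚ i ≡ 1ℚ
  2^*½^ i = trans (cong (_* ½ ^ℚ i) (ι-2^ i)) (2^½^ i)

  ½^≤1/ : ∀ i k → suc k ℕ.≤ 2 ℕ.^ i → ½ ^ℚ i ≤ 1/ k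
  ½^≤1/ i k h = subst (½ ^ℚ i ≤_) (ℚₚ.*-identityˡ (1/ k))
    (≤*1/ k (≤-trans (*-monoˡ (½ ^ℚ i) (^-nonNeg 0≤½ i) (ι-mono h)) (≤-reflexive (2^*½^ i))))

  1/≤½^ : ∀ i k → 2 ℕ.^ i ℕ.≤ suc k → 1/ k ≤ ½ ^ℚ i
  1/≤½^ i k h = subst (_≤ ½ ^ℚ i) (ℚₚ.*-identityˡ (1/ k))
    (*1/≤ k (≤-trans (≤-reflexive (sym (2^*½^ i))) (*-monoˡ (½ ^ℚ i) (^-nonNeg 0≤½ i) (ι-mono h))))

  2^suc : ∀ i → 2 ℕ.^ suc i ≡ 2 ℕ.^ i ℕ.+ 2 ℕ.^ i
  2^suc i = cong (2 ℕ.^ i ℕ.+_) (ℕₚ.+-identityʳ (2 ℕ.^ i))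

  module LogBounds (k : ℕ) where
    open ℚₚ.≤-Reasoning

    x : ℚ
    x = 1ℚ - 1/ k

    S u : ℕ → ℚ
    S = mercatorSum x
    u = mercatorTerm x

    x≥0 : 0ℚ ≤ x
    x≥0 = ≤⇒0≤- (1/-anti {0} {k} ℕ.z≤n)

    x≤1 : x ≤ 1ℚ
    x≤1 = x-y≤x 1ℚ (1/≥0 k)

    u≥0 : ∀ j → 0ℚ ≤ u j
    u≥0 j = *-nonNeg (^-nonNeg x≥0 (suc j)) (1/≥0 j)

    u≤1/ : ∀ j → u j ≤ 1/ j
    u≤1/ j = subst (u j ≤_) (ℚₚ.*-identityˡ (1/ j)) (*-monoˡ (1/ j) (1/≥0 j) (^≤1 x≥0 x≤1 (suc j)))

    S-mono : ∀ a j → S a ≤ S (j ℕ.+ a)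
    S-mono a zero    = ≤-refl
    S-mono a (suc j) = ≤-trans (S-mono a j) (x≤x+y (S (j ℕ.+ a)) (u≥0 (j ℕ.+ a)))

    S-mono′ : ∀ {a b} → a ℕ.≤ b → S a ≤ S b
    S-mono′ {a} {b} h = subst (λ z → S a ≤ S z) (ℕₚ.m∸n+n≡m h) (S-mono a (b ℕ.∸ a))

    S-lower : ∀ a j c → (∀ i → i ℕ.< j ℕ.+ a → c ≤ u i) → S a + ι j * c ≤ S (j ℕ.+ a)
    S-lower a zero    c h = ≤-reflexive (solve 2 (λ s c → s :+ con 0ℚ :* c := s) refl (S a) c)
    S-lower a (suc j) c h = begin
      S a + (1ℚ + ι j) * c       ≡⟨ solve 3 (λ s j c → s :+ (con 1ℚ :+ j) :* c := s :+ j :* c :+ c) refl (S a) (ι j) c ⟩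
      S a + ι j * c + c          ≤⟨ ℚₚ.+-mono-≤ (S-lower a j c λ i i< → h i (ℕₚ.m≤n⇒m≤1+n i<)) (h (j ℕ.+ a) ℕₚ.≤-refl) ⟩
      S (j ℕ.+ a) + u (j ℕ.+ a)  ∎

    S-upper : ∀ a j c → (∀ i → a ℕ.≤ i → u i ≤ c) → S (j ℕ.+ a) ≤ S a + ι j * c
    S-upper a zero    c h = ≤-reflexive (solve 2 (λ s c → s := s :+ con 0ℚ :* c) refl (S a) c)
    S-upper a (suc j) c h = begin
      S (j ℕ.+ a) + u (j ℕ.+ a)  ≤⟨ ℚₚ.+-mono-≤ (S-upper a j c h) (h (j ℕ.+ a) (ℕₚ.m≤n+m a j)) ⟩
      S a + ι j * c + c          ≡⟨ solve 3 (λ s j c → s :+ j :* c :+ c := s :+ (con 1ℚ :+ j) :* c) refl (S a) (ι j) c ⟩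
      S a + (1ℚ + ι j) * c       ∎

    ¼ : ℚ
    ¼ = ½ * ½

    module _ (l : ℕ) (2^l≤n : 2 ℕ.^ suc l ℕ.≤ suc k) where

      -- Bernoulli gives (1 - 1/n)^j ≥ 1 - j/n, and j is at most n/2. The Mercator series is thus
      -- comparable to the harmonic series up to this index.
      x^≥½ : ∀ j → j ℕ.≤ 2 ℕ.^ l → ½ ≤ x ^ℚ j
      x^≥½ j j≤ = ≤-trans
        (subst (_≤ 1ℚ - ι j * 1/ k) (solve 0 (con 1ℚ :- con ½ := con ½) refl)
          (ℚₚ.+-monoʳ-≤ 1ℚ (ℚₚ.neg-antimono-≤ (*1/≤ k (subst (_≤ ι (suc k) * ½)
            (trans (cong (_* ½) (ι-+ j j)) (solve 1 (λ j → (j :+ j) :* con ½ := j) refl (ι j)))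
            (*-monoˡ ½ 0≤½ (ι-mono (ℕₚ.≤-trans (ℕₚ.≤-trans (ℕₚ.+-mono-≤ j≤ j≤)
              (ℕₚ.≤-reflexive (sym (2^suc l)))) 2^l≤n))))))))
        (bernoulli (1/ k) (1/-anti {0} {k} ℕ.z≤n) j)

      -- Dyadic blocks of the harmonic series: the 2^i terms of a block are each at least ½ ·
      -- 2^-(i+1), so a block adds at least ¼.
      S-2^-lower : ∀ i → i ℕ.≤ l → ι (suc i) * ¼ ≤ S (2 ℕ.^ i)
      S-2^-lower zero i≤l = ≤-trans (ℚₚ.≤ᵇ⇒≤ _) (≤-trans (x^≥½ 1 (ℕₚ.m^n>0 2 l))
        (≤-reflexive (solve 1 (λ y → y := con 0ℚ :+ y :* con (1/ 0)) refl (x ^ℚ 1))))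
      S-2^-lower (suc i) i≤l = begin
        ι (suc (suc i)) * ¼                        ≡⟨ solve 1 (λ i → (con 1ℚ :+ (con 1ℚ :+ i)) :* con ¼ := (con 1ℚ :+ i) :* con ¼ :+ con 1ℚ :* con ¼) refl (ι i) ⟩
        ι (suc i) * ¼ + 1ℚ * ¼                     ≤⟨ ℚₚ.+-monoˡ-≤ (1ℚ * ¼) (S-2^-lower i (ℕₚ.≤-trans (ℕₚ.n≤1+n i) i≤l)) ⟩
        S (2 ℕ.^ i) + 1ℚ * ¼                       ≡⟨ cong (λ z → S (2 ℕ.^ i) + z * ¼) (2^*½^ i) ⟨
        S (2 ℕ.^ i) + ι (2 ℕ.^ i) * ½ ^ℚ i * ¼     ≡⟨ cong (S (2 ℕ.^ i) +_) (solve 2 (λ a b → a :* b :* con ¼ := a :* (con ½ :* (con ½ :* b))) refl (ι (2 ℕ.^ i)) (½ ^ℚ i)) ⟩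
        S (2 ℕ.^ i) + ι (2 ℕ.^ i) * (½ * ½ ^ℚ suc i) ≤⟨ S-lower (2 ℕ.^ i) (2 ℕ.^ i) (½ * ½ ^ℚ suc i) term ⟩
        S (2 ℕ.^ i ℕ.+ 2 ℕ.^ i)                    ≡⟨ cong S (2^suc i) ⟨
        S (2 ℕ.^ suc i)                            ∎
        where
        term : ∀ j → j ℕ.< 2 ℕ.^ i ℕ.+ 2 ℕ.^ i → ½ * ½ ^ℚ suc i ≤ u j
        term j j< = *-mono (^-nonNeg 0≤½ (suc i)) (^-nonNeg x≥0 (suc j))
          (x^≥½ (suc j) (ℕₚ.≤-trans j≤ (ℕₚ.^-monoʳ-≤ 2 i≤l))) (½^≤1/ (suc i) j j≤)
          where
          j≤ : suc j ℕ.≤ 2 ℕ.^ suc i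
          j≤ = ℕₚ.≤-trans j< (ℕₚ.≤-reflexive (sym (2^suc i)))

      log-lower : ∀ N → 2 ℕ.^ l ℕ.≤ N → ι (suc l) * ¼ ≤ S N
      log-lower N h = ≤-trans (S-2^-lower l ℕₚ.≤-refl) (S-mono′ h)

    S-2^-upper : ∀ i → S (2 ℕ.^ i) ≤ ι (suc i)
    S-2^-upper zero = ≤-trans (≤-reflexive (solve 1 (λ x → con 0ℚ :+ x :* con 1ℚ :* con (1/ 0) := x) refl x))
      (≤-trans x≤1 (≤-reflexive (sym (ℚₚ.+-identityʳ 1ℚ))))
    S-2^-upper (suc i) = begin
      S (2 ℕ.^ suc i)                        ≡⟨ cong S (2^suc i) ⟩
      S (2 ℕ.^ i ℕ.+ 2 ℕ.^ i)                ≤⟨ S-upper (2 ℕ.^ i) (2 ℕ.^ i) (½ ^ℚ i)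
                                                  (λ j h → ≤-trans (u≤1/ j) (1/≤½^ i j (ℕₚ.m≤n⇒m≤1+n h))) ⟩
      S (2 ℕ.^ i) + ι (2 ℕ.^ i) * ½ ^ℚ i     ≡⟨ cong (S (2 ℕ.^ i) +_) (2^*½^ i) ⟩
      S (2 ℕ.^ i) + 1ℚ                       ≤⟨ ℚₚ.+-monoˡ-≤ 1ℚ (S-2^-upper i) ⟩
      ι (suc i) + 1ℚ                         ≡⟨ ℚₚ.+-comm (ι (suc i)) 1ℚ ⟩
      ι (suc (suc i))                        ∎

    n = ι (suc k)

    u-suc : ∀ j → u (suc j) ≤ x * u j
    u-suc j = ≤-trans (*-monoʳ (x ^ℚ suc (suc j)) (^-nonNeg x≥0 (suc (suc j))) (1/-anti (ℕₚ.n≤1+n j)))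
      (≤-reflexive (ℚₚ.*-assoc x (x ^ℚ suc j) (1/ j)))

    -- From any index on, the terms fall at least as fast as a geometric series of ratio 1 - 1/n,
    -- whose sum is n times its first term. So `S a + n * u a` bounds all later partial sums.
    tail-decreasing : ∀ a j → S (j ℕ.+ a) + n * u (j ℕ.+ a) ≤ S a + n * u a
    tail-decreasing a zero    = ≤-refl
    tail-decreasing a (suc j) = begin
      S b + u b + n * u (suc b)        ≤⟨ ℚₚ.+-monoʳ-≤ (S b + u b) (*-monoʳ n (ι≥0 (suc k)) (u-suc b)) ⟩
      S b + u b + n * (x * u b)        ≡⟨ solve 4 (λ s u n v → s :+ u :+ n :* ((con 1ℚ :- v) :* u) := s :+ n :* u :+ (con 1ℚ :- n :* v) :* u) refl (S b) (u b) n (1/ k) ⟩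
      S b + n * u b + (1ℚ - n * 1/ k) * u b  ≡⟨ cong (λ z → S b + n * u b + (1ℚ - z) * u b) (ι*1/ k) ⟩
      S b + n * u b + (1ℚ - 1ℚ) * u b  ≡⟨ solve 2 (λ s u → s :+ (con 1ℚ :- con 1ℚ) :* u := s) refl (S b + n * u b) (u b) ⟩
      S b + n * u b                    ≤⟨ tail-decreasing a j ⟩
      S a + n * u a                    ∎
      where b = j ℕ.+ a

    -- Up to 2^L the dyadic blocks add at most 1 each; as 2^L ≥ n, the geometric tail after that
    -- adds at most n · (1/n) = 1.
    log-upper : ∀ L → suc k ℕ.≤ 2 ℕ.^ L → ∀ N → S N ≤ ι (suc (suc L))
    log-upper L n≤ N = ≤-trans (S-mono N M) (≤-trans (subst (λ z → S z ≤ S M + 1ℚ) (ℕₚ.+-comm N M) bound)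
        (≤-trans (ℚₚ.+-monoˡ-≤ 1ℚ (S-2^-upper L)) (≤-reflexive (ℚₚ.+-comm (ι (suc L)) 1ℚ))))
      where
      M = 2 ℕ.^ L
      bound : S (N ℕ.+ M) ≤ S M + 1ℚ
      bound = begin
        S (N ℕ.+ M)                            ≤⟨ x≤x+y _ (*-nonNeg (ι≥0 (suc k)) (u≥0 (N ℕ.+ M))) ⟩
        S (N ℕ.+ M) + n * u (N ℕ.+ M)          ≤⟨ tail-decreasing M N ⟩
        S M + n * u M                          ≤⟨ ℚₚ.+-monoʳ-≤ (S M) (*-monoʳ n (ι≥0 (suc k)) (≤-trans (u≤1/ M) (1/-anti (ℕₚ.≤-trans (ℕₚ.n≤1+n k) n≤)))) ⟩
        S M + n * 1/ k                         ≡⟨ cong (S M +_) (ι*1/ k) ⟩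
        S M + 1ℚ                               ∎

-- From rational to real edge probabilities
module _ where
  open import Data.Rational using (_+_; _*_; _-_; -_; _≤_; _<_; ∣_∣)
  open import Data.Rational.Properties using (≤-trans; ≤-reflexive; ≤-refl)
  open +-*-Solver using (solve; _:+_; _:*_; :-_; _:-_; _:=_; con)
  open ℝ

  ∣∣-≤ : ∀ {x ε} → x ≤ ε → - x ≤ ε → ∣ x ∣ ≤ ε
  ∣∣-≤ {x} a b with ℚₚ.∣p∣≡p∨∣p∣≡-p x
  ... | inj₁ e = ≤-trans (≤-reflexive e) a
  ... | inj₂ e = ≤-trans (≤-reflexive e) b

  x≤∣x∣ : ∀ x → x ≤ ∣ x ∣
  x≤∣x∣ x with ℚₚ.≤-total 0ℚ x
  ... | inj₁ 0≤x = ≤-reflexive (sym (ℚₚ.0≤p⇒∣p∣≡p 0≤x))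
  ... | inj₂ x≤0 = ≤-trans x≤0 (ℚₚ.0≤∣p∣ x)

  -x≤∣x∣ : ∀ x → - x ≤ ∣ x ∣
  -x≤∣x∣ x = subst (- x ≤_) (ℚₚ.∣-p∣≡∣p∣ x) (x≤∣x∣ (- x))

  -- Lipschitz continuity alone does not pass to products, so boundedness is carried along, with the
  -- same `K`. The interval [-2, 2] leaves room for terms of `p` outside [0, 1].
  record Tame (f : ℚ → ℚ) : Set where
    field
      K         : ℚ
      K≥0       : 0ℚ ≤ K
      bounded   : ∀ x → ∣ x ∣ ≤ 2ℚ → ∣ f x ∣ ≤ K
      lipschitz : ∀ x y → ∣ x ∣ ≤ 2ℚ → ∣ y ∣ ≤ 2ℚ → ∣ f x - f y ∣ ≤ K * ∣ x - y ∣

  open Tame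

  tame-const : ∀ c → Tame (λ _ → c)
  tame-const c = record
    { K = ∣ c ∣ ; K≥0 = ℚₚ.0≤∣p∣ c ; bounded = λ _ _ → ≤-refl
    ; lipschitz = λ x y _ _ → subst (_≤ ∣ c ∣ * ∣ x - y ∣) (cong ∣_∣ (sym (ℚₚ.+-inverseʳ c)))
        (*-nonNeg (ℚₚ.0≤∣p∣ c) (ℚₚ.0≤∣p∣ (x - y))) }

  tame-id : Tame (λ x → x)
  tame-id = record
    { K = 2ℚ ; K≥0 = 0≤2 ; bounded = λ _ h → h
    ; lipschitz = λ x y _ _ → subst (_≤ 2ℚ * ∣ x - y ∣) (ℚₚ.*-identityˡ ∣ x - y ∣)
        (*-monoˡ ∣ x - y ∣ (ℚₚ.0≤∣p∣ (x - y)) 1≤2) }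

  tame-+ : ∀ {f g} → Tame f → Tame g → Tame (λ x → f x + g x)
  tame-+ {f} {g} F G = record
    { K = K F + K G ; K≥0 = +-nonNeg (K≥0 F) (K≥0 G)
    ; bounded = λ x h → ≤-trans (ℚₚ.∣p+q∣≤∣p∣+∣q∣ (f x) (g x)) (ℚₚ.+-mono-≤ (bounded F x h) (bounded G x h))
    ; lipschitz = λ x y hx hy → begin
        ∣ f x + g x - (f y + g y) ∣            ≡⟨ cong ∣_∣ (solve 4 (λ a b c d → a :+ b :- (c :+ d) := (a :- c) :+ (b :- d)) refl (f x) (g x) (f y) (g y)) ⟩
        ∣ (f x - f y) + (g x - g y) ∣          ≤⟨ ℚₚ.∣p+q∣≤∣p∣+∣q∣ (f x - f y) (g x - g y) ⟩
        ∣ f x - f y ∣ + ∣ g x - g y ∣          ≤⟨ ℚₚ.+-mono-≤ (lipschitz F x y hx hy) (lipschitz G x y hx hy) ⟩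
        K F * ∣ x - y ∣ + K G * ∣ x - y ∣      ≡⟨ ℚₚ.*-distribʳ-+ ∣ x - y ∣ (K F) (K G) ⟨
        (K F + K G) * ∣ x - y ∣                ∎ }
    where open ℚₚ.≤-Reasoning

  tame-* : ∀ {f g} → Tame f → Tame g → Tame (λ x → f x * g x)
  tame-* {f} {g} F G = record
    { K = K F * K G + K F * K G ; K≥0 = +-nonNeg KK≥0 KK≥0
    ; bounded = λ x h → ≤-trans (bound x h) (x≤x+y _ KK≥0)
    ; lipschitz = λ x y hx hy → begin
        ∣ f x * g x - f y * g y ∣
          ≡⟨ cong ∣_∣ (solve 4 (λ a b c d → a :* b :- c :* d := a :* (b :- d) :+ (a :- c) :* d) refl (f x) (g x) (f y) (g y)) ⟩
        ∣ f x * (g x - g y) + (f x - f y) * g y ∣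
          ≤⟨ ℚₚ.∣p+q∣≤∣p∣+∣q∣ (f x * (g x - g y)) ((f x - f y) * g y) ⟩
        ∣ f x * (g x - g y) ∣ + ∣ (f x - f y) * g y ∣
          ≡⟨ cong₂ _+_ (ℚₚ.∣p*q∣≡∣p∣*∣q∣ (f x) (g x - g y)) (ℚₚ.∣p*q∣≡∣p∣*∣q∣ (f x - f y) (g y)) ⟩
        ∣ f x ∣ * ∣ g x - g y ∣ + ∣ f x - f y ∣ * ∣ g y ∣
          ≤⟨ ℚₚ.+-mono-≤ (*-mono (ℚₚ.0≤∣p∣ (g x - g y)) (K≥0 F) (bounded F x hx) (lipschitz G x y hx hy))
               (*-mono (ℚₚ.0≤∣p∣ (g y)) (*-nonNeg (K≥0 F) (ℚₚ.0≤∣p∣ (x - y))) (lipschitz F x y hx hy) (bounded G y hy)) ⟩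
        K F * (K G * ∣ x - y ∣) + K F * ∣ x - y ∣ * K G
          ≡⟨ solve 3 (λ a b d → a :* (b :* d) :+ a :* d :* b := (a :* b :+ a :* b) :* d) refl (K F) (K G) ∣ x - y ∣ ⟩
        (K F * K G + K F * K G) * ∣ x - y ∣ ∎ }
    where
    open ℚₚ.≤-Reasoning
    KK≥0 : 0ℚ ≤ K F * K G
    KK≥0 = *-nonNeg (K≥0 F) (K≥0 G)
    bound : ∀ x → ∣ x ∣ ≤ 2ℚ → ∣ f x * g x ∣ ≤ K F * K G
    bound x h = subst (_≤ K F * K G) (sym (ℚₚ.∣p*q∣≡∣p∣*∣q∣ (f x) (g x)))
      (*-mono (ℚₚ.0≤∣p∣ (g x)) (K≥0 F) (bounded F x h) (bounded G x h))

  coinWeight : ℚ → Bool → ℚ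
  coinWeight q b = if b then q else 1ℚ - q

  tame-coin : ∀ b → Tame (λ q → coinWeight q b)
  tame-coin true  = tame-id
  tame-coin false = record
    { K = ι 3 ; K≥0 = ι≥0 3
    ; bounded = λ x h → ≤-trans (ℚₚ.∣p+q∣≤∣p∣+∣q∣ 1ℚ (- x)) (ℚₚ.+-monoʳ-≤ 1ℚ (≤-trans (≤-reflexive (ℚₚ.∣-p∣≡∣p∣ x)) h))
    ; lipschitz = λ x y _ _ → subst (_≤ ι 3 * ∣ x - y ∣)
        (trans (sym (ℚₚ.∣-p∣≡∣p∣ (x - y))) (cong ∣_∣ (solve 2 (λ x y → :- (x :- y) := con 1ℚ :- x :- (con 1ℚ :- y)) refl x y)))
        (≤-trans (≤-reflexive (sym (ℚₚ.*-identityˡ ∣ x - y ∣)))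
          (*-monoˡ ∣ x - y ∣ (ℚₚ.0≤∣p∣ (x - y)) (x≤x+y 1ℚ (ι≥0 2)))) }

  tame-∏ : ∀ {A : Set} {k} {w : ℚ → A → ℚ} → (∀ a → Tame (λ q → w q a)) → (v : Vec A k) → Tame (λ q → ∏ (w q) v)
  tame-∏ h []      = tame-const 1ℚ
  tame-∏ h (a ∷ v) = tame-* (h a) (tame-∏ h v)

  tame-∑ : ∀ {A : Set} {f : ℚ → A → ℚ} → (∀ a → Tame (λ q → f q a)) → (as : List A) → Tame (λ q → ∑ as (f q))
  tame-∑ h []       = tame-const 0ℚ
  tame-∑ h (a ∷ as) = tame-+ (h a) (tame-∑ h as)

  ∑-filter : ∀ {A : Set} (P : A → Bool) (as : List A) (f : A → ℚ) →
    ∑ (List.filterᵇ P as) f ≡ ∑ as (λ a → f a * ind (P a))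
  ∑-filter P []       f = refl
  ∑-filter P (a ∷ as) f with P a
  ... | true  = cong₂ _+_ (sym (ℚₚ.*-identityʳ (f a))) (∑-filter P as f)
  ... | false = trans (∑-filter P as f)
    (sym (trans (cong (_+ ∑ as (λ a → f a * ind (P a))) (ℚₚ.*-zeroʳ (f a))) (ℚₚ.+-identityˡ _)))

  module _ {n m : ℕ} where

    graphWeight : ℚ → BipartiteGraph n m → ℚ
    graphWeight q = ∏ (∏ (coinWeight q))

    Prℚ : ℚ → (BipartiteGraph n m → Bool) → ℚ
    Prℚ q S = ∑ (allBipartiteGraphs n m) (λ B → graphWeight q B * ind (S B))

    tame-Pr : ∀ S → Tame (λ q → Prℚ q S)
    tame-Pr S = tame-∑ (λ B → tame-* (tame-∏ (tame-∏ tame-coin) B) (tame-const (ind (S B)))) (allBipartiteGraphs n m)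

    -- Sums and products of reals act termwise, so each term of a real probability is the same
    -- polynomial evaluated at a term of `p`.
    seq-Pr : ∀ p S k → seq (Pr {n} {m} p S) k ≡ Prℚ (seq p k) S
    seq-Pr p S k = trans (go (List.filterᵇ S (allBipartiteGraphs n m)))
      (∑-filter S (allBipartiteGraphs n m) (graphWeight (seq p k)))
      where
      w : Bool → ℝ
      w b = if b then p else 1ℝ -ℝ p
      prod : List Bool → ℚ
      prod = λ l → seq (productℝ (List.map w l)) k
      prod-++ : ∀ l l′ → prod (l ++ l′) ≡ prod l * prod l′
      prod-++ []      l′ = sym (ℚₚ.*-identityˡ (prod l′))
      prod-++ (b ∷ l) l′ = trans (cong (seq (w b) k *_) (prod-++ l l′)) (sym (ℚₚ.*-assoc (seq (w b) k) (prod l) (prod l′)))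
      prod-row : ∀ {m} (r : Vec Bool m) → prod (Vec.toList r) ≡ ∏ (coinWeight (seq p k)) r
      prod-row []          = refl
      prod-row (true  ∷ r) = cong (seq p k *_) (prod-row r)
      prod-row (false ∷ r) = cong ((1ℚ - seq p k) *_) (prod-row r)
      weight≡ : ∀ {n} (B : BipartiteGraph n m) → seq (weight p B) k ≡ ∏ (∏ (coinWeight (seq p k))) B
      weight≡ []      = refl
      weight≡ (r ∷ B) = trans (cong prod (Vecₚ.toList-++ r (Vec.concat B)))
        (trans (prod-++ (Vec.toList r) (Vec.toList (Vec.concat B))) (cong₂ _*_ (prod-row r) (weight≡ B)))
      go : ∀ Bs → seq (sumℝ (List.map (weight p) Bs)) k ≡ ∑ Bs (graphWeight (seq p k))
      go []       = refl
      go (B ∷ Bs) = cong₂ _+_ (weight≡ B) (go Bs)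

  -- `upper` and `lower` carry the bounds on a term of `p` over to the point `c`, at which the
  -- weights form a distribution.
  record Clamp (q η : ℚ) : Set where
    field
      c     : ℚ
      c≥0   : 0ℚ ≤ c
      c≤1   : c ≤ 1ℚ
      close : ∣ q - c ∣ ≤ η
      upper : ∀ u → 0ℚ ≤ u → q ≤ u → c ≤ u
      lower : ∀ l → l ≤ 1ℚ → l ≤ q → l ≤ c

  clamp : ∀ q η → 0ℚ ≤ η → 0ℚ ≤ q + η → q ≤ 1ℚ + η → Clamp q η
  clamp q η η≥0 lo hi with ℚₚ.≤-total 0ℚ q | ℚₚ.≤-total q 1ℚ
  ... | inj₂ q≤0 | _ = record
    { c = 0ℚ ; c≥0 = ≤-refl ; c≤1 = 0≤1
    ; close = ∣∣-≤ (≤-trans (≤-reflexive (ℚₚ.+-identityʳ q)) (≤-trans q≤0 η≥0))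
        (0≤-⇒≤ (subst (0ℚ ≤_) (solve 2 (λ q η → q :+ η := η :- (:- (q :- con 0ℚ))) refl q η) lo))
    ; upper = λ u u≥0 _ → u≥0 ; lower = λ l _ l≤q → ≤-trans l≤q q≤0 }
  ... | inj₁ q≥0 | inj₁ q≤1 = record
    { c = q ; c≥0 = q≥0 ; c≤1 = q≤1
    ; close = subst (_≤ η) (cong ∣_∣ (sym (ℚₚ.+-inverseʳ q))) η≥0
    ; upper = λ u _ q≤u → q≤u ; lower = λ l _ l≤q → l≤q }
  ... | inj₁ q≥0 | inj₂ 1≤q = record
    { c = 1ℚ ; c≥0 = 0≤1 ; c≤1 = ≤-refl
    ; close = ∣∣-≤ (0≤-⇒≤ (subst (0ℚ ≤_) (solve 2 (λ q η → con 1ℚ :+ η :- q := η :- (q :- con 1ℚ)) refl q η) (≤⇒0≤- hi)))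
        (≤-trans (0≤-⇒≤ (subst (0ℚ ≤_) (solve 1 (λ q → q :- con 1ℚ := con 0ℚ :- (:- (q :- con 1ℚ))) refl q) (≤⇒0≤- 1≤q))) η≥0)
    ; upper = λ u _ q≤u → ≤-trans 1≤q q≤u ; lower = λ l l≤1 _ → l≤1 }

  -- The terms of p may leave [0 , 1]; the probability of S is continuous in p, so it can be computed
  -- at the nearest point c of [0 , 1].
  Pr-lower-bound : ∀ {n m} p → 0ℝ ≤ℝ p → p ≤ℝ 1ℝ → (S : BipartiteGraph n m → Bool) → ∀ δ N →
    (∀ k → N ℕ.≤ k → ∀ {η} (C : Clamp (seq p k) η) → let open Clamp C in
      ℙ (Coins.graph c c≥0 c≤1 n m) (not ∘ S) ≤ δ) →
    ∀ ε → (∃[ N′ ] ∀ k → N′ ℕ.≤ k → δ ≤ seq ε k) → 1ℝ -ℝ ε ≤ℝ Pr p S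
  Pr-lower-bound {n} {m} p p≥0 p≤1 S δ N fail ε (N′ , δ≤ε) ξ ξ>0 =
    let j , 1/j≤ξ = archimedean ξ ξ>0
        K₁ , K≤K₁ = upper-ι (K F)
        -- Small enough for `K F * η ≤ ξ`; being at most 1, it also keeps the terms of `p` in
        -- [-2, 2].
        η = 1/ j * 1/ K₁
        η>0 = *-pos (1/>0 j) (1/>0 K₁)
        N₁ , lo = p≥0 η η>0
        N₂ , hi = p≤1 η η>0
    in N ℕ.⊔ N′ ℕ.⊔ (N₁ ℕ.⊔ N₂) , λ k h →
      let hN  = ℕₚ.m⊔n≤o⇒m≤o N N′ (ℕₚ.m⊔n≤o⇒m≤o (N ℕ.⊔ N′) (N₁ ℕ.⊔ N₂) h)
          hN′ = ℕₚ.m⊔n≤o⇒n≤o N N′ (ℕₚ.m⊔n≤o⇒m≤o (N ℕ.⊔ N′) (N₁ ℕ.⊔ N₂) h)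
          h₁  = ℕₚ.m⊔n≤o⇒m≤o N₁ N₂ (ℕₚ.m⊔n≤o⇒n≤o (N ℕ.⊔ N′) (N₁ ℕ.⊔ N₂) h)
          h₂  = ℕₚ.m⊔n≤o⇒n≤o N₁ N₂ (ℕₚ.m⊔n≤o⇒n≤o (N ℕ.⊔ N′) (N₁ ℕ.⊔ N₂) h)
          η≥0 = ℚₚ.<⇒≤ η>0
          C = clamp (seq p k) η η≥0 (lo k h₁) (hi k h₂)
          open Clamp C
          η≤1 : η ≤ 1ℚ
          η≤1 = *-mono (1/≥0 K₁) 0≤1 (1/-anti {0} {j} ℕ.z≤n) (1/-anti {0} {K₁} ℕ.z≤n)
          ∣c∣≤2 : ∣ c ∣ ≤ 2ℚ
          ∣c∣≤2 = ≤-trans (≤-reflexive (ℚₚ.0≤p⇒∣p∣≡p c≥0)) (≤-trans c≤1 1≤2)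
          ∣p∣≤2 : ∣ seq p k ∣ ≤ 2ℚ
          ∣p∣≤2 = begin
            ∣ seq p k ∣                ≡⟨ cong ∣_∣ (solve 2 (λ p c → p := (p :- c) :+ c) refl (seq p k) c) ⟩
            ∣ (seq p k - c) + c ∣      ≤⟨ ℚₚ.∣p+q∣≤∣p∣+∣q∣ (seq p k - c) c ⟩
            ∣ seq p k - c ∣ + ∣ c ∣    ≤⟨ ℚₚ.+-mono-≤ (≤-trans close η≤1) (≤-trans (≤-reflexive (ℚₚ.0≤p⇒∣p∣≡p c≥0)) c≤1) ⟩
            2ℚ                         ∎
          Kη≤ξ : K F * η ≤ ξ
          Kη≤ξ = begin
            K F * (1/ j * 1/ K₁)         ≤⟨ *-monoˡ η η≥0 K≤K₁ ⟩
            ι (suc K₁) * (1/ j * 1/ K₁)  ≡⟨ solve 3 (λ a b c → a :* (b :* c) := a :* c :* b) refl (ι (suc K₁)) (1/ j) (1/ K₁) ⟩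
            ι (suc K₁) * 1/ K₁ * 1/ j    ≡⟨ cong (_* 1/ j) (ι*1/ K₁) ⟩
            1ℚ * 1/ j                    ≡⟨ ℚₚ.*-identityˡ (1/ j) ⟩
            1/ j                         ≤⟨ 1/j≤ξ ⟩
            ξ                            ∎
      in begin
        1ℚ - seq ε k
          ≤⟨ ℚₚ.+-monoʳ-≤ 1ℚ (ℚₚ.neg-antimono-≤ (≤-trans (fail k hN C) (δ≤ε k hN′))) ⟩
        1ℚ - ℙ (Coins.graph c c≥0 c≤1 n m) (not ∘ S)
          ≡⟨ cong (λ z → 1ℚ - z) (ℙ-not (Coins.graph c c≥0 c≤1 n m) S) ⟩
        1ℚ - (1ℚ - Prℚ c S)
          ≡⟨ solve 2 (λ x y → con 1ℚ :- (con 1ℚ :- x) := y :+ (:- (y :- x))) refl (Prℚ c S) (Prℚ (seq p k) S) ⟩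
        Prℚ (seq p k) S + - (Prℚ (seq p k) S - Prℚ c S)
          ≤⟨ ℚₚ.+-monoʳ-≤ (Prℚ (seq p k) S) (≤-trans (-x≤∣x∣ _) (≤-trans (lipschitz F (seq p k) c ∣p∣≤2 ∣c∣≤2)
               (≤-trans (*-monoʳ (K F) (K≥0 F) close) Kη≤ξ))) ⟩
        Prℚ (seq p k) S + ξ
          ≡⟨ cong (_+ ξ) (seq-Pr p S k) ⟨
        seq (Pr p S) k + ξ ∎
    where
    open ℚₚ.≤-Reasoning
    F = tame-Pr S
    upper-ι : ∀ x → ∃[ k ] x ≤ ι (suc k)
    upper-ι x with 0ℚ ℚₚ.<? x
    ... | no ¬x>0 = 0 , ≤-trans (ℚₚ.≮⇒≥ ¬x>0) (ι≥0 1)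
    ... | yes x>0 = let k , h = archimedean (recip x x>0) (recip>0 x x>0) in
        k , subst₂ _≤_ (ℚₚ.*-identityˡ x) refl (bound k h)
      where
      bound : ∀ k → 1/ k ≤ recip x x>0 → 1ℚ * x ≤ ι (suc k)
      bound k h = begin
        1ℚ * x                      ≡⟨ cong (_* x) (ι*1/ k) ⟨
        ι (suc k) * 1/ k * x        ≤⟨ *-monoˡ x (ℚₚ.<⇒≤ x>0) (*-monoʳ (ι (suc k)) (ι≥0 (suc k)) h) ⟩
        ι (suc k) * recip x x>0 * x ≡⟨ ℚₚ.*-assoc (ι (suc k)) (recip x x>0) x ⟩
        ι (suc k) * (recip x x>0 * x) ≡⟨ cong (ι (suc k) *_) (ℚₚ.*-inverseˡ x {{ℚ.>-nonZero x>0}}) ⟩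
        ι (suc k) * 1ℚ              ≡⟨ ℚₚ.*-identityʳ (ι (suc k)) ⟩
        ι (suc k)                   ∎

-- The lower bound
module _ where
  open import Data.Rational using (_+_; _*_; _-_; -_; _≤_; _<_; ∣_∣)
  open import Data.Rational.Properties using (≤-trans; ≤-reflexive; ≤-refl)
  open +-*-Solver using (solve; _:+_; _:*_; :-_; _:-_; _:=_; con)
  open ℝ

  ilog : ∀ b → 2 ℕ.≤ b → ∀ n → 1 ℕ.≤ n → ∃[ e ] b ℕ.^ e ℕ.≤ n × n ℕ.< b ℕ.^ suc e
  ilog b 2≤b (suc zero) _ = 0 , ℕₚ.≤-refl , ℕₚ.≤-trans 2≤b (ℕₚ.≤-reflexive (sym (ℕₚ.*-identityʳ b)))
  ilog b 2≤b (suc (suc n)) _ = go (ilog b 2≤b (suc n) (ℕ.s≤s ℕ.z≤n))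
    where
    go : ∃[ e ] b ℕ.^ e ℕ.≤ suc n × suc n ℕ.< b ℕ.^ suc e →
      ∃[ e ] b ℕ.^ e ℕ.≤ suc (suc n) × suc (suc n) ℕ.< b ℕ.^ suc e
    go (e , lo , hi) with suc (suc n) ℕ.<? b ℕ.^ suc e
    ... | yes hi′ = e , ℕₚ.m≤n⇒m≤1+n lo , hi′
    ... | no ¬hi  = suc e , ℕₚ.≮⇒≥ ¬hi , ℕₚ.<-≤-trans (ℕ.s≤s hi)
      (ℕₚ.≤-trans (ℕₚ.+-mono-≤ (ℕₚ.≤-trans (ℕ.s≤s ℕ.z≤n) hi) (ℕₚ.≤-reflexive (sym (ℕₚ.+-identityʳ _))))
        (ℕₚ.*-monoˡ-≤ (b ℕ.^ suc e) 2≤b))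

  ilog-large : ∀ b → 2 ℕ.≤ b → ∀ {e₀ e n} → b ℕ.^ suc e₀ ℕ.≤ n → n ℕ.< b ℕ.^ suc e → e₀ ℕ.≤ e
  ilog-large b@(suc _) 2≤b {e₀} {e} lo hi = ℕₚ.≮⇒≥ λ e<e₀ →
    ℕₚ.<⇒≱ hi (ℕₚ.≤-trans (ℕₚ.^-monoʳ-≤ b (ℕₚ.m≤n⇒m≤1+n e<e₀)) lo)

  square-+ : ∀ a b → (a + b) * (a + b) ≤ 2ℚ * (a * a) + 2ℚ * (b * b)
  square-+ a b = 0≤-⇒≤ (subst (0ℚ ≤_)
    (solve 2 (λ a b → (a :- b) :* (a :- b)
      := con 2ℚ :* (a :* a) :+ con 2ℚ :* (b :* b) :- (a :+ b) :* (a :+ b)) refl a b)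
    (square-nonNeg (a - b)))

  -- The approximate root errs from below; `IsRoot` promises this only for a positive root, and at 0
  -- the bound is the assumption `0ℚ ≤ x`.
  sqrt-square : ∀ k {x} → 0ℚ ≤ x → sqrtℚ k x * sqrtℚ k x ≤ x
  sqrt-square k {x} x≥0 = go (0ℚ ℚₚ.<? s)
    where
    open IsRoot (proj₂ (approxRoot k x))
    s = sqrtℚ k x
    go : Dec (0ℚ < s) → s * s ≤ x
    go (yes s>0) = below s>0
    go (no ¬s>0) = ≤-trans (*-monoʳ s s≥0 (ℚₚ.≮⇒≥ ¬s>0)) (≤-trans (≤-reflexive (ℚₚ.*-zeroʳ s)) x≥0)

  -- Turns a failure bound of the form a/J into one below a given `δ` as soon as J ≥ a (k + 1).
  scaled-≤ : ∀ {x δ} k → 1/ k ≤ δ → ∀ {J} a → a ℕ.* suc k ℕ.≤ J → 0 ℕ.< J → x * ι J ≤ ι a → x ≤ δ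
  scaled-≤ {x} {δ} k h {J@(suc J′)} a a≤J _ x≤ = *-cancelʳ (ι J) (ι>0 J′) (begin
    x * ι J                      ≤⟨ x≤ ⟩
    ι a                          ≡⟨ ℚₚ.*-identityʳ (ι a) ⟨
    ι a * 1ℚ                     ≡⟨ cong (ι a *_) (ι*1/ k) ⟨
    ι a * (ι (suc k) * 1/ k)     ≡⟨ trans (sym (ℚₚ.*-assoc (ι a) (ι (suc k)) (1/ k))) (cong (_* 1/ k) (sym (ι-* a (suc k)))) ⟩
    ι (a ℕ.* suc k) * 1/ k       ≤⟨ *-mono (1/≥0 k) (ι≥0 J) (ι-mono a≤J) h ⟩
    ι J * δ                      ≡⟨ ℚₚ.*-comm (ι J) δ ⟩
    δ * ι J                      ∎)
    where open ℚₚ.≤-Reasoning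

  seq-threshold : ∀ m k → seq (threshold (suc m)) k ≡ sqrtℚ k (LogBounds.S m k * 1/ m)
  seq-threshold m k = refl

  -- With log n ≤ 2 (J + 2), the value 2^-5 makes the main part 64 n · 2 (c₁ s)² at most (J + 2)/4,
  -- where s is the threshold; the remaining room absorbs the slack `e`.
  c₁ : ℝ
  c₁ = fromℚ (½ ^ℚ 5)

  c₁>0 : 0ℝ <ℝ c₁
  c₁>0 = ½ ^ℚ 5 , ^-pos (ℚₚ.positive⁻¹ ½) 5 , 0 , λ _ _ → ≤-reflexive (ℚₚ.+-identityˡ (½ ^ℚ 5))

  module LowerBound (m J : ℕ) (n<4^ : suc m ℕ.< 4 ℕ.^ suc J) where
    open ℚₚ.≤-Reasoning

    private
      n = ι (suc m)
      v = 1/ m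
      h = ½ ^ℚ 5
      -- The ε at which the hypothesis on `p` is used; it contributes ½ · 1/n to the final bound.
      e = ½ ^ℚ 4 * v

    scaled-square : ∀ s → s * s ≤ ι (2 ℕ.* (J ℕ.+ 2)) * v → ∀ c → 0ℚ ≤ c → c ≤ h * s + e →
      ι 64 * (n * (c * c)) ≤ ι (J ℕ.+ 2)
    scaled-square s s²≤ c c≥0 c≤ = begin
      ι 64 * (n * (c * c))
        ≤⟨ *-monoʳ (ι 64) (ι≥0 64) (*-monoʳ n (ι≥0 (suc m)) (≤-trans (*-mono c≥0 (≤-trans c≥0 c≤) c≤ c≤) (square-+ (h * s) e))) ⟩
      ι 64 * (n * (2ℚ * (h * s * (h * s)) + 2ℚ * (e * e)))
        ≡⟨ solve 3 (λ n s v → con (ι 64) :* (n :* (con 2ℚ :* (con h :* s :* (con h :* s)) :+ con 2ℚ :* (con (½ ^ℚ 4) :* v :* (con (½ ^ℚ 4) :* v))))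
             := con (½ ^ℚ 3) :* (n :* (s :* s)) :+ con ½ :* (n :* v) :* v) refl n s v ⟩
      ½ ^ℚ 3 * (n * (s * s)) + ½ * (n * v) * v
        ≤⟨ ℚₚ.+-mono-≤ (*-monoʳ (½ ^ℚ 3) (^-nonNeg 0≤½ 3) ns²≤)
             (≤-trans (≤-reflexive (cong (λ z → ½ * z * v) (ι*1/ m))) (*-monoʳ (½ * 1ℚ) 0≤½ (≤-trans (1/-anti {0} {m} ℕ.z≤n) 1≤J+2))) ⟩
      ½ ^ℚ 3 * (ι 2 * ι (J ℕ.+ 2)) + ½ * 1ℚ * ι (J ℕ.+ 2)
        ≡⟨ solve 1 (λ j → con (½ ^ℚ 3) :* (con (ι 2) :* j) :+ con ½ :* con 1ℚ :* j := con (½ * ½ + ½) :* j) refl (ι (J ℕ.+ 2)) ⟩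
      (½ * ½ + ½) * ι (J ℕ.+ 2)
        ≤⟨ *-monoˡ (ι (J ℕ.+ 2)) {½ * ½ + ½} {1ℚ} (ι≥0 (J ℕ.+ 2)) (ℚₚ.≤ᵇ⇒≤ {½ * ½ + ½} {1ℚ} _) ⟩
      1ℚ * ι (J ℕ.+ 2)
        ≡⟨ ℚₚ.*-identityˡ (ι (J ℕ.+ 2)) ⟩
      ι (J ℕ.+ 2) ∎
      where
      1≤J+2 : 1ℚ ≤ ι (J ℕ.+ 2)
      1≤J+2 = ι-mono {1} (ℕₚ.≤-trans (ℕ.s≤s ℕ.z≤n) (ℕₚ.m≤n+m 2 J))
      ns²≤ : n * (s * s) ≤ ι 2 * ι (J ℕ.+ 2)
      ns²≤ = begin
        n * (s * s)                              ≤⟨ *-monoʳ n (ι≥0 (suc m)) s²≤ ⟩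
        n * (ι (2 ℕ.* (J ℕ.+ 2)) * v)            ≡⟨ solve 3 (λ n w v → n :* (w :* v) := (n :* v) :* w) refl n (ι (2 ℕ.* (J ℕ.+ 2))) v ⟩
        n * v * ι (2 ℕ.* (J ℕ.+ 2))              ≡⟨ trans (cong (_* ι (2 ℕ.* (J ℕ.+ 2))) (ι*1/ m)) (ℚₚ.*-identityˡ _) ⟩
        ι (2 ℕ.* (J ℕ.+ 2))                      ≡⟨ ι-* 2 (J ℕ.+ 2) ⟩
        ι 2 * ι (J ℕ.+ 2)                        ∎

    -- n < 2^(2(J+1)) gives log n ≤ 2 (J + 1) + 2 by `log-upper`, already for every partial sum.
    threshold-square : ∀ k → seq (threshold (suc m)) k * seq (threshold (suc m)) k ≤ ι (2 ℕ.* (J ℕ.+ 2)) * v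
    threshold-square k = subst (λ s → s * s ≤ ι (2 ℕ.* (J ℕ.+ 2)) * v) (sym (seq-threshold m k))
      (≤-trans (sqrt-square k {LogBounds.S m k * v} (*-nonNeg S≥0 (1/≥0 m)))
        (*-monoˡ v (1/≥0 m) (subst (λ z → LogBounds.S m k ≤ ι z) shape (LogBounds.log-upper m (2 ℕ.* suc J) n≤ k))))
      where
      S≥0 : 0ℚ ≤ LogBounds.S m k
      S≥0 = LogBounds.S-mono′ m {0} {k} ℕ.z≤n
      n≤ : suc m ℕ.≤ 2 ℕ.^ (2 ℕ.* suc J)
      n≤ = ℕₚ.≤-trans (ℕₚ.<⇒≤ n<4^) (ℕₚ.≤-reflexive (ℕₚ.^-*-assoc 2 2 (suc J)))
      shape : suc (suc (2 ℕ.* suc J)) ≡ 2 ℕ.* (J ℕ.+ 2)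
      shape = trans (cong (λ z → suc (suc (2 ℕ.* z))) (ℕₚ.+-comm 1 J))
        (trans (ℕₚ.+-comm 2 (2 ℕ.* (J ℕ.+ 1))) (trans (sym (ℕₚ.*-distribˡ-+ 2 (J ℕ.+ 1) 1)) (cong (2 ℕ.*_) (ℕₚ.+-assoc J 1 1))))

    threshold≥0 : ∀ k → 0ℚ ≤ seq (threshold (suc m)) k
    threshold≥0 k = subst (0ℚ ≤_) (sym (seq-threshold m k)) (IsRoot.s≥0 (proj₂ (approxRoot k (LogBounds.S m k * v))))

    envelope : ℕ → ℚ
    envelope k = h * seq (threshold (suc m)) k + e

    envelope≥0 : ∀ k → 0ℚ ≤ envelope k
    envelope≥0 k = +-nonNeg {h * seq (threshold (suc m)) k} {e}
      (*-nonNeg {h} {seq (threshold (suc m)) k} (^-nonNeg 0≤½ 5) (threshold≥0 k))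
      (*-nonNeg {½ ^ℚ 4} {v} (^-nonNeg 0≤½ 4) (1/≥0 m))

  sparse⇒tc≥4-whp : (p : ℕ → ℝ) → (∀ n → 0ℝ ≤ℝ p n × p n ≤ℝ 1ℝ) →
    ForLarge (λ n → p n ≤ℝ c₁ *ℝ threshold n) →
    WithHighProbability p (λ n G → Tc₂≥ 4 (toGraph G))
  sparse⇒tc≥4-whp p 0≤p≤1 (n₀ , below) ε (δ , δ>0 , Nε , ε≥) =
    n₀ ℕ.⊔ 4 ℕ.^ suc J₀ , λ
      { zero h    → contradiction (ℕₚ.≤-trans (ℕₚ.m^n>0 4 (suc J₀)) (ℕₚ.m⊔n≤o⇒n≤o n₀ _ h)) (λ ())
      ; (suc m) h → Large.result m (ℕₚ.m⊔n≤o⇒m≤o n₀ _ h) (ℕₚ.m⊔n≤o⇒n≤o n₀ _ h) }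
    where
    k₀ = proj₁ (archimedean δ δ>0)
    -- `fail-bound` bounds the failure by 24/J, which is then at most 1/(k₀+1) ≤ δ.
    J₀ = 24 ℕ.* suc k₀
    module Large (m : ℕ) (n≥n₀ : n₀ ℕ.≤ suc m) (n≥4^ : 4 ℕ.^ suc J₀ ℕ.≤ suc m) where
      J∃ = ilog 4 (ℕ.s≤s (ℕ.s≤s ℕ.z≤n)) (suc m) (ℕ.s≤s ℕ.z≤n)
      J = proj₁ J∃
      J₀≤J : J₀ ℕ.≤ J
      J₀≤J = ilog-large 4 (ℕ.s≤s (ℕ.s≤s ℕ.z≤n)) n≥4^ (proj₂ (proj₂ J∃))
      1≤J : 1 ℕ.≤ J
      1≤J = ℕₚ.≤-trans (ℕ.s≤s ℕ.z≤n) J₀≤J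
      4^J≤ : 2 ℕ.^ J ℕ.* 2 ℕ.^ J ℕ.≤ suc m
      4^J≤ = ℕₚ.≤-trans (ℕₚ.≤-reflexive (trans (sym (ℕₚ.^-distribˡ-+-* 2 J J))
        (trans (cong (2 ℕ.^_) (cong (J ℕ.+_) (sym (ℕₚ.+-identityʳ J)))) (sym (ℕₚ.^-*-assoc 2 2 J))))) (proj₁ (proj₂ J∃))
      e = ½ ^ℚ 4 * 1/ m
      e>0 = *-pos (^-pos (ℚₚ.positive⁻¹ ½) 4) (1/>0 m)
      p≤ = below (suc m) n≥n₀ e e>0
      open LowerBound m J (proj₂ (proj₂ J∃))
      fail : ∀ k → proj₁ p≤ ℕ.≤ k → ∀ {η} (C : Clamp (seq (p (suc m)) k) η) → let open Clamp C in
        ℙ (Coins.graph c c≥0 c≤1 (suc m) (suc m)) (not ∘ hasIsolatedTriple) ≤ δ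
      fail k h C = scaled-≤ k₀ (proj₂ (archimedean δ δ>0)) 24 J₀≤J 1≤J
        (Coins.SparseTriples.fail-bound c c≥0 c≤1 m J 1≤J 4^J≤
          (scaled-square (seq (threshold (suc m)) k) (threshold-square k) c c≥0
            (upper (envelope k) (envelope≥0 k) (proj₂ p≤ k h))))
        where open Clamp C
      result : PrAtLeast (p (suc m)) (λ G → Tc₂≥ 4 (toGraph G)) (1ℝ -ℝ ε)
      result = hasIsolatedTriple , (λ B s → uncoverable⇒tc≥ B 3 (hasIsolatedTriple⇒uncoverable B s))
        , Pr-lower-bound {suc m} {suc m} (p (suc m)) (proj₁ (0≤p≤1 (suc m))) (proj₂ (0≤p≤1 (suc m))) hasIsolatedTriple δ (proj₁ p≤) fail ε
            (Nε , λ k h → subst (_≤ seq ε k) (ℚₚ.+-identityˡ δ) (ε≥ k h))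

-- The upper bound
module _ where
  open import Data.Rational using (_+_; _*_; _-_; -_; _≤_; _<_; ∣_∣)
  open import Data.Rational.Properties using (≤-trans; ≤-reflexive; ≤-refl)
  open +-*-Solver using (solve; _:+_; _:*_; :-_; _:-_; _:=_; con)
  open ℝ

  -- 2^17 = 2^15 · 2 · 2: the set sizes require n p ≥ 2^15 L, the bound log n ≥ L/4 halves the root,
  -- and the last factor 2 absorbs all slack and rounding.
  C₂ : ℝ
  C₂ = fromℚ (2ℚ ^ℚ 17)

  C₂>0 : 0ℝ <ℝ C₂
  C₂>0 = 2ℚ ^ℚ 17 , ^-pos (ℚₚ.positive⁻¹ 2ℚ) 17 , 0 , λ _ _ → ≤-reflexive (ℚₚ.+-identityˡ (2ℚ ^ℚ 17))

  square-cancel : ∀ {a b} → 0ℚ ≤ b → a * a ≤ b * b → a ≤ b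
  square-cancel {a} {b} b≥0 h = ℚₚ.≮⇒≥ λ b<a → ℚₚ.<-irrefl refl (begin-strict
    b * b   ≤⟨ *-monoʳ b b≥0 (ℚₚ.<⇒≤ b<a) ⟩
    b * a   <⟨ ℚₚ.*-monoˡ-<-pos a {{ℚ.positive (ℚₚ.≤-<-trans b≥0 b<a)}} b<a ⟩
    a * a   ≤⟨ h ⟩
    b * b   ∎)
    where open ℚₚ.≤-Reasoning

  -- The least `s` that reaches `a + 1` overshoots by at most one `q`, and `q ≤ 1ℚ`.
  ceiling : ∀ a q → 0ℚ < q → q ≤ 1ℚ → ∃[ s ] ι (suc a) ≤ ι s * q × ι s * q ≤ ι (suc (suc a))
  ceiling a q q>0 q≤1 = go (least (λ s → ι (suc a) ≤ ι s * q) (λ s → ι (suc a) ℚₚ.≤? ι s * q) exists)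
    where
    open ℚₚ.≤-Reasoning
    exists : ∃[ s ] ι (suc a) ≤ ι s * q
    exists = let k , h = archimedean q q>0 in suc a ℕ.* suc k , (begin
      ι (suc a)                      ≡⟨ trans (cong (ι (suc a) *_) (ι*1/ k)) (ℚₚ.*-identityʳ (ι (suc a))) ⟨
      ι (suc a) * (ι (suc k) * 1/ k) ≡⟨ trans (sym (ℚₚ.*-assoc (ι (suc a)) (ι (suc k)) (1/ k))) (cong (_* 1/ k) (sym (ι-* (suc a) (suc k)))) ⟩
      ι (suc a ℕ.* suc k) * 1/ k     ≤⟨ *-monoʳ (ι (suc a ℕ.* suc k)) (ι≥0 (suc a ℕ.* suc k)) h ⟩
      ι (suc a ℕ.* suc k) * q        ∎)
    go : (∃[ s ] ι (suc a) ≤ ι s * q × (∀ j → ι (suc a) ≤ ι j * q → s ℕ.≤ j)) →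
      ∃[ s ] ι (suc a) ≤ ι s * q × ι s * q ≤ ι (suc (suc a))
    go (zero , h , _) = contradiction (ℚₚ.<-≤-trans (ι>0 a) (≤-trans h (≤-reflexive (ℚₚ.*-zeroˡ q)))) (ℚₚ.<-irrefl refl)
    go (suc s , h , min) = suc s , h , (begin
      (1ℚ + ι s) * q     ≡⟨ solve 2 (λ s q → (con 1ℚ :+ s) :* q := q :+ s :* q) refl (ι s) q ⟩
      q + ι s * q        ≤⟨ ℚₚ.+-mono-≤ q≤1 (ℚₚ.≮⇒≥ λ lt → ℕₚ.<-irrefl refl (min s (ℚₚ.<⇒≤ lt))) ⟩
      1ℚ + ι (suc a)     ∎)

  -- Set sizes must be fixed before the index of a term is known. They are computed from one
  -- rational `q` that lies below all late terms and within `v + v` of them; `v` will be 1/n.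
  record Approximation (n v R : ℚ) (x : ℕ → ℚ) : Set where
    field
      q     : ℚ
      q≤1   : q ≤ 1ℚ
      R≤nq  : R ≤ n * q
      K     : ℕ
      lower : ∀ k → K ℕ.≤ k → q ≤ x k
      upper : ∀ k → K ℕ.≤ k → x k ≤ q + (v + v)

  -- R = 2¹⁵ L is the lower bound on n p that the hypothesis p ≥ 2¹⁷ √(log n / n) leaves.
  module Density (m l : ℕ) (2^L≤n : 2 ℕ.^ suc l ℕ.≤ suc m) where
    open ℚₚ.≤-Reasoning

    n v λL R : ℚ
    n  = ι (suc m)
    v  = 1/ m
    λL = ι (suc l)
    R  = 2ℚ ^ℚ 15 * λL

    n≥0 : 0ℚ ≤ n
    n≥0 = ι≥0 (suc m)

    v≥0 : 0ℚ ≤ v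
    v≥0 = 1/≥0 m

    L≤n : λL ≤ n
    L≤n = ι-mono (ℕₚ.≤-trans (ℕₚ.<⇒≤ (n<2^n (suc l))) 2^L≤n)

    R≥ : 2ℚ ^ℚ 15 ≤ R
    R≥ = subst (_≤ R) (ℚₚ.*-identityʳ (2ℚ ^ℚ 15)) (*-monoʳ (2ℚ ^ℚ 15) (^-nonNeg 0≤2 15) (x≤x+y 1ℚ (ι≥0 l)))

    R>0 : 0ℚ < R
    R>0 = ℚₚ.<-≤-trans (^-pos (ℚₚ.positive⁻¹ 2ℚ) 15) R≥

    -- Compared after squaring. From log n ≥ L/4 the right side is at least 2^16 √(L n), and L ≤ n
    -- makes this at least 2^16 L = 2R. The term `1/ k` makes up for the rounding of the root.
    root-bound : ∀ k → 2 ℕ.^ l ℕ.≤ k → R + R ≤ n * (2ℚ ^ℚ 17 * (seq (threshold (suc m)) k + 1/ k))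
    root-bound k h = square-cancel {R + R}
      (*-nonNeg n≥0 (*-nonNeg (^-nonNeg 0≤2 17) (+-nonNeg s≥0 (1/≥0 k)))) (begin
        (R + R) * (R + R)
          ≡⟨ solve 1 (λ a → (con (2ℚ ^ℚ 15) :* a :+ con (2ℚ ^ℚ 15) :* a) :* (con (2ℚ ^ℚ 15) :* a :+ con (2ℚ ^ℚ 15) :* a)
               := con (2ℚ ^ℚ 32) :* a :* a) refl λL ⟩
        2ℚ ^ℚ 32 * λL * λL
          ≤⟨ *-monoʳ (2ℚ ^ℚ 32 * λL) (*-nonNeg (^-nonNeg 0≤2 32) (ι≥0 (suc l))) L≤n ⟩
        2ℚ ^ℚ 32 * λL * n
          ≡⟨ solve 2 (λ a n → con (2ℚ ^ℚ 32) :* a :* n := con (2ℚ ^ℚ 34) :* (n :* con 1ℚ) :* (a :* con (½ * ½))) refl λL n ⟩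
        2ℚ ^ℚ 34 * (n * 1ℚ) * (λL * (½ * ½))
          ≡⟨ cong (λ z → 2ℚ ^ℚ 34 * (n * z) * (λL * (½ * ½))) (ι*1/ m) ⟨
        2ℚ ^ℚ 34 * (n * (n * v)) * (λL * (½ * ½))
          ≡⟨ solve 4 (λ n v a c → c :* (n :* (n :* v)) :* a := c :* (n :* n) :* (a :* v)) refl n v (λL * (½ * ½)) (2ℚ ^ℚ 34) ⟩
        2ℚ ^ℚ 34 * (n * n) * (λL * (½ * ½) * v)
          ≤⟨ *-monoʳ (2ℚ ^ℚ 34 * (n * n)) (*-nonNeg (^-nonNeg 0≤2 34) (*-nonNeg n≥0 n≥0))
               (≤-trans (*-monoˡ v v≥0 (LogBounds.log-lower m l 2^L≤n k h)) (ℚₚ.<⇒≤ above)) ⟩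
        2ℚ ^ℚ 34 * (n * n) * (y * y)
          ≡⟨ solve 2 (λ n y → con (2ℚ ^ℚ 34) :* (n :* n) :* (y :* y)
               := n :* (con (2ℚ ^ℚ 17) :* y) :* (n :* (con (2ℚ ^ℚ 17) :* y))) refl n y ⟩
        n * (2ℚ ^ℚ 17 * y) * (n * (2ℚ ^ℚ 17 * y)) ∎)
      where
      open IsRoot (proj₂ (approxRoot k (LogBounds.S m k * v)))
      y = sqrtℚ k (LogBounds.S m k * v) + 1/ k

    -- One half of 1/n is spent on the ε of the hypothesis and one on the rounding of the root;
    -- multiplied by n they cost 1 together.
    half : ℚ
    half = ½ * v

    half>0 : 0ℚ < half
    half>0 = *-pos (ℚₚ.positive⁻¹ ½) (1/>0 m)

    dense-terms : ∀ k x s → 2 ℕ.^ l ℕ.≤ k → s ≡ seq (threshold (suc m)) k →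
      2ℚ ^ℚ 17 * s ≤ x + half → 1/ k ≤ ½ ^ℚ 17 * half → R + R ≤ n * x + 1ℚ
    dense-terms k x s h s≡ dense fine = begin
      R + R
        ≤⟨ subst (λ s → R + R ≤ n * (2ℚ ^ℚ 17 * (s + 1/ k))) (sym s≡) (root-bound k h) ⟩
      n * (2ℚ ^ℚ 17 * (s + 1/ k))
        ≡⟨ cong (n *_) (ℚₚ.*-distribˡ-+ (2ℚ ^ℚ 17) s (1/ k)) ⟩
      n * (2ℚ ^ℚ 17 * s + 2ℚ ^ℚ 17 * 1/ k)
        ≤⟨ *-monoʳ n n≥0 (ℚₚ.+-mono-≤ dense small) ⟩
      n * (x + half + half)
        ≡⟨ solve 3 (λ n x v → n :* (x :+ con ½ :* v :+ con ½ :* v) := n :* x :+ n :* v) refl n x v ⟩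
      n * x + n * v
        ≡⟨ cong (n * x +_) (ι*1/ m) ⟩
      n * x + 1ℚ ∎
      where
      small : 2ℚ ^ℚ 17 * 1/ k ≤ half
      small = ≤-trans (*-monoʳ (2ℚ ^ℚ 17) {1/ k} {½ ^ℚ 17 * half} (^-nonNeg 0≤2 17) fine)
        (≤-reflexive (solve 1 (λ x → con (2ℚ ^ℚ 17) :* (con (½ ^ℚ 17) :* x) := x) refl half))

    dense⇒large : ∀ p → C₂ *ℝ threshold (suc m) ≤ℝ p →
      ∃[ K ] ∀ k → K ℕ.≤ k → R + R ≤ n * seq p k + 1ℚ
    dense⇒large p dense =
      let K₁ , d = dense half half>0
          K₂ , f = archimedean (½ ^ℚ 17 * half) (*-pos (^-pos (ℚₚ.positive⁻¹ ½) 17) half>0)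
      in K₁ ℕ.⊔ (2 ℕ.^ l ℕ.⊔ K₂) , λ k h →
        let h₂ = ℕₚ.m⊔n≤o⇒n≤o K₁ (2 ℕ.^ l ℕ.⊔ K₂) h in
        dense-terms k (seq p k) (seq (threshold (suc m)) k) (ℕₚ.m⊔n≤o⇒m≤o (2 ℕ.^ l) K₂ h₂) refl
          (d k (ℕₚ.m⊔n≤o⇒m≤o K₁ (2 ℕ.^ l ℕ.⊔ K₂) h))
          (≤-trans (1/-anti (ℕₚ.m⊔n≤o⇒n≤o (2 ℕ.^ l) K₂ h₂)) f)

    shifted-lower : ∀ a → R + R ≤ n * a + 1ℚ → R ≤ n * (a - v)
    shifted-lower a h = begin
      R                             ≡⟨ solve 1 (λ r → r := r :+ r :- r) refl R ⟩
      R + R - R                     ≤⟨ ℚₚ.+-mono-≤ {R + R} {n * a + 1ℚ} { - R} { - 2ℚ} h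
                                         (ℚₚ.neg-antimono-≤ (≤-trans (ℚₚ.≤ᵇ⇒≤ {2ℚ} {2ℚ ^ℚ 15} _) R≥)) ⟩
      n * a + 1ℚ - 2ℚ               ≡⟨ solve 1 (λ x → x :+ con 1ℚ :- con 2ℚ := x :- con 1ℚ) refl (n * a) ⟩
      n * a - 1ℚ                    ≡⟨ cong (λ z → n * a - z) (sym (ι*1/ m)) ⟩
      n * a - n * v                 ≡⟨ solve 3 (λ n a v → n :* a :- n :* v := n :* (a :- v)) refl n a v ⟩
      n * (a - v)                   ∎

    near-lower : ∀ a x → ∣ a - x ∣ ≤ v → a - v ≤ x
    near-lower a x close = begin
      a - v             ≡⟨ solve 3 (λ a v x → a :- v := x :+ (a :- x) :- v) refl a v x ⟩
      x + (a - x) - v   ≤⟨ ℚₚ.+-monoˡ-≤ (- v) (ℚₚ.+-monoʳ-≤ x (≤-trans (x≤∣x∣ (a - x)) close)) ⟩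
      x + v - v         ≡⟨ solve 2 (λ x v → x :+ v :- v := x) refl x v ⟩
      x                 ∎

    near-upper : ∀ a x → ∣ a - x ∣ ≤ v → x ≤ a - v + (v + v)
    near-upper a x close = begin
      x                 ≡⟨ solve 2 (λ a x → x := a :+ (:- (a :- x))) refl a x ⟩
      a + - (a - x)     ≤⟨ ℚₚ.+-monoʳ-≤ a (≤-trans (-x≤∣x∣ (a - x)) close) ⟩
      a + v             ≡⟨ solve 2 (λ a v → a :+ v := a :- v :+ (v :+ v)) refl a v ⟩
      a - v + (v + v)   ∎

    below-one : ∀ a → a ≤ 1ℚ + v → a - v ≤ 1ℚ
    below-one a h = ≤-trans (ℚₚ.+-monoˡ-≤ (- v) h)
      (≤-reflexive (solve 1 (λ v → con 1ℚ :+ v :- v := con 1ℚ) refl v))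

    module _ (p : ℝ) (p≤1 : p ≤ℝ 1ℝ) (K₁ : ℕ)
      (large : ∀ k → K₁ ℕ.≤ k → R + R ≤ n * seq p k + 1ℚ) where

      approximation : Approximation n v R (seq p)
      approximation = record
        { q     = a - v
        ; q≤1   = below-one a (proj₂ K₄∃ K hK₄)
        ; R≤nq  = shifted-lower a (large K (ℕₚ.m≤m⊔n K₁ K₃₄))
        ; K     = K
        ; lower = λ k h → near-lower a (seq p k) (close k h)
        ; upper = λ k h → near-upper a (seq p k) (close k h)
        }
        where
        K₃∃ = cauchy p v (1/>0 m)
        K₄∃ = p≤1 v (1/>0 m)
        K₃₄ = proj₁ K₃∃ ℕ.⊔ proj₁ K₄∃
        K = K₁ ℕ.⊔ K₃₄
        hK₃₄ : K₃₄ ℕ.≤ K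
        hK₃₄ = ℕₚ.m≤n⊔m K₁ K₃₄
        hK₃ : proj₁ K₃∃ ℕ.≤ K
        hK₃ = ℕₚ.m⊔n≤o⇒m≤o (proj₁ K₃∃) (proj₁ K₄∃) hK₃₄
        hK₄ : proj₁ K₄∃ ℕ.≤ K
        hK₄ = ℕₚ.m⊔n≤o⇒n≤o (proj₁ K₃∃) (proj₁ K₄∃) hK₃₄
        a = seq p K
        close : ∀ k → K ℕ.≤ k → ∣ a - seq p k ∣ ≤ v
        close k h = proj₂ K₃∃ K k hK₃ (ℕₚ.≤-trans hK₃ h)

  module Parameters (m l : ℕ) (2^L≤n : 2 ℕ.^ suc l ℕ.≤ suc m) (n<2^ : suc m ℕ.< 2 ℕ.^ suc (suc l))
    (512≤L : 512 ℕ.≤ suc l) (x : ℕ → ℚ)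
    (A : Approximation (Density.n m l 2^L≤n) (Density.v m l 2^L≤n) (Density.R m l 2^L≤n) x) where
    open Density m l 2^L≤n
    open Approximation A
    open ℚₚ.≤-Reasoning

    N L : ℕ
    N = suc m
    L = suc l

    Rv≤q : R * v ≤ q
    Rv≤q = *1/≤ m R≤nq

    q>0 : 0ℚ < q
    q>0 = ℚₚ.<-≤-trans (*-pos R>0 (1/>0 m)) Rv≤q

    s∃ : ∃[ s ] ι 20 ≤ ι s * q × ι s * q ≤ ι 21
    s∃ = ceiling 19 q q>0 q≤1

    b∃ : ∃[ b ] ι 1 ≤ ι b * q × ι b * q ≤ ι 2
    b∃ = ceiling 0 q q>0 q≤1

    s b d : ℕ
    s = proj₁ s∃
    b = proj₁ b∃
    d = N ℕ./ 256

    sq≤21 : ι s * q ≤ ι 21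
    sq≤21 = proj₂ (proj₂ s∃)

    10b≤s : 10 ℕ.* b ℕ.≤ s
    10b≤s = ι-cancel-≤ (*-cancelʳ {ι (10 ℕ.* b)} {ι s} q q>0 (begin
      ι (10 ℕ.* b) * q      ≡⟨ trans (cong (_* q) (ι-* 10 b)) (ℚₚ.*-assoc (ι 10) (ι b) q) ⟩
      ι 10 * (ι b * q)      ≤⟨ *-monoʳ (ι 10) {ι b * q} {ι 2} (ι≥0 10) (proj₂ (proj₂ b∃)) ⟩
      ι 20                  ≤⟨ proj₁ (proj₂ s∃) ⟩
      ι s * q               ∎))

    0<s : 0 ℕ.< s
    0<s = go s (proj₁ (proj₂ s∃))
      where
      go : ∀ s → ι 20 ≤ ι s * q → 0 ℕ.< s
      go zero h = contradiction (ℚₚ.<-≤-trans (ι>0 19) (≤-trans h (≤-reflexive (ℚₚ.*-zeroˡ q)))) (ℚₚ.<-irrefl refl)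
      go (suc s) _ = ℕ.s≤s ℕ.z≤n

    -- b q ≥ 1 gives (1 - q)^b ≤ 1/(1 + b q) ≤ ½, and `s` contains ten such exponents because s q ≥
    -- 20 ≥ 10 b q.
    decay : ∀ c → q ≤ c → c ≤ 1ℚ → (1ℚ - c) ^ℚ s ≤ ½ ^ℚ 10
    decay c q≤c c≤1 = begin
      (1ℚ - c) ^ℚ s              ≤⟨ ^-monoˡ (≤⇒0≤- c≤1) (ℚₚ.+-monoʳ-≤ 1ℚ (ℚₚ.neg-antimono-≤ q≤c)) s ⟩
      (1ℚ - q) ^ℚ s              ≤⟨ ^-antiʳ (≤⇒0≤- q≤1) (x-y≤x 1ℚ (ℚₚ.<⇒≤ q>0)) 10b≤s ⟩
      (1ℚ - q) ^ℚ (10 ℕ.* b)     ≡⟨ ^-* (1ℚ - q) 10 b ⟩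
      ((1ℚ - q) ^ℚ b) ^ℚ 10      ≤⟨ ^-monoˡ (^-nonNeg (≤⇒0≤- q≤1) b) halved 10 ⟩
      ½ ^ℚ 10                    ∎
      where
      P = (1ℚ - q) ^ℚ b
      halved : P ≤ ½
      halved = *-cancelʳ {P} {½} 2ℚ (ℚₚ.positive⁻¹ 2ℚ) (≤-trans
        (*-monoʳ P {2ℚ} {1ℚ + ι b * q} (^-nonNeg (≤⇒0≤- q≤1) b) (ℚₚ.+-monoʳ-≤ 1ℚ (proj₁ (proj₂ b∃))))
        (reciprocal-bernoulli q (ℚₚ.<⇒≤ q>0) q≤1 b))

    -- One quantity for two demands: 2X covers the exponent (L + 2) s + L of the union bound and
    -- also the 1024 s required of the hubs.
    X : ℕ
    X = (L ℕ.+ 512) ℕ.* s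

    -- With L + 512 ≤ 2L and s q ≤ 21 this needs n q ≥ 512 · 21 · 2 L, and 512 · 21 · 2 = 21504 is
    -- below the 2^15 in `R`.
    512X≤N : 512 ℕ.* X ℕ.≤ N
    512X≤N = ι-cancel-≤ (*-cancelʳ {ι (512 ℕ.* X)} {ι N} q q>0 (begin
      ι (512 ℕ.* X) * q
        ≡⟨ cong (_* q) (trans (ι-* 512 X) (cong (ι 512 *_) (ι-* (L ℕ.+ 512) s))) ⟩
      ι 512 * (ι (L ℕ.+ 512) * ι s) * q
        ≡⟨ solve 4 (λ a b s q → a :* (b :* s) :* q := a :* (b :* (s :* q))) refl (ι 512) (ι (L ℕ.+ 512)) (ι s) q ⟩
      ι 512 * (ι (L ℕ.+ 512) * (ι s * q))
        ≤⟨ *-monoʳ (ι 512) (ι≥0 512) (*-mono {ι (L ℕ.+ 512)} {ι (L ℕ.+ L)} {ι s * q} {ι 21}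
             (*-nonNeg (ι≥0 s) (ℚₚ.<⇒≤ q>0)) (ι≥0 (L ℕ.+ L)) (ι-mono (ℕₚ.+-monoʳ-≤ L 512≤L)) sq≤21) ⟩
      ι 512 * (ι (L ℕ.+ L) * ι 21)
        ≡⟨ trans (cong (λ z → ι 512 * (z * ι 21)) (ι-+ L L))
             (solve 3 (λ a l c → a :* ((l :+ l) :* c) := a :* c :* con 2ℚ :* l) refl (ι 512) λL (ι 21)) ⟩
      ι 512 * ι 21 * 2ℚ * λL
        ≤⟨ *-monoˡ λL {ι 512 * ι 21 * 2ℚ} {2ℚ ^ℚ 15} (ι≥0 L) (ℚₚ.≤ᵇ⇒≤ {ι 512 * ι 21 * 2ℚ} {2ℚ ^ℚ 15} _) ⟩
      R
        ≤⟨ R≤nq ⟩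
      ι N * q ∎))

    N<256[d+1] : N ℕ.< 256 ℕ.* (d ℕ.+ 1)
    N<256[d+1] = ℕₚ.<-≤-trans (subst (ℕ._< 256 ℕ.+ d ℕ.* 256) (sym (ℕD.m≡m%n+[m/n]*n N 256))
        (ℕₚ.+-monoˡ-< (d ℕ.* 256) (ℕD.m%n<n N 256)))
      (ℕₚ.≤-reflexive (trans (cong (256 ℕ.+_) (ℕₚ.*-comm d 256))
        (trans (sym (ℕₚ.*-suc 256 d)) (cong (256 ℕ.*_) (ℕₚ.+-comm 1 d)))))

    2X≤d : 2 ℕ.* X ℕ.≤ d
    2X≤d = ℕₚ.≤-pred (ℕₚ.<-≤-trans (ℕₚ.*-cancelˡ-< 256 (2 ℕ.* X) (d ℕ.+ 1)
        (ℕₚ.≤-<-trans (ℕₚ.≤-trans (ℕₚ.≤-reflexive (sym (ℕₚ.*-assoc 256 2 X))) 512X≤N) N<256[d+1]))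
      (ℕₚ.≤-reflexive (ℕₚ.+-comm d 1)))

    L≤X : L ℕ.≤ X
    L≤X = ℕₚ.≤-trans (ℕₚ.m≤m+n L 512) (ℕₚ.m≤m*n (L ℕ.+ 512) s {{ℕ.>-nonZero 0<s}})

    X+X≤d : X ℕ.+ X ℕ.≤ d
    X+X≤d = ℕₚ.≤-trans (ℕₚ.≤-reflexive (cong (X ℕ.+_) (sym (ℕₚ.+-identityʳ X)))) 2X≤d

    budget : (L ℕ.+ 2) ℕ.* s ℕ.+ L ℕ.≤ d
    budget = ℕₚ.≤-trans (ℕₚ.+-mono-≤ (ℕₚ.*-monoˡ-≤ s (ℕₚ.+-monoʳ-≤ L (ℕₚ.≤ᵇ⇒≤ 2 512 _))) L≤X) X+X≤d

    M : ℕ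
    M = d ℕ.+ d

    0<d : 0 ℕ.< d
    0<d = ℕₚ.<-≤-trans (ℕ.s≤s ℕ.z≤n) (ℕₚ.≤-trans L≤X (ℕₚ.≤-trans (ℕₚ.m≤m+n X X) X+X≤d))

    N<256M : N ℕ.< 256 ℕ.* M
    N<256M = ℕₚ.<-≤-trans N<256[d+1] (ℕₚ.*-monoʳ-≤ 256 (ℕₚ.+-monoʳ-≤ d 0<d))

    1024s≤M : 4 ℕ.* (256 ℕ.* s) ℕ.≤ M
    1024s≤M = ℕₚ.≤-trans (ℕₚ.≤-reflexive (trans (sym (ℕₚ.*-assoc 4 256 s)) (ℕₚ.*-assoc 2 512 s)))
      (ℕₚ.≤-trans (ℕₚ.*-monoʳ-≤ 2 (ℕₚ.*-monoˡ-≤ s (ℕₚ.m≤n+m 512 L))) (ℕₚ.≤-trans 2X≤d (ℕₚ.m≤m+n d d)))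

    -- Three parts of size 3 · 14 · M with M = 2d make 252 d, just below 256 d ≤ N; this fixes the
    -- divisor 256 in `d`.
    thirds : let t = 3 ℕ.* (14 ℕ.* M) in t ℕ.+ (t ℕ.+ t) ℕ.≤ N
    thirds = ℕₚ.≤-trans (ℕₚ.≤-reflexive sum≡) (ℕₚ.≤-trans (ℕₚ.*-monoˡ-≤ d (ℕₚ.≤ᵇ⇒≤ 252 256 _))
      (ℕₚ.≤-trans (ℕₚ.≤-reflexive (ℕₚ.*-comm 256 d)) (ℕD.m/n*n≤m N 256)))
      where
      t≡ : 3 ℕ.* (14 ℕ.* M) ≡ 84 ℕ.* d
      t≡ = trans (cong (λ z → 3 ℕ.* (14 ℕ.* z)) (cong (d ℕ.+_) (sym (ℕₚ.+-identityʳ d))))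
        (trans (cong (3 ℕ.*_) (sym (ℕₚ.*-assoc 14 2 d))) (sym (ℕₚ.*-assoc 3 28 d)))
      sum≡ : 3 ℕ.* (14 ℕ.* M) ℕ.+ (3 ℕ.* (14 ℕ.* M) ℕ.+ 3 ℕ.* (14 ℕ.* M)) ≡ 252 ℕ.* d
      sum≡ = trans (cong (λ z → z ℕ.+ (z ℕ.+ z)) t≡)
        (trans (cong (84 ℕ.* d ℕ.+_) (sym (ℕₚ.*-distribʳ-+ d 84 84))) (sym (ℕₚ.*-distribʳ-+ d 84 168)))

    -- As q ≥ R/n ≥ 32/n, the error 2/n is at most q/16, so the product is at most 8 · 21 · 17/16 =
    -- 178.5.
    few : ∀ {k y} → k ℕ.≤ 8 ℕ.* s → 0ℚ ≤ y → y ≤ q + (v + v) → ι k * y ≤ ι 200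
    few {k} {y} k≤ y≥0 y≤ = begin
      ι k * y                        ≤⟨ *-mono {ι k} {ι 8 * ι s} {y} {q + q * (½ ^ℚ 4)} y≥0 (*-nonNeg (ι≥0 8) (ι≥0 s))
                                          (≤-trans (ι-mono k≤) (≤-reflexive (ι-* 8 s)))
                                          (≤-trans y≤ (ℚₚ.+-monoʳ-≤ q 2v≤)) ⟩
      ι 8 * ι s * (q + q * (½ ^ℚ 4)) ≡⟨ solve 4 (λ a s q h → a :* s :* (q :+ q :* h) := (s :* q) :* (a :* (con 1ℚ :+ h))) refl (ι 8) (ι s) q (½ ^ℚ 4) ⟩
      ι s * q * (ι 8 * (1ℚ + ½ ^ℚ 4)) ≤⟨ *-monoˡ (ι 8 * (1ℚ + ½ ^ℚ 4)) {ι s * q} {ι 21} (ℚₚ.≤ᵇ⇒≤ {0ℚ} {ι 8 * (1ℚ + ½ ^ℚ 4)} _) sq≤21 ⟩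
      ι 21 * (ι 8 * (1ℚ + ½ ^ℚ 4))   ≤⟨ ℚₚ.≤ᵇ⇒≤ {ι 21 * (ι 8 * (1ℚ + ½ ^ℚ 4))} {ι 200} _ ⟩
      ι 200                          ∎
      where
      2v≤ : v + v ≤ q * (½ ^ℚ 4)
      2v≤ = begin
        v + v                        ≡⟨ solve 1 (λ v → v :+ v := con (2ℚ ^ℚ 5) :* v :* con (½ ^ℚ 4)) refl v ⟩
        2ℚ ^ℚ 5 * v * ½ ^ℚ 4         ≤⟨ *-monoˡ (½ ^ℚ 4) {2ℚ ^ℚ 5 * v} {q} (^-nonNeg 0≤½ 4) (≤-trans
                                          (*-monoˡ v {2ℚ ^ℚ 5} {R} v≥0 (≤-trans (ℚₚ.≤ᵇ⇒≤ {2ℚ ^ℚ 5} {2ℚ ^ℚ 15} _) R≥)) Rv≤q) ⟩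
        q * ½ ^ℚ 4                   ∎

    failure : ∀ c (c≥0 : 0ℚ ≤ c) (c≤1 : c ≤ 1ℚ) → q ≤ c →
      ℙ (Coins.graph c c≥0 c≤1 N N) (not ∘ not ∘ gappy s M) * ι L ≤ ι 8
    failure c c≥0 c≤1 q≤c = ≤-trans
      (≤-reflexive (cong (_* ι L) (𝔼-cong (Coins.graph c c≥0 c≤1 N N) λ B → cong ind (not-involutive (hasGap s M B ∨ hasGap M s B)))))
      (Gaps.gappy-bound c c≥0 c≤1 N L s d (ℕₚ.≤-trans (ℕₚ.<⇒≤ n<2^) (ℕₚ.≤-reflexive (cong (2 ℕ.^_) (ℕₚ.+-comm 1 L))))
        (ℕₚ.<⇒≤ N<256[d+1]) (decay c q≤c c≤1) budget)

  ≤-divide : ∀ {a b} y (y>0 : 0ℚ < y) → a * y ≤ b → a ≤ b * recip y y>0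
  ≤-divide {a} {b} y y>0 h = begin
    a                      ≡⟨ ℚₚ.*-identityʳ a ⟨
    a * 1ℚ                 ≡⟨ cong (a *_) (ℚₚ.*-inverseʳ y {{ℚ.>-nonZero y>0}}) ⟨
    a * (y * recip y y>0)  ≡⟨ ℚₚ.*-assoc a y (recip y y>0) ⟨
    a * y * recip y y>0    ≤⟨ *-monoˡ (recip y y>0) {a * y} {b} (ℚₚ.<⇒≤ (recip>0 y y>0)) h ⟩
    b * recip y y>0        ∎
    where
    open ℚₚ.≤-Reasoning

  FewMissed : ℝ → ∀ n → BipartiteGraph n n → Set
  FewMissed p n G = Σ[ p>0 ∈ 0ℝ <ℝ p ] AlmostCoverable (toGraph G) 3 (fromℕ 200 *ℝ inv p p>0)

  module UpperBound (m l : ℕ) (2^L≤n : 2 ℕ.^ suc l ℕ.≤ suc m) (n<2^ : suc m ℕ.< 2 ℕ.^ suc (suc l))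
    (512≤L : 512 ℕ.≤ suc l) (p : ℝ)
    (A : Approximation (Density.n m l 2^L≤n) (Density.v m l 2^L≤n) (Density.R m l 2^L≤n) (seq p)) where
    open Density m l 2^L≤n using (n; v; R)
    open Approximation A
    open Parameters m l 2^L≤n n<2^ 512≤L (seq p) A

    -- The witness `q` becomes the floor inside `inv`, whose terms are the reciprocals of
    -- `seq p k ⊔ q`. For late terms these denominators still satisfy the bound `q + (v + v)` that
    -- `few` needs.
    p>0 : 0ℝ <ℝ p
    p>0 = q , q>0 , K , λ k h → subst (_≤ seq p k) (sym (ℚₚ.+-identityˡ q)) (lower k h)

    v≥0 : 0ℚ ≤ v
    v≥0 = 1/≥0 m

    few-vertices : ∀ N′ → N′ ℕ.≤ 8 ℕ.* s → fromℕ N′ ≤ℝ fromℕ 200 *ℝ inv p p>0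
    few-vertices N′ h ξ ξ>0 = K , λ k K≤k → ≤-trans (bound k K≤k) (x≤x+y _ (ℚₚ.<⇒≤ ξ>0))
      where
      bound : ∀ k → K ℕ.≤ k → seq (fromℕ N′) k ≤ seq (fromℕ 200 *ℝ inv p p>0) k
      bound k K≤k = subst₂ (λ a b → a ≤ b * recip (seq p k ℚ.⊔ q) y>0) (ι-/1 N′) (ι-/1 200)
        (≤-divide (seq p k ℚ.⊔ q) y>0
          (few h (ℚₚ.<⇒≤ y>0) (ℚₚ.⊔-lub (upper k K≤k) (x≤x+y q (+-nonNeg v≥0 v≥0)))))
        where
        y>0 : 0ℚ < seq p k ℚ.⊔ q
        y>0 = ℚₚ.<-≤-trans q>0 (ℚₚ.p≤q⊔p (seq p k) q)

    coverable : (B : BipartiteGraph N N) → T (not (gappy s M B)) →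
      AlmostCoverable (toGraph B) 3 (fromℕ 200 *ℝ inv p p>0)
    coverable B ¬gappy χ =
      let k , k≤3 , t , disjoint , xs , few-xs , covers = Cover.small-cover B χ {s} {M} {256}
            (gapless⇒expands s M B λ g → not⁻ ¬gappy (∨⁺ˡ g))
            (gapless⇒expands M s B λ g → not⁻ ¬gappy (∨⁺ʳ {hasGap s M B} g))
            0<s N<256M 1024s≤M thirds
      in k , k≤3 , t , disjoint , xs , few-vertices (length xs) few-xs , covers

    result : 0ℝ ≤ℝ p → p ≤ℝ 1ℝ → ∀ ε δ → (∃[ N′ ] ∀ k → N′ ℕ.≤ k → δ ≤ seq ε k) →
      ∀ k₀ → 1/ k₀ ≤ δ → 8 ℕ.* suc k₀ ℕ.≤ L →
      PrAtLeast {N} {N} p (FewMissed p N) (1ℝ -ℝ ε)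
    result p≥0 p≤1 ε δ δ≤ε k₀ k₀≤ L≥ = not ∘ gappy s M , (λ B g → p>0 , coverable B g)
      , Pr-lower-bound {N} {N} p p≥0 p≤1 (not ∘ gappy s M) δ K
          (λ k h C → scaled-≤ k₀ k₀≤ 8 L≥ (ℕ.s≤s ℕ.z≤n)
            (failure (Clamp.c C) (Clamp.c≥0 C) (Clamp.c≤1 C) (Clamp.lower C q q≤1 (lower k h))))
          ε δ≤ε

  module _ (L₀ k₀ : ℕ) (512≤L₀ : 512 ℕ.≤ L₀) (8k₀≤L₀ : 8 ℕ.* suc k₀ ℕ.≤ L₀)
    (m : ℕ) (p : ℝ) (p≥0 : 0ℝ ≤ℝ p) (p≤1 : p ≤ℝ 1ℝ) (dense : C₂ *ℝ threshold (suc m) ≤ℝ p)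
    (ε : ℝ) (δ : ℚ) (δ≤ε : ∃[ N′ ] ∀ k → N′ ℕ.≤ k → δ ≤ seq ε k) (k₀≤ : 1/ k₀ ≤ δ) where

    private
      Goal : Set
      Goal = PrAtLeast {suc m} {suc m} p (FewMissed p (suc m)) (1ℝ -ℝ ε)

      with-exponent : ∀ e → 2 ℕ.^ e ℕ.≤ suc m → suc m ℕ.< 2 ℕ.^ suc e → L₀ ℕ.≤ e → Goal
      with-exponent zero lo hi L₀≤ = contradiction (ℕₚ.≤-trans 512≤L₀ L₀≤) (λ ())
      with-exponent (suc l) lo hi L₀≤ = UpperBound.result m l lo hi (ℕₚ.≤-trans 512≤L₀ L₀≤) p
        (Density.approximation m l lo p p≤1 (proj₁ large) (proj₂ large))
        p≥0 p≤1 ε δ δ≤ε k₀ k₀≤ (ℕₚ.≤-trans 8k₀≤L₀ L₀≤)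
        where
        large = Density.dense⇒large m l lo p dense

    few-missed-whp : 2 ℕ.^ suc L₀ ℕ.≤ suc m → Goal
    few-missed-whp n≥ = let e , lo , hi = ilog 2 (ℕ.s≤s (ℕ.s≤s ℕ.z≤n)) (suc m) (ℕ.s≤s ℕ.z≤n) in
      with-exponent e lo hi (ilog-large 2 (ℕ.s≤s (ℕ.s≤s ℕ.z≤n)) {L₀} {e} n≥ hi)

  dense⇒fewMissed-whp : (p : ℕ → ℝ) → (∀ n → 0ℝ ≤ℝ p n × p n ≤ℝ 1ℝ) →
    ForLarge (λ n → C₂ *ℝ threshold n ≤ℝ p n) →
    WithHighProbability p (λ n → FewMissed (p n) n)
  dense⇒fewMissed-whp p 0≤p≤1 (n₀ , dense) ε (δ , δ>0 , Nε , ε≥) =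
    -- The first bound makes the failure 8/L at most 1/(k₀+1) ≤ δ; the second gives L + 512 ≤ 2L.
    go (8 ℕ.* suc k₀ ℕ.⊔ 512) (ℕₚ.m≤n⊔m (8 ℕ.* suc k₀) 512) (ℕₚ.m≤m⊔n (8 ℕ.* suc k₀) 512)
    where
    k₀ = proj₁ (archimedean δ δ>0)
    go : ∀ L₀ → 512 ℕ.≤ L₀ → 8 ℕ.* suc k₀ ℕ.≤ L₀ → ∃[ N ] ∀ n → N ℕ.≤ n → PrAtLeast (p n) (FewMissed (p n) n) (1ℝ -ℝ ε)
    go L₀ 512≤L₀ 8k₀≤L₀ = n₀ ℕ.⊔ 2 ℕ.^ suc L₀ , λ
      { zero h    → contradiction (ℕₚ.≤-trans (ℕₚ.m^n>0 2 (suc L₀)) (ℕₚ.m⊔n≤o⇒n≤o n₀ _ h)) (λ ())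
      ; (suc m) h → few-missed-whp L₀ k₀ 512≤L₀ 8k₀≤L₀ m (p (suc m))
          (proj₁ (0≤p≤1 (suc m))) (proj₂ (0≤p≤1 (suc m))) (dense (suc m) (ℕₚ.m⊔n≤o⇒m≤o n₀ _ h))
          ε δ (Nε , λ k h → subst (_≤ seq ε k) (ℚₚ.+-identityˡ δ) (ε≥ k h))
          (proj₂ (archimedean δ δ>0)) (ℕₚ.m⊔n≤o⇒n≤o n₀ _ h) }

theorem1p4 : ∃[ c ] ∃[ C ] 0ℝ <ℝ c × 0ℝ <ℝ C ×
    ((p : ℕ → ℝ) → (∀ n → 0ℝ ≤ℝ p n × p n ≤ℝ 1ℝ) →
    (ForLarge (λ n → p n ≤ℝ c *ℝ threshold n) →
    WithHighProbability p (λ n G → Tc₂≥ 4 (toGraph G)))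
    ×
    (ForLarge (λ n → C *ℝ threshold n ≤ℝ p n) →
    WithHighProbability p (λ n G →
    Σ[ p>0 ∈ 0ℝ <ℝ p n ]
    AlmostCoverable (toGraph G) 3 (fromℕ 200 *ℝ inv (p n) p>0))))
theorem1p4 = c₁ , C₂ , c₁>0 , C₂>0 , λ p 0≤p≤1 → sparse⇒tc≥4-whp p 0≤p≤1 , dense⇒fewMissed-whp p 0≤p≤1
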